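{- Let $1\le m\le n$, $\pi\in\mathfrak S_{m,n}$ and $\beta\in\{\mathsf w,\mathsf e\}^m$. The $B$-leading form of $G^\beta_\pi$ (the sum of its terms containing the maximal power of $B$) is \[B^{mn-\ell(\hat\pi)}\,S^\beta_\pi(A+x_1,\dots,A+x_m,y_1,\dots,y_n).\] Furthermore, only nongeneric hybrid pipe dreams contribute to this $B$-leading form, and the $B$-leading form of the weight of each nongeneric hybrid pipe dream of type $\beta$ with connectivity $\pi$ equals $B^{mn-\ell(\hat\pi)}$ times its contribution to $S^\beta_\pi$ evaluated at $x_k\mapsto A+x_k$.
   Context: $\mathfrak S_{m,n}$ is the set of injective maps $\pi:\{1,\dots,m\}\to\{1,\dots,n\}$. For $\pi\in\mathfrak S_{m,n}$ let $j_1<\dots<j_{n-m}$ be the elements of $\{1,\dots,n\}$ not in the image of $\pi$ and define $\hat\pi\in\mathfrak S_n$ by $\hat\pi(i)=\pi(i)$ ($i\le m$), $\hat\pi(m+k)=j_k$. $\ell(w)=\#\{i<j: w(i)>w(j)\}$ is the number of inversions. Row $i$ of an $m\times n$ grid has type $\beta_i$. A hybrid generic pipe dream of type $\beta$ fills the grid with tiles (unit squares in which pipes join edge midpoints). Rows of type $\mathsf w$ allow: blank; straight tiles horizontal (West–East), vertical (South–North), cross; elbow tiles West–North, South–East, double elbow (both). Rows of type $\mathsf e$ allow: blank; the same straight tiles; elbow tiles East–North, South–West, double elbow (both). Conditions: no pipe starts or ends inside the grid; each $\mathsf w$ row has a pipe entering through its West boundary edge and none exiting East; each $\mathsf e$ row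 has a pipe entering through its East boundary edge and none exiting West; no pipe crosses the South boundary; double crossings are allowed. Pipes are numbered counterclockwise from the northwest corner (West-entering $1,\dots,k$ top to bottom, East-entering $k+1,\dots,m$ bottom to top); $\varphi(i)$ is the number of the pipe entering row $i$; the connectivity is $\pi$ with pipe $i$ exiting North in column $\pi(i)$. The weight of such a pipe dream is the product over tiles at $(i,j)$ of: $A+B$ for elbows; if $\beta_i=\mathsf w$, $B-x_{\varphi(i)}+y_j$ for blank and $A+x_{\varphi(i)}-y_j$ for straight tiles; if $\beta_i=\mathsf e$, $A+x_{\varphi(i)}-y_j$ for blank and $B-x_{\varphi(i)}+y_j$ for straight tiles; $G^\beta_\pi$ is the sum of weights over those of type $\beta$ with connectivity $\pi$. A nongeneric hybrid pipe dream is a hybrid generic pipe dream with no vertical tile in $\mathsf w$ rows, no double elbow in $\mathsf e$ rows, and no two pipes crossing twice; $S^\beta_\pi\in\mathbb Z[x_1,\dots,x_m,y_1,\dots,y_n]$ is the sum over nongeneric ones of type $\beta$ and connectivity $\pi$ of the product over tiles of: $x_{\varphi(i)}-y_j$ for straight tiles if $\beta_i=\mathsf w$, $x_{\varphi(i)}-y_j$ for blank tiles if $\beta_i=\mathsf e$, and $1$ otherwise. -}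

module Defs where

open import Data.Bool using (Bool; true; false; _∧_; _∨_; not; if_then_else_; T)
open import Data.Bool.Properties as BoolP using ()
open import Data.Nat as ℕ using (ℕ; zero; suc; _+_; _*_; _∸_; _≡ᵇ_; _<ᵇ_; _<?_)
open import Data.Integer as ℤ using (ℤ; 0ℤ; 1ℤ)
open import Data.Fin using (Fin; toℕ; fromℕ<)
open import Data.Vec as Vec using (Vec; []; _∷_)
open import Data.List as List using (List; []; _∷_; _++_; map; foldr; upTo; filterᵇ; length; concatMap)
open import Data.Bool.ListAction using (all; any)
open import Data.Maybe as Maybe using (Maybe; just; nothing; maybe)
open import Data.Maybe.Properties as MaybeP using ()
open import Data.Product using (_×_; _,_; proj₁; proj₂)
open import Relation.Nullary.Decidable using (⌊_⌋; yes; no)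
open import Relation.Binary.PropositionalEquality using (_≡_)

data Var (m n : ℕ) : Set where
  varA varB : Var m n
  varX : Fin m → Var m n
  varY : Fin n → Var m n

data Expr (m n : ℕ) : Set where
  var : Var m n → Expr m n
  con : ℤ → Expr m n
  _⊕_ : Expr m n → Expr m n → Expr m n
  _⊗_ : Expr m n → Expr m n → Expr m n
  ⊝_  : Expr m n → Expr m n

infixl 6 _⊕_ _⊖_
infixl 7 _⊗_

_⊖_ : ∀ {m n} → Expr m n → Expr m n → Expr m n
p ⊖ q = p ⊕ (⊝ q)

prodE : ∀ {m n} → List (Expr m n) → Expr m n
prodE = foldr _⊗_ (con 1ℤ)

sumE : ∀ {m n} → List (Expr m n) → Expr m n
sumE = foldr _⊕_ (con 0ℤ)

_^E_ : ∀ {m n} → Expr m n → ℕ → Expr m n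
p ^E zero = con 1ℤ
p ^E suc k = p ⊗ (p ^E k)

substE : ∀ {m n} → (Var m n → Expr m n) → Expr m n → Expr m n
substE σ (var v) = σ v
substE σ (con c) = con c
substE σ (p ⊕ q) = substE σ p ⊕ substE σ q
substE σ (p ⊗ q) = substE σ p ⊗ substE σ q
substE σ (⊝ p) = ⊝ substE σ p

shiftX : ∀ {m n} → Var m n → Expr m n
shiftX (varX k) = var varA ⊕ var (varX k)
shiftX v = var v

record Mono (m n : ℕ) : Set where
  constructor mono
  field
    eA eB : ℕ
    eX : Vec ℕ m
    eY : Vec ℕ n
open Mono public

Poly : ℕ → ℕ → Set
Poly m n = List (ℤ × Mono m n)

zeroVec : ∀ {k} → Vec ℕ k
zeroVec = Vec.replicate _ 0

unitVec : ∀ {k} → Fin k → Vec ℕ k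
unitVec i = Vec.updateAt zeroVec i (λ _ → 1)

mono1 : ∀ {m n} → Mono m n
mono1 = mono 0 0 zeroVec zeroVec

monoOf : ∀ {m n} → Var m n → Mono m n
monoOf varA = mono 1 0 zeroVec zeroVec
monoOf varB = mono 0 1 zeroVec zeroVec
monoOf (varX i) = mono 0 0 (unitVec i) zeroVec
monoOf (varY j) = mono 0 0 zeroVec (unitVec j)

monoMul : ∀ {m n} → Mono m n → Mono m n → Mono m n
monoMul (mono a b x y) (mono a' b' x' y') =
  mono (a + a') (b + b') (Vec.zipWith _+_ x x') (Vec.zipWith _+_ y y')

toPoly : ∀ {m n} → Expr m n → Poly m n
toPoly (var v) = (1ℤ , monoOf v) ∷ []
toPoly (con c) = (c , mono1) ∷ []
toPoly (p ⊕ q) = toPoly p ++ toPoly q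
toPoly (p ⊗ q) =
  concatMap (λ t → map (λ u → (proj₁ t ℤ.* proj₁ u , monoMul (proj₂ t) (proj₂ u))) (toPoly q))
            (toPoly p)
toPoly (⊝ p) = map (λ t → (ℤ.- proj₁ t , proj₂ t)) (toPoly p)

vecEq : ∀ {k} → Vec ℕ k → Vec ℕ k → Bool
vecEq [] [] = true
vecEq (a ∷ as) (b ∷ bs) = (a ≡ᵇ b) ∧ vecEq as bs

monoEq : ∀ {m n} → Mono m n → Mono m n → Bool
monoEq (mono a b x y) (mono a' b' x' y') =
  (a ≡ᵇ a') ∧ (b ≡ᵇ b') ∧ vecEq x x' ∧ vecEq y y'

coeff : ∀ {m n} → Poly m n → Mono m n → ℤ
coeff p e = foldr ℤ._+_ 0ℤ (map proj₁ (filterᵇ (λ t → monoEq (proj₂ t) e) p))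

_≈P_ : ∀ {m n} → Poly m n → Poly m n → Set
p ≈P q = ∀ e → coeff p e ≡ coeff q e

-- degree in B (maximal B-exponent of a monomial with nonzero coefficient; 0 for p = 0)
degB : ∀ {m n} → Poly m n → ℕ
degB p = foldr ℕ._⊔_ 0
  (map (λ t → eB (proj₂ t)) (filterᵇ (λ t → not ⌊ coeff p (proj₂ t) ℤ.≟ 0ℤ ⌋) p))

leadB : ∀ {m n} → Poly m n → Poly m n
leadB p = filterᵇ (λ t → eB (proj₂ t) ≡ᵇ degB p) p

data RowType : Set where
  𝗐 𝖾 : RowType

isW : RowType → Bool
isW 𝗐 = true
isW 𝖾 = false

data Side : Set where
  N S E W : Side

-- tiles: blank, horizontal (W–E), vertical (S–N), cross,
-- elbows W–N, S–E, E–N, S–W, double elbow (W–N & S–E), double elbow (E–N & S–W)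
data Tile : Set where
  blank hor ver crs elWN elSE elEN elSW dbW dbE : Tile

allTiles : List Tile
allTiles = blank ∷ hor ∷ ver ∷ crs ∷ elWN ∷ elSE ∷ elEN ∷ elSW ∷ dbW ∷ dbE ∷ []

allowed : RowType → Tile → Bool
allowed 𝗐 elEN = false
allowed 𝗐 elSW = false
allowed 𝗐 dbE = false
allowed 𝖾 elWN = false
allowed 𝖾 elSE = false
allowed 𝖾 dbW = false
allowed _ _ = true

isElbow isStraight isDouble : Tile → Bool
isElbow elWN = true
isElbow elSE = true
isElbow elEN = true
isElbow elSW = true
isElbow dbW = true
isElbow dbE = true
isElbow _ = false
isStraight hor = true
isStraight ver = true
isStraight crs = true
isStraight _ = false
isDouble dbW = true
isDouble dbE = true
isDouble _ = false

isBlank isVer isCrs : Tile → Bool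
isBlank blank = true
isBlank _ = false
isVer ver = true
isVer _ = false
isCrs crs = true
isCrs _ = false

uses : Tile → Side → Bool
uses blank _ = false
uses hor s = isW' s where
  isW' : Side → Bool
  isW' W = true
  isW' E = true
  isW' _ = false
uses ver s = isV s where
  isV : Side → Bool
  isV N = true
  isV S = true
  isV _ = false
uses crs _ = true
uses elWN W = true
uses elWN N = true
uses elWN _ = false
uses elSE S = true
uses elSE E = true
uses elSE _ = false
uses elEN E = true
uses elEN N = true
uses elEN _ = false
uses elSW S = true
uses elSW W = true
uses elSW _ = false
uses dbW _ = true
uses dbE _ = true

through : Tile → Side → Maybe Side
through hor W = just E
through hor E = just W
through ver S = just N
through ver N = just S
through crs W = just E
through crs E = just W
through crs S = just N
through crs N = just S
through elWN W = just N
through elWN N = just W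
through elSE S = just E
through elSE E = just S
through elEN E = just N
through elEN N = just E
through elSW S = just W
through elSW W = just S
through dbW W = just N
through dbW N = just W
through dbW S = just E
through dbW E = just S
through dbE E = just N
through dbE N = just E
through dbE S = just W
through dbE W = just S
through _ _ = nothing

-- a filling of the m × n grid; rows 0..m-1 from top (North) to bottom (South),
-- columns 0..n-1 from West to East (0-based versions of the paper's 1..m, 1..n)
PD : ℕ → ℕ → Set
PD m n = Vec (Vec Tile n) m

nth : ∀ {A : Set} {k} → Vec A k → ℕ → Maybe A
nth [] _ = nothing
nth (a ∷ as) zero = just a
nth (a ∷ as) (suc i) = nth as i

tileAt : ∀ {m n} → PD m n → ℕ → ℕ → Maybe Tile
tileAt D i j = Maybe._>>=_ (nth D i) (λ r → nth r j)

rowType : ∀ {m} → Vec RowType m → ℕ → RowType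
rowType β i = maybe (λ r → r) 𝗐 (nth β i)

usesAt : ∀ {m n} → PD m n → ℕ → ℕ → Side → Bool
usesAt D i j s = maybe (λ t → uses t s) false (tileAt D i j)

eqBool : Bool → Bool → Bool
eqBool a b = ⌊ a BoolP.≟ b ⌋

allℕ : ℕ → (ℕ → Bool) → Bool
allℕ k p = all p (upTo k)

valid : ∀ {m n} → Vec RowType m → PD m n → Bool
valid {m} {n} β D =
  allℕ m (λ i → allℕ n (λ j →
      maybe (allowed (rowType β i)) false (tileAt D i j)
    ∧ (if suc j <ᵇ n then eqBool (usesAt D i j E) (usesAt D i (suc j) W) else true)
    ∧ (if suc i <ᵇ m then eqBool (usesAt D i j S) (usesAt D (suc i) j N) else true)))
  ∧ allℕ m (λ i → eqBool (usesAt D i 0 W) (isW (rowType β i))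
                 ∧ eqBool (usesAt D i (n ∸ 1) E) (not (isW (rowType β i))))
  ∧ allℕ n (λ j → not (usesAt D (m ∸ 1) j S))

-- follow a pipe currently entering tile (i , j) through side s, with fuel;
-- returns the list of tiles visited and the column where it exits North (if it does)
walk : ∀ {m n} → PD m n → ℕ → ℕ → ℕ → Side → List (ℕ × ℕ) × Maybe ℕ
walkNorth : ∀ {m n} → PD m n → ℕ → ℕ → ℕ → List (ℕ × ℕ) × Maybe ℕ
walkWest : ∀ {m n} → PD m n → ℕ → ℕ → ℕ → List (ℕ × ℕ) × Maybe ℕ
walkExit : ∀ {m n} → PD m n → ℕ → ℕ → ℕ → Maybe Side → List (ℕ × ℕ) × Maybe ℕ
cons : ℕ × ℕ → List (ℕ × ℕ) × Maybe ℕ → List (ℕ × ℕ) × Maybe ℕ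
cons p (ps , r) = (p ∷ ps) , r

walk D zero i j s = [] , nothing
walk D (suc f) i j s =
  maybe (λ t → cons (i , j) (walkExit D f i j (through t s))) ([] , nothing) (tileAt D i j)

walkExit D f i j nothing = [] , nothing
walkExit D f i j (just N) = walkNorth D f i j
walkExit D f i j (just S) = walk D f (suc i) j N
walkExit D f i j (just E) = walk D f i (suc j) W
walkExit D f i j (just W) = walkWest D f i j

walkNorth D f zero j = [] , just j
walkNorth D f (suc i) j = walk D f i j S

walkWest D f i zero = [] , nothing
walkWest D f i (suc j) = walk D f i j E

pipeOfRow : ∀ {m n} → Vec RowType m → PD m n → ℕ → List (ℕ × ℕ) × Maybe ℕ
pipeOfRow {m} {n} β D i with rowType β i
... | 𝗐 = walk D (suc (m * n)) i 0 W
... | 𝖾 = walk D (suc (m * n)) i (n ∸ 1) E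

countℕ : ℕ → (ℕ → Bool) → ℕ
countℕ k p = length (filterᵇ p (upTo k))

-- φ(i) (0-based): 𝗐 rows numbered 0..k-1 top to bottom, 𝖾 rows k..m-1 bottom to top
φ : ∀ {m} → Vec RowType m → ℕ → ℕ
φ {m} β i with rowType β i
... | 𝗐 = countℕ i (λ i' → isW (rowType β i'))
... | 𝖾 = countℕ m (λ i' → isW (rowType β i'))
        + countℕ m (λ i' → (i <ᵇ i') ∧ not (isW (rowType β i')))

πℕ : ∀ {m n} → (Fin m → Fin n) → ℕ → ℕ
πℕ {m} π k with k <? m
... | yes p = toℕ (π (fromℕ< p))
... | no _ = 0

eqMaybeℕ : Maybe ℕ → Maybe ℕ → Bool
eqMaybeℕ a b = ⌊ MaybeP.≡-dec ℕ._≟_ a b ⌋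

hasConnectivity : ∀ {m n} → Vec RowType m → (Fin m → Fin n) → PD m n → Bool
hasConnectivity {m} β π D =
  allℕ m (λ i → eqMaybeℕ (proj₂ (pipeOfRow β D i)) (just (πℕ π (φ β i))))

isGeneric : ∀ {m n} → Vec RowType m → (Fin m → Fin n) → PD m n → Bool
isGeneric β π D = valid β D ∧ hasConnectivity β π D

memPos : ℕ × ℕ → List (ℕ × ℕ) → Bool
memPos (a , b) ps = any (λ q → (a ≡ᵇ proj₁ q) ∧ (b ≡ᵇ proj₂ q)) ps

isCrsAt : ∀ {m n} → PD m n → ℕ × ℕ → Bool
isCrsAt D (i , j) = maybe isCrs false (tileAt D i j)

crossings : ∀ {m n} → Vec RowType m → PD m n → ℕ → ℕ → ℕ
crossings β D i₁ i₂ =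
  length (filterᵇ (λ q → isCrsAt D q ∧ memPos q (proj₁ (pipeOfRow β D i₂)))
                  (proj₁ (pipeOfRow β D i₁)))

nongenericConditions : ∀ {m n} → Vec RowType m → PD m n → Bool
nongenericConditions {m} {n} β D =
  allℕ m (λ i → allℕ n (λ j →
    maybe (λ t → if isW (rowType β i) then not (isVer t) else not (isDouble t))
          false (tileAt D i j)))
  ∧ allℕ m (λ i₁ → allℕ m (λ i₂ →
      (i₁ ≡ᵇ i₂) ∨ (crossings β D i₁ i₂ <ᵇ 2)))

isNongeneric : ∀ {m n} → Vec RowType m → (Fin m → Fin n) → PD m n → Bool
isNongeneric β π D = isGeneric β π D ∧ nongenericConditions β D

allVecs : ∀ {A : Set} → (k : ℕ) → List A → List (Vec A k)
allVecs zero xs = [] ∷ []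
allVecs (suc k) xs = concatMap (λ a → map (a ∷_) (allVecs k xs)) xs

allPD : (m n : ℕ) → List (PD m n)
allPD m n = allVecs m (allVecs n allTiles)

xE : ∀ {m n} → ℕ → Expr m n
xE {m} k with k <? m
... | yes p = var (varX (fromℕ< p))
... | no _ = con 0ℤ

yE : ∀ {m n} → ℕ → Expr m n
yE {n = n} j with j <? n
... | yes p = var (varY (fromℕ< p))
... | no _ = con 0ℤ

Aᴱ Bᴱ : ∀ {m n} → Expr m n
Aᴱ = var varA
Bᴱ = var varB

tileWeight : ∀ {m n} → RowType → Tile → Expr m n → Expr m n → Expr m n
tileWeight r t x y =
  if isElbow t then Aᴱ ⊕ Bᴱ
  else if isBlank t
    then (if isW r then Bᴱ ⊖ x ⊕ y else Aᴱ ⊕ x ⊖ y)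
    else (if isW r then Aᴱ ⊕ x ⊖ y else Bᴱ ⊖ x ⊕ y)

tileWeightS : ∀ {m n} → RowType → Tile → Expr m n → Expr m n → Expr m n
tileWeightS 𝗐 t x y = if isStraight t then x ⊖ y else con 1ℤ
tileWeightS 𝖾 t x y = if isBlank t then x ⊖ y else con 1ℤ

gridProduct : ∀ {m n} → (RowType → Tile → Expr m n → Expr m n → Expr m n)
            → Vec RowType m → PD m n → Expr m n
gridProduct {m} {n} w β D =
  prodE (map (λ i → prodE (map (λ j →
      maybe (λ t → w (rowType β i) t (xE (φ β i)) (yE j)) (con 1ℤ) (tileAt D i j))
    (upTo n))) (upTo m))

weight : ∀ {m n} → Vec RowType m → PD m n → Expr m n
weight = gridProduct tileWeight

weightS : ∀ {m n} → Vec RowType m → PD m n → Expr m n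
weightS = gridProduct tileWeightS

G : ∀ {m n} → Vec RowType m → (Fin m → Fin n) → Expr m n
G {m} {n} β π = sumE (map (weight β) (filterᵇ (isGeneric β π) (allPD m n)))

Sβ : ∀ {m n} → Vec RowType m → (Fin m → Fin n) → Expr m n
Sβ {m} {n} β π = sumE (map (weightS β) (filterᵇ (isNongeneric β π) (allPD m n)))

nthL : List ℕ → ℕ → ℕ
nthL [] _ = 0
nthL (a ∷ as) zero = a
nthL (a ∷ as) (suc k) = nthL as k

πhat : ∀ {m n} → (Fin m → Fin n) → ℕ → ℕ
πhat {m} {n} π k =
  if k <ᵇ m then πℕ π k
  else nthL (filterᵇ (λ j → not (any (λ i → πℕ π i ≡ᵇ j) (upTo m))) (upTo n)) (k ∸ m)

lengthHat : ∀ {m n} → (Fin m → Fin n) → ℕ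
lengthHat {m} {n} π =
  length (filterᵇ (λ ij → (proj₁ ij <ᵇ proj₂ ij) ∧ (πhat π (proj₂ ij) <ᵇ πhat π (proj₁ ij)))
                  (List.cartesianProduct (upTo n) (upTo n)))

{-# OPTIONS --safe #-}
module Submission where

-- Label every edge of a pipe dream by the number of its pipe, an empty edge by m, and read the vertical
-- labels along each horizontal grid line as a word; the word at the North boundary is π̂⁻¹ with the
-- columns outside the image of π all marked m, so it has ℓ(π̂) inversions.  Going up through a row, each
-- straight tile transposes two neighbouring letters and each other tile changes nothing.  Counting
-- inversions row by row gives
--   #(straight tiles in 𝗐 rows) + #(blank tiles in 𝖾 rows) = ℓ(π̂) + excess,
-- where the excess counts vertical tiles in 𝗐 rows and crossings that undo an inversion twice, and double
-- elbows in 𝖾 rows once.  The left side is mn minus the B-degree of the weight.  Two pipes start out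
-- uninverted, and their crossings alternately create and undo their inversion, so the excess vanishes
-- exactly for the nongeneric pipe dreams.  One of these exists for every π and β (built from the top row
-- down), and weights do not cancel, so the B-degree of G is mn − ℓ(π̂).

open import Defs
open import Data.Bool using (Bool; true; false; _∧_; _∨_; not; if_then_else_; T)
open import Data.Bool.Properties using (T-∧; T-∨; T-not-≡; ∧-comm; ∨-comm; ∧-zeroʳ; ∨-zeroʳ; T?) renaming (_≟_ to _≟ᴮ_)
open import Data.Bool.ListAction using (all; any)
open import Data.Nat using (ℕ; zero; suc; _+_; _*_; _∸_; _⊔_; _≤_; _<_; z≤n; s≤s; z<s; s<s; s≤s⁻¹; _≡ᵇ_; _<ᵇ_; _≟_; _<?_)
open import Data.Nat.Properties
open import Data.Nat.Tactic.RingSolver using (solve-∀)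
open import Data.Integer as ℤ using (ℤ; 0ℤ; 1ℤ)
import Data.Integer.Properties as ℤ
open import Data.Fin using (Fin; zero; suc; toℕ; fromℕ<)
import Data.Fin as Fin
import Data.Fin.Properties as Fin
open import Data.Vec as Vec using (Vec; []; _∷_; lookup)
import Data.Vec.Properties as Vec
open import Data.List as List using (List; []; _∷_; _++_; upTo; filterᵇ; length; concatMap; foldr)
import Data.List.Properties as List
open import Data.List.Relation.Unary.All as All using (All; []; _∷_)
import Data.List.Relation.Unary.All.Properties as All
open import Data.List.Relation.Unary.Any as Any using (here; there)
open import Data.List.Relation.Unary.AllPairs as AllPairs using (AllPairs; []; _∷_)
import Data.List.Relation.Unary.AllPairs.Properties as AllPairs
open import Data.List.Membership.Propositional using (_∈_)
open import Data.List.Membership.Propositional.Properties using (∈-map⁺; ∈-concatMap⁺)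
open import Data.Maybe using (Maybe; just; nothing; maybe)
open import Data.Product using (Σ; ∃; ∃₂; _×_; _,_; proj₁; proj₂)
open import Data.Sum using (_⊎_; inj₁; inj₂)
open import Data.Empty using (⊥-elim)
open import Data.Unit using (⊤; tt)
open import Function using (_∘_; id; flip; const)
open import Function.Bundles using (Equivalence)
open import Function.Definitions using (Injective)
open import Relation.Nullary using (¬_; yes; no)
open import Relation.Nullary.Decidable using (⌊_⌋)
open import Relation.Binary.Definitions using (tri<; tri≈; tri>)
open import Relation.Binary.PropositionalEquality using (_≡_; _≢_; refl; sym; trans; cong; cong₂; subst; subst₂; module ≡-Reasoning)

-- Indicators, finite sums and counting

-- Treating an empty edge as a pipe with the largest number `m` leaves only two kinds of tile: those
-- that exchange their two incoming labels and those that keep their order. The counterclockwise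
-- numbering makes the count exact: a pipe entering from the West is smaller than every pipe from a
-- row below, one entering from the East is larger, so an entering pipe is never inverted with
-- another pipe. In an `𝖾` row it is still inverted with the empty columns, and the account of these
-- is why blank tiles are charged there instead of straight ones. The empty columns may share one
-- label because π̂ lists them in increasing order, without inversions among themselves. The
-- difficulty lies in the definitions: pipes are walks with fuel and crossings are counted along
-- lists of positions, while the count needs labels on edges. Uniqueness of each label in every word
-- ties the two together. Cancellation is excluded by a second grading, in which `A` has weight 1
-- and `B` weight 2. Every tile weight then has a single top term, `A` or `B`, with coefficient 1.

𝟙 : Bool → ℕ
𝟙 true = 1
𝟙 false = 0

δ lt : ℕ → ℕ → ℕ
δ x y = 𝟙 (x ≡ᵇ y)
lt x y = 𝟙 (x <ᵇ y)

T⇒≡ : ∀ {b} → T b → b ≡ true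
T⇒≡ {true} _ = refl

≡⇒T : ∀ {b} → b ≡ true → T b
≡⇒T refl = tt

¬T⇒≡ : ∀ {b} → ¬ T b → b ≡ false
¬T⇒≡ {false} _ = refl
¬T⇒≡ {true} ¬t = ⊥-elim (¬t tt)

∧⁻ : ∀ {a b} → T (a ∧ b) → T a × T b
∧⁻ = Equivalence.to T-∧

∧⁺ : ∀ {a b} → T a → T b → T (a ∧ b)
∧⁺ p q = Equivalence.from T-∧ (p , q)

eqBool⁻ : ∀ {a b} → T (eqBool a b) → a ≡ b
eqBool⁻ {a} {b} p with a ≟ᴮ b
... | yes e = e

eqBool⁺ : ∀ {a b} → a ≡ b → T (eqBool a b)
eqBool⁺ {a} {b} e with a ≟ᴮ b
... | yes _ = tt
... | no ¬e = ⊥-elim (¬e e)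

≡ᵇ-refl : ∀ x → (x ≡ᵇ x) ≡ true
≡ᵇ-refl x = T⇒≡ (≡⇒≡ᵇ x x refl)

≢⇒≡ᵇ : ∀ {x y} → x ≢ y → (x ≡ᵇ y) ≡ false
≢⇒≡ᵇ {x} {y} ne = ¬T⇒≡ (ne ∘ ≡ᵇ⇒≡ x y)

<⇒<ᵇ≡ : ∀ {x y} → x < y → (x <ᵇ y) ≡ true
<⇒<ᵇ≡ = T⇒≡ ∘ <⇒<ᵇ

≥⇒<ᵇ≡ : ∀ {x y} → y ≤ x → (x <ᵇ y) ≡ false
≥⇒<ᵇ≡ {x} {y} y≤x = ¬T⇒≡ (λ t → <⇒≱ (<ᵇ⇒< x y t) y≤x)

δ-refl : ∀ x → δ x x ≡ 1
δ-refl x = cong 𝟙 (≡ᵇ-refl x)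

δ-≢ : ∀ {x y} → x ≢ y → δ x y ≡ 0
δ-≢ = cong 𝟙 ∘ ≢⇒≡ᵇ

lt-< : ∀ {x y} → x < y → lt x y ≡ 1
lt-< = cong 𝟙 ∘ <⇒<ᵇ≡

lt-≥ : ∀ {x y} → y ≤ x → lt x y ≡ 0
lt-≥ = cong 𝟙 ∘ ≥⇒<ᵇ≡

lt-irrefl : ∀ x → lt x x ≡ 0
lt-irrefl x = lt-≥ (≤-refl {x})

lt-connex : ∀ {x y} → x ≢ y → lt x y + lt y x ≡ 1
lt-connex {x} {y} x≢y with <-cmp x y
... | tri< p _ _ = cong₂ _+_ (lt-< p) (lt-≥ (<⇒≤ p))
... | tri≈ _ p _ = ⊥-elim (x≢y p)
... | tri> _ _ p = cong₂ _+_ (lt-≥ (<⇒≤ p)) (lt-< p)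

𝟙-mono : ∀ {a b} → (T a → T b) → 𝟙 a ≤ 𝟙 b
𝟙-mono {false} _ = z≤n
𝟙-mono {true} {true} _ = ≤-refl
𝟙-mono {true} {false} f = ⊥-elim (f tt)

∑ : ℕ → (ℕ → ℕ) → ℕ
∑ zero f = 0
∑ (suc n) f = f 0 + ∑ n (f ∘ suc)

∑-cong : ∀ n {f g} → (∀ i → i < n → f i ≡ g i) → ∑ n f ≡ ∑ n g
∑-cong zero h = refl
∑-cong (suc n) h = cong₂ _+_ (h 0 z<s) (∑-cong n (λ i p → h (suc i) (s<s p)))

∑-mono : ∀ n {f g} → (∀ i → i < n → f i ≤ g i) → ∑ n f ≤ ∑ n g
∑-mono zero h = z≤n
∑-mono (suc n) h = +-mono-≤ (h 0 z<s) (∑-mono n (λ i p → h (suc i) (s<s p)))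

∑-zero : ∀ n {f} → (∀ i → i < n → f i ≡ 0) → ∑ n f ≡ 0
∑-zero zero h = refl
∑-zero (suc n) h = cong₂ _+_ (h 0 z<s) (∑-zero n (λ i p → h (suc i) (s<s p)))

+-interchange : ∀ a b c d → (a + b) + (c + d) ≡ (a + c) + (b + d)
+-interchange = solve-∀

∑-+ : ∀ n f g → ∑ n (λ i → f i + g i) ≡ ∑ n f + ∑ n g
∑-+ zero f g = refl
∑-+ (suc n) f g = trans (cong (f 0 + g 0 +_) (∑-+ n (f ∘ suc) (g ∘ suc)))
  (+-interchange (f 0) (g 0) (∑ n (f ∘ suc)) (∑ n (g ∘ suc)))

∑-const : ∀ n c → ∑ n (λ _ → c) ≡ n * c
∑-const zero c = refl
∑-const (suc n) c = cong (c +_) (∑-const n c)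

∑-comm : ∀ m n (f : ℕ → ℕ → ℕ) → ∑ m (λ i → ∑ n (f i)) ≡ ∑ n (λ j → ∑ m (λ i → f i j))
∑-comm zero n f = sym (∑-zero n (λ _ _ → refl))
∑-comm (suc m) n f = trans (cong (∑ n (f 0) +_) (∑-comm m n (f ∘ suc)))
  (sym (∑-+ n (f 0) (λ j → ∑ m (λ i → f (suc i) j))))

∑-*ʳ : ∀ n f c → ∑ n (λ i → f i * c) ≡ ∑ n f * c
∑-*ʳ zero f c = refl
∑-*ʳ (suc n) f c = trans (cong (f 0 * c +_) (∑-*ʳ n (f ∘ suc) c)) (sym (*-distribʳ-+ c (f 0) _))

∑-δ : ∀ {n} (f : ℕ → ℕ) {k} → k < n → ∑ n (λ c → δ k c * f c) ≡ f k
∑-δ {suc n} f {zero} _ = trans (cong₂ _+_ (*-identityˡ (f 0)) (∑-zero n (λ _ _ → refl))) (+-identityʳ (f 0))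
∑-δ {suc n} f {suc k} (s≤s p) = ∑-δ (f ∘ suc) p

∑-split : ∀ k n f → ∑ (k + n) f ≡ ∑ k f + ∑ n (λ i → f (k + i))
∑-split zero n f = refl
∑-split (suc k) n f = trans (cong (f 0 +_) (∑-split k n (f ∘ suc))) (sym (+-assoc (f 0) _ _))

sumV : ∀ {n} → (ℕ → ℕ) → Vec ℕ n → ℕ
sumV g [] = 0
sumV g (x ∷ xs) = g x + sumV g xs

sumV-zero : ∀ {n} g (v : Vec ℕ n) → (∀ i → g (lookup v i) ≡ 0) → sumV g v ≡ 0
sumV-zero g [] h = refl
sumV-zero g (x ∷ v) h = cong₂ _+_ (h zero) (sumV-zero g v (h ∘ suc))

sumV-cong : ∀ {n} {f g} → (∀ x → f x ≡ g x) → (v : Vec ℕ n) → sumV f v ≡ sumV g v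
sumV-cong h [] = refl
sumV-cong h (x ∷ v) = cong₂ _+_ (h x) (sumV-cong h v)

sumV-+ : ∀ {n} f g (v : Vec ℕ n) → sumV (λ x → f x + g x) v ≡ sumV f v + sumV g v
sumV-+ f g [] = refl
sumV-+ f g (x ∷ v) = trans (cong (f x + g x +_) (sumV-+ f g v)) (+-interchange (f x) (g x) _ _)

countᵇ : ∀ {A : Set} → (A → Bool) → List A → ℕ
countᵇ p [] = 0
countᵇ p (x ∷ xs) = 𝟙 (p x) + countᵇ p xs

length-filterᵇ : ∀ {A : Set} (p : A → Bool) xs → length (filterᵇ p xs) ≡ countᵇ p xs
length-filterᵇ p [] = refl
length-filterᵇ p (x ∷ xs) with p x
... | true = cong suc (length-filterᵇ p xs)
... | false = length-filterᵇ p xs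

countᵇ-++ : ∀ {A : Set} (p : A → Bool) xs ys → countᵇ p (xs ++ ys) ≡ countᵇ p xs + countᵇ p ys
countᵇ-++ p [] ys = refl
countᵇ-++ p (x ∷ xs) ys = trans (cong (𝟙 (p x) +_) (countᵇ-++ p xs ys)) (sym (+-assoc (𝟙 (p x)) _ _))

countᵇ-map : ∀ {A B : Set} (p : B → Bool) (f : A → B) xs → countᵇ p (List.map f xs) ≡ countᵇ (p ∘ f) xs
countᵇ-map p f [] = refl
countᵇ-map p f (x ∷ xs) = cong (𝟙 (p (f x)) +_) (countᵇ-map p f xs)

countᵇ-cong : ∀ {A : Set} {p q : A → Bool} xs → (∀ x → p x ≡ q x) → countᵇ p xs ≡ countᵇ q xs
countᵇ-cong [] h = refl
countᵇ-cong (x ∷ xs) h = cong₂ _+_ (cong 𝟙 (h x)) (countᵇ-cong xs h)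

countᵇ-applyUpTo : ∀ {A : Set} (p : A → Bool) f n → countᵇ p (List.applyUpTo f n) ≡ ∑ n (λ i → 𝟙 (p (f i)))
countᵇ-applyUpTo p f zero = refl
countᵇ-applyUpTo p f (suc n) = cong (𝟙 (p (f 0)) +_) (countᵇ-applyUpTo p (f ∘ suc) n)

length-filter-upTo : ∀ p n → length (filterᵇ p (upTo n)) ≡ ∑ n (𝟙 ∘ p)
length-filter-upTo p n = trans (length-filterᵇ p (upTo n)) (countᵇ-applyUpTo p id n)

all-applyUpTo⁻ : ∀ (p : ℕ → Bool) f n → T (all p (List.applyUpTo f n)) → ∀ i → i < n → T (p (f i))
all-applyUpTo⁻ p f (suc n) h zero _ = proj₁ (∧⁻ h)
all-applyUpTo⁻ p f (suc n) h (suc i) (s≤s q) = all-applyUpTo⁻ p (f ∘ suc) n (proj₂ (∧⁻ {p (f 0)} h)) i q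

all-applyUpTo⁺ : ∀ (p : ℕ → Bool) f n → (∀ i → i < n → T (p (f i))) → T (all p (List.applyUpTo f n))
all-applyUpTo⁺ p f zero h = tt
all-applyUpTo⁺ p f (suc n) h = ∧⁺ (h 0 z<s) (all-applyUpTo⁺ p (f ∘ suc) n (λ i q → h (suc i) (s<s q)))

allℕ⁻ : ∀ {n p} → T (allℕ n p) → ∀ i → i < n → T (p i)
allℕ⁻ {n} {p} = all-applyUpTo⁻ p id n

allℕ⁺ : ∀ {n p} → (∀ i → i < n → T (p i)) → T (allℕ n p)
allℕ⁺ {n} {p} = all-applyUpTo⁺ p id n

-- Labelled tilings and the inversion count of a row

-- w, s, e, u label the West, South, East and North edges; M marks an edge that no pipe uses.
data TileLabels (M : ℕ) : RowType → Tile → (w s e u : ℕ) → Set where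
  blank : ∀ {T} → TileLabels M T blank M M M M
  hor   : ∀ {T a} → a < M → TileLabels M T hor a M a M
  ver   : ∀ {T b} → b < M → TileLabels M T ver M b M b
  crs   : ∀ {T a b} → a < M → b < M → a ≢ b → TileLabels M T crs a b a b
  elWN  : ∀ {a} → a < M → TileLabels M 𝗐 elWN a M M a
  elSE  : ∀ {b} → b < M → TileLabels M 𝗐 elSE M b b M
  dbW   : ∀ {a b} → a < M → b < M → TileLabels M 𝗐 dbW a b b a
  elEN  : ∀ {a} → a < M → TileLabels M 𝖾 elEN M M a a
  elSW  : ∀ {b} → b < M → TileLabels M 𝖾 elSW b b M M
  dbE   : ∀ {a b} → a < M → b < M → TileLabels M 𝖾 dbE b b a a

data RowLabels (M : ℕ) (T : RowType) : ∀ {n} → ℕ → Vec Tile n → Vec ℕ n → Vec ℕ n → ℕ → Set where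
  []  : ∀ {h} → RowLabels M T h [] [] [] h
  _∷_ : ∀ {n t w s e u e′} {r : Vec Tile n} {v us} →
        TileLabels M T t w s e u → RowLabels M T e r v us e′ →
        RowLabels M T w (t ∷ r) (s ∷ v) (u ∷ us) e′

infixr 5 _∷_ _◂_

westLabel eastLabel : ℕ → RowType → ℕ → ℕ
westLabel M 𝗐 p = p
westLabel M 𝖾 p = M
eastLabel M 𝗐 p = M
eastLabel M 𝖾 p = p

-- The last index is the word on the North grid line of the tiling. The empty tiling has a word of
-- letters `M` only: no pipe crosses the South boundary.
data Labelling (M : ℕ) : ∀ {m n} → Vec RowType m → Vec ℕ m → PD m n → Vec ℕ n → Set where
  []  : ∀ {n} → Labelling M [] [] [] (Vec.replicate n M)
  _◂_ : ∀ {m n T p β ps r u v} {D : PD m n} →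
        RowLabels M T (westLabel M T p) r v u (eastLabel M T p) →
        Labelling M β ps D v → Labelling M (T ∷ β) (p ∷ ps) (r ∷ D) u

-- A tile statistic sees the row type, the tile and the labels of its West and South edges.
Stat : Set
Stat = RowType → Tile → ℕ → ℕ → ℕ

rowSum : ∀ {M T n w e} {r : Vec Tile n} {v u} → Stat → RowLabels M T w r v u e → ℕ
rowSum F [] = 0
rowSum {T = T} F (_∷_ {t = t} {w} {s} _ rl) = F T t w s + rowSum F rl

sumL : ∀ {M m n β ps} {D : PD m n} {u} → Stat → Labelling M β ps D u → ℕ
sumL F [] = 0
sumL F (rl ◂ ld) = rowSum F rl + sumL F ld

-- With `M` counted as a label, `hor` and `ver` are crossings with `M`, and blank tiles and single
-- elbows are double elbows with one or both labels `M`. Hence a tile either transposes its incoming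
-- labels or leaves them in order.
turnW : ∀ {M t w s e u} → TileLabels M 𝗐 t w s e u →
  (isStraight t ≡ true × e ≡ w × u ≡ s) ⊎ (isStraight t ≡ false × e ≡ s × u ≡ w)
turnW blank = inj₂ (refl , refl , refl)
turnW (hor _) = inj₁ (refl , refl , refl)
turnW (ver _) = inj₁ (refl , refl , refl)
turnW (crs _ _ _) = inj₁ (refl , refl , refl)
turnW (elWN _) = inj₂ (refl , refl , refl)
turnW (elSE _) = inj₂ (refl , refl , refl)
turnW (dbW _ _) = inj₂ (refl , refl , refl)

turnE : ∀ {M t w s e u} → TileLabels M 𝖾 t w s e u →
  (isStraight t ≡ true × w ≡ e × u ≡ s) ⊎ (isStraight t ≡ false × w ≡ s × u ≡ e)
turnE blank = inj₂ (refl , refl , refl)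
turnE (hor _) = inj₁ (refl , refl , refl)
turnE (ver _) = inj₁ (refl , refl , refl)
turnE (crs _ _ _) = inj₁ (refl , refl , refl)
turnE (elEN _) = inj₂ (refl , refl , refl)
turnE (elSW _) = inj₂ (refl , refl , refl)
turnE (dbE _ _) = inj₂ (refl , refl , refl)

x+[y+z]≡y+[x+z] : ∀ x y z → x + (y + z) ≡ y + (x + z)
x+[y+z]≡y+[x+z] = solve-∀

-- No label is created or lost: the letters of `w v` are a permutation of those of `u e`, expressed
-- by equal sums of every function `g` over the letters. With `g` an indicator, a label occurs
-- equally often before and after the row.
row-permW : ∀ {M n w e} {r : Vec Tile n} {v u} g → RowLabels M 𝗐 w r v u e →
  g w + sumV g v ≡ sumV g u + g e
row-permW g [] = +-comm _ 0
row-permW g (_∷_ {w = w} {s} {e} {u} tl rl) with turnW tl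
... | inj₁ (_ , refl , refl) = trans (x+[y+z]≡y+[x+z] (g w) (g s) _) (trans (cong (g s +_) (row-permW g rl)) (sym (+-assoc (g s) _ _)))
... | inj₂ (_ , refl , refl) = trans (cong (g w +_) (row-permW g rl)) (sym (+-assoc (g w) _ _))

row-permE : ∀ {M n w e} {r : Vec Tile n} {v u} g → RowLabels M 𝖾 w r v u e →
  sumV g v + g e ≡ g w + sumV g u
row-permE g [] = +-comm 0 _
row-permE g (_∷_ {w = w} {s} {e} {u} tl rl) with turnE tl
... | inj₁ (_ , refl , refl) = trans (+-assoc (g s) _ _) (trans (cong (g s +_) (row-permE g rl)) (x+[y+z]≡y+[x+z] (g s) (g w) _))
... | inj₂ (_ , refl , refl) = trans (+-assoc (g s) _ _) (cong (g s +_) (row-permE g rl))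

inv : ∀ {n} → (ℕ → ℕ → ℕ) → Vec ℕ n → ℕ
inv f [] = 0
inv f (x ∷ xs) = sumV (f x) xs + inv f xs

onStraight : (ℕ → ℕ → ℕ) → Tile → ℕ → ℕ → ℕ
onStraight f t h s = if isStraight t then f h s else 0

-- A straight tile transposes the pipe moving horizontally (label h) with the one coming from the
-- South (label s) in the word of labels: a 𝗐 row reads h s before and s h after, an 𝖾 row conversely.
lost gained : (ℕ → ℕ → ℕ) → Stat
lost f 𝗐 = onStraight f
lost f 𝖾 = onStraight (flip f)
gained f 𝗐 = onStraight (flip f)
gained f 𝖾 = onStraight f

-- The first two summands on either side make up `inv f` of the words `u e` and `w v` of length
-- `n + 1`. Passing the tiles from West to East turns `w v` into `u e` by one transposition of
-- neighbours at each straight tile, and this alters `inv` only in the pair exchanged, whatever the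
-- relation `f` is.
row-invW : ∀ {M n w e} {r : Vec Tile n} {v u} f (rl : RowLabels M 𝗐 w r v u e) →
  inv f u + sumV (λ x → f x e) u + rowSum (lost f) rl ≡ sumV (f w) v + inv f v + rowSum (gained f) rl
row-invW f [] = refl
row-invW {e = e} f (_∷_ {t = t} {w} {s} {e₁} {u₀} {v = v} {us} tl rl)
  with isStraight t | turnW tl | row-permW (f u₀) rl | row-invW f rl
... | .true | inj₁ (refl , refl , refl) | perm | ih =
  let fe = λ x → f x e in begin
  sumV (f s) us + inv f us + (f s e + sumV fe us) + (f w s + rowSum (lost f) rl)
    ≡⟨ h₁ (sumV (f s) us) (inv f us) (f s e) (sumV fe us) (f w s) (rowSum (lost f) rl) ⟩
  (sumV (f s) us + f s e) + (inv f us + sumV fe us + rowSum (lost f) rl) + f w s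
    ≡⟨ cong (_+ f w s) (cong₂ _+_ (sym perm) ih) ⟩
  (f s w + sumV (f s) v) + (sumV (f w) v + inv f v + rowSum (gained f) rl) + f w s
    ≡⟨ h₂ (f s w) (sumV (f s) v) (sumV (f w) v) (inv f v) (rowSum (gained f) rl) (f w s) ⟩
  f w s + sumV (f w) v + (sumV (f s) v + inv f v) + (f s w + rowSum (gained f) rl) ∎
  where
  open ≡-Reasoning
  h₁ : ∀ a b c d x y → a + b + (c + d) + (x + y) ≡ (a + c) + (b + d + y) + x
  h₁ = solve-∀
  h₂ : ∀ a b c d x y → (a + b) + (c + d + x) + y ≡ y + c + (b + d) + (a + x)
  h₂ = solve-∀
... | .false | inj₂ (refl , refl , refl) | perm | ih =
  let fe = λ x → f x e in begin
  sumV (f w) us + inv f us + (f w e + sumV fe us) + rowSum (lost f) rl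
    ≡⟨ h₁ (sumV (f w) us) (inv f us) (f w e) (sumV fe us) (rowSum (lost f) rl) ⟩
  (sumV (f w) us + f w e) + (inv f us + sumV fe us + rowSum (lost f) rl)
    ≡⟨ cong₂ _+_ (sym perm) ih ⟩
  (f w s + sumV (f w) v) + (sumV (f s) v + inv f v + rowSum (gained f) rl)
    ≡⟨ sym (+-assoc (f w s + sumV (f w) v) (sumV (f s) v + inv f v) (rowSum (gained f) rl)) ⟩
  f w s + sumV (f w) v + (sumV (f s) v + inv f v) + rowSum (gained f) rl ∎
  where
  open ≡-Reasoning
  h₁ : ∀ a b c d y → a + b + (c + d) + y ≡ (a + c) + (b + d + y)
  h₁ = solve-∀

row-invE : ∀ {M n w e} {r : Vec Tile n} {v u} f (rl : RowLabels M 𝖾 w r v u e) →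
  sumV (f w) u + inv f u + rowSum (lost f) rl ≡ inv f v + sumV (λ x → f x e) v + rowSum (gained f) rl
row-invE f [] = refl
row-invE {e = e} f (_∷_ {t = t} {w} {s} {e₁} {u₀} {v = v} {us} tl rl)
  with isStraight t | turnE tl | row-permE (f s) rl | row-invE f rl
... | .true | inj₁ (refl , refl , refl) | perm | ih =
  let fe = λ x → f x e in begin
  f w s + sumV (f w) us + (sumV (f s) us + inv f us) + (f s w + rowSum (lost f) rl)
    ≡⟨ h₁ (f w s) (sumV (f w) us) (sumV (f s) us) (inv f us) (f s w) (rowSum (lost f) rl) ⟩
  (f s w + sumV (f s) us) + (sumV (f w) us + inv f us + rowSum (lost f) rl) + f w s
    ≡⟨ cong (_+ f w s) (cong₂ _+_ (sym perm) ih) ⟩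
  (sumV (f s) v + f s e) + (inv f v + sumV fe v + rowSum (gained f) rl) + f w s
    ≡⟨ h₂ (sumV (f s) v) (f s e) (inv f v) (sumV fe v) (rowSum (gained f) rl) (f w s) ⟩
  sumV (f s) v + inv f v + (f s e + sumV fe v) + (f w s + rowSum (gained f) rl) ∎
  where
  open ≡-Reasoning
  h₁ : ∀ a b c d x y → a + b + (c + d) + (x + y) ≡ (x + c) + (b + d + y) + a
  h₁ = solve-∀
  h₂ : ∀ a b c d x y → (a + b) + (c + d + x) + y ≡ a + c + (b + d) + (y + x)
  h₂ = solve-∀
... | .false | inj₂ (refl , refl , refl) | perm | ih =
  let fe = λ x → f x e in begin
  f s u₀ + sumV (f s) us + (sumV (f u₀) us + inv f us) + rowSum (lost f) rl
    ≡⟨ h₁ (f s u₀) (sumV (f s) us) (sumV (f u₀) us) (inv f us) (rowSum (lost f) rl) ⟩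
  (f s u₀ + sumV (f s) us) + (sumV (f u₀) us + inv f us + rowSum (lost f) rl)
    ≡⟨ cong₂ _+_ (sym perm) ih ⟩
  (sumV (f s) v + f s e) + (inv f v + sumV fe v + rowSum (gained f) rl)
    ≡⟨ h₂ (sumV (f s) v) (f s e) (inv f v) (sumV fe v) (rowSum (gained f) rl) ⟩
  sumV (f s) v + inv f v + (f s e + sumV fe v) + rowSum (gained f) rl ∎
  where
  open ≡-Reasoning
  h₁ : ∀ a b c d x → a + b + (c + d) + x ≡ (a + b) + (c + d + x)
  h₁ = solve-∀
  h₂ : ∀ a b c d x → (a + b) + (c + d + x) ≡ a + c + (b + d) + x
  h₂ = solve-∀

-- Inversions of the whole tiling

Precedes : RowType → ℕ → ℕ → Set
Precedes 𝗐 p q = p < q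
Precedes 𝖾 p q = q < p

-- All that the inversion count uses of the numbering `φ`. Unlike `φ`, which depends on the whole of
-- `β`, this property survives deleting the top row with `M` kept fixed, as the inductions require;
-- the labels of the remaining rows then no longer exhaust the numbers below `M`.
record Sorted (M : ℕ) {m} (β : Vec RowType m) (ps : Vec ℕ m) : Set where
  field
    bounded : ∀ i → lookup ps i < M
    ordered : ∀ {i j} → i Fin.< j → Precedes (lookup β i) (lookup ps i) (lookup ps j)
open Sorted

Sorted-tail : ∀ {M m T p} {β : Vec RowType m} {ps} → Sorted M (T ∷ β) (p ∷ ps) → Sorted M β ps
Sorted-tail so .bounded i = bounded so (suc i)
Sorted-tail so .ordered lt = ordered so (s<s lt)

Sorted-head : ∀ {M m T p} {β : Vec RowType m} {ps} → Sorted M (T ∷ β) (p ∷ ps) →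
  ∀ i → Precedes T p (lookup ps i)
Sorted-head so i = ordered so {zero} {suc i} z<s

sumV-replicate : ∀ n g {x} → g x ≡ 0 → sumV g (Vec.replicate n x) ≡ 0
sumV-replicate zero g h = refl
sumV-replicate (suc n) g h = cong₂ _+_ h (sumV-replicate n g h)

-- The tiles of cost 1 in a row are those whose weight `A + x - y` lacks `B`, so the total cost is
-- the amount by which the B-degree of a weight falls short of the number of tiles.
tileCost : RowType → Tile → ℕ
tileCost 𝗐 t = 𝟙 (isStraight t)
tileCost 𝖾 t = 𝟙 (isBlank t)

-- In a `𝗐` row, `ver` is charged like a crossing that undoes an inversion: it is one, with the
-- largest label `M` moving horizontally. A `hor` tile has `s = M` and is free.
cost excess : Stat
cost τ t _ _ = tileCost τ t
excess 𝗐 t h s = if isStraight t then lt s h + lt s h else 0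
excess 𝖾 t h s = if isDouble t then 1 else if isCrs t then lt h s + lt h s else 0

-- inv (inverted a b) counts the occurrences of b before a.
inverted : ℕ → ℕ → ℕ → ℕ → ℕ
inverted a b x y = δ x b * δ y a

lt-excess : ∀ {h s} → h ≢ s → lt s h + lt s h + lt h s ≡ 1 + lt s h
lt-excess {h} {s} h≢s = trans (+-assoc (lt s h) _ _)
  (trans (+-comm (lt s h) _) (cong (_+ lt s h) (lt-connex (h≢s ∘ sym))))

module _ {M : ℕ} where

  -- Every pipe from a lower row passes each grid line above it exactly once; only the number of
  -- letters `M` is uncontrolled, hence the condition on `g M`.
  sumV-labels : ∀ {m n β ps u} {D : PD m n} g → g M ≡ 0 → Labelling M β ps D u → sumV g u ≡ sumV g ps
  sumV-labels g gM ([] {n}) = sumV-replicate n g gM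
  sumV-labels g gM (_◂_ {T = 𝗐} {p = p} {u = u} rl ld) = begin
    sumV g u         ≡⟨ sym (+-identityʳ _) ⟩
    sumV g u + 0     ≡⟨ cong (sumV g u +_) (sym gM) ⟩
    sumV g u + g M   ≡⟨ sym (row-permW g rl) ⟩
    g p + _          ≡⟨ cong (g p +_) (sumV-labels g gM ld) ⟩
    g p + _          ∎
    where open ≡-Reasoning
  sumV-labels g gM (_◂_ {T = 𝖾} {p = p} {u = u} {v = v} rl ld) = begin
    sumV g u         ≡⟨ cong (_+ sumV g u) (sym gM) ⟩
    g M + sumV g u   ≡⟨ sym (row-permE g rl) ⟩
    sumV g v + g p   ≡⟨ +-comm (sumV g v) (g p) ⟩
    g p + sumV g v   ≡⟨ cong (g p +_) (sumV-labels g gM ld) ⟩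
    g p + _          ∎
    where open ≡-Reasoning

  sumV-labels-zero : ∀ {m n β ps u} {D : PD m n} g → g M ≡ 0 → Labelling M β ps D u →
    (∀ i → g (lookup ps i) ≡ 0) → sumV g u ≡ 0
  sumV-labels-zero {ps = ps} g gM ld h = trans (sumV-labels g gM ld) (sumV-zero g ps h)

  -- A straight tile changes the number of inversions by `1 - 2 * lt s h`, since its labels differ,
  -- and cost minus excess is the same number. Other tiles give 0 throughout.
  tile-excessW : ∀ {t w s e u} → TileLabels M 𝗐 t w s e u →
    excess 𝗐 t w s + gained (flip lt) 𝗐 t w s ≡ cost 𝗐 t w s + lost (flip lt) 𝗐 t w s
  tile-excessW blank = refl
  tile-excessW (hor a<M) = lt-excess (<⇒≢ a<M)
  tile-excessW (ver b<M) = lt-excess (<⇒≢ b<M ∘ sym)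
  tile-excessW (crs _ _ h≢s) = lt-excess h≢s
  tile-excessW (elWN _) = refl
  tile-excessW (elSE _) = refl
  tile-excessW (dbW _ _) = refl

  row-excessW : ∀ {n w e} {r : Vec Tile n} {v u} (rl : RowLabels M 𝗐 w r v u e) →
    rowSum excess rl + rowSum (gained (flip lt)) rl ≡ rowSum cost rl + rowSum (lost (flip lt)) rl
  row-excessW [] = refl
  row-excessW (_∷_ {t = t} {w} {s} tl rl) =
    trans (+-interchange (excess 𝗐 t w s) _ _ _)
      (trans (cong₂ _+_ (tile-excessW tl) (row-excessW rl)) (+-interchange (cost 𝗐 t w s) _ _ _))

  occupied empty : ℕ → ℕ
  occupied x = lt x M
  empty x = 𝟙 (not (x <ᵇ M))

  empty-M : empty M ≡ 1
  empty-M = cong (𝟙 ∘ not) (≥⇒<ᵇ≡ (≤-refl {M}))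

  empty-< : ∀ {x} → x < M → empty x ≡ 0
  empty-< = cong (𝟙 ∘ not) ∘ <⇒<ᵇ≡

  -- In an `𝖾` row the words compared are `v p` and `M u`. Their inversions include those of `p`
  -- with the empty columns of `v` and those of the leading `M` with the occupied columns of `u`.
  -- These boundary terms are distributed over the columns here, which is where the cost of a blank
  -- tile and the excess of a double elbow come from.
  tile-excessE : ∀ {t w s e u} → TileLabels M 𝖾 t w s e u →
    cost 𝖾 t w s + occupied u + lost (flip lt) 𝖾 t w s ≡ empty s + gained (flip lt) 𝖾 t w s + excess 𝖾 t w s
  tile-excessE blank rewrite lt-irrefl M | empty-M = refl
  tile-excessE (hor a<M) rewrite lt-irrefl M | empty-M | lt-< a<M | lt-≥ (<⇒≤ a<M) = refl
  tile-excessE (ver b<M) rewrite empty-< b<M | lt-< b<M | lt-≥ (<⇒≤ b<M) = refl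
  tile-excessE (crs {a = h} {s} h<M s<M h≢s) rewrite empty-< s<M | lt-< s<M =
    trans (cong (_+ lt h s) (sym (lt-connex (h≢s ∘ sym)))) (+-assoc (lt s h) _ _)
  tile-excessE (elEN a<M) rewrite lt-< a<M | empty-M = refl
  tile-excessE (elSW b<M) rewrite lt-irrefl M | empty-< b<M = refl
  tile-excessE (dbE a<M b<M) rewrite lt-< a<M | empty-< b<M = refl

  row-excessE : ∀ {n w e} {r : Vec Tile n} {v u} (rl : RowLabels M 𝖾 w r v u e) →
    rowSum cost rl + sumV occupied u + rowSum (lost (flip lt)) rl ≡
    sumV empty v + rowSum (gained (flip lt)) rl + rowSum excess rl
  row-excessE [] = refl
  row-excessE (_∷_ {t = t} {w} {s} {e} {u} tl rl) =
    trans (regroup (cost 𝖾 t w s) (rowSum cost rl) (occupied u) _ _ _)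
      (trans (cong₂ _+_ (tile-excessE tl) (row-excessE rl)) (sym (regroup (empty s) _ _ _ _ _)))
    where
    regroup : ∀ a b c d x y → a + b + (c + d) + (x + y) ≡ (a + c + x) + (b + d + y)
    regroup = solve-∀

  inv+excess≡cost : ∀ {m n β ps u} {D : PD m n} → Sorted M β ps → (ld : Labelling M β ps D u) →
    inv (flip lt) u + sumL excess ld ≡ sumL cost ld
  inv+excess≡cost {n = n} so [] = trans (+-identityʳ _) (replicated n)
    where
    replicated : ∀ n → inv (flip lt) (Vec.replicate n M) ≡ 0
    replicated zero = refl
    replicated (suc n) = cong₂ _+_ (sumV-replicate n (λ y → lt y M) (lt-irrefl M)) (replicated n)
  inv+excess≡cost so ld₀@(_◂_ {T = 𝗐} {p = p} {u = u} {v = v} rl ld) = begin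
    inv f u + (rowSum excess rl + sumL excess ld)  ≡⟨ sym (+-assoc (inv f u) _ _) ⟩
    inv f u + rowSum excess rl + sumL excess ld    ≡⟨ cong (_+ sumL excess ld) step ⟩
    inv f v + rowSum cost rl + sumL excess ld      ≡⟨ regroup (inv f v) _ _ ⟩
    rowSum cost rl + (inv f v + sumL excess ld)    ≡⟨ cong (rowSum cost rl +_) (inv+excess≡cost (Sorted-tail so) ld) ⟩
    rowSum cost rl + sumL cost ld                  ∎
    where
    open ≡-Reasoning
    f = flip lt
    regroup : ∀ a b c → a + b + c ≡ b + (a + c)
    regroup = solve-∀
    regroup₁ : ∀ a b c d → a + b + (c + d) ≡ a + 0 + c + (b + d)
    regroup₁ = solve-∀
    regroup₂ : ∀ a b c d → 0 + a + b + (c + d) ≡ a + c + (d + b)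
    regroup₂ = solve-∀
    -- The entering pipe is smaller than all labels from the rows below, so putting it in front of
    -- `v` makes no inversion.
    south≥p : sumV (f p) v ≡ 0
    south≥p = sumV-labels-zero (f p) (lt-≥ (<⇒≤ (bounded so zero))) ld (λ i → lt-≥ (<⇒≤ (Sorted-head so i)))
    north≤M : sumV (λ x → f x M) u ≡ 0
    north≤M = sumV-labels-zero (λ x → f x M) (lt-irrefl M) ld₀ (λ i → lt-≥ (<⇒≤ (bounded so i)))
    step : inv f u + rowSum excess rl ≡ inv f v + rowSum cost rl
    -- To avoid subtraction, the row identity and the tile identity are added and the common terms
    -- cancelled.
    step = +-cancelʳ-≡ (rowSum (lost f) rl + rowSum (gained f) rl) _ _ (trans
      (regroup₁ (inv f u) (rowSum excess rl) (rowSum (lost f) rl) (rowSum (gained f) rl)) (trans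
      (cong₂ _+_ (subst₂ (λ a b → inv f u + a + rowSum (lost f) rl ≡ b + inv f v + rowSum (gained f) rl)
                    north≤M south≥p (row-invW f rl))
                 (row-excessW rl))
      (regroup₂ (inv f v) (rowSum (gained f) rl) (rowSum cost rl) (rowSum (lost f) rl))))
  inv+excess≡cost so ld₀@(_◂_ {T = 𝖾} {p = p} {u = u} {v = v} rl ld) = begin
    inv f u + (rowSum excess rl + sumL excess ld)  ≡⟨ sym (+-assoc (inv f u) _ _) ⟩
    inv f u + rowSum excess rl + sumL excess ld    ≡⟨ cong (_+ sumL excess ld) step ⟩
    inv f v + rowSum cost rl + sumL excess ld      ≡⟨ regroup (inv f v) _ _ ⟩
    rowSum cost rl + (inv f v + sumL excess ld)    ≡⟨ cong (rowSum cost rl +_) (inv+excess≡cost (Sorted-tail so) ld) ⟩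
    rowSum cost rl + sumL cost ld                  ∎
    where
    open ≡-Reasoning
    f = flip lt
    regroup : ∀ a b c → a + b + c ≡ b + (a + c)
    regroup = solve-∀
    regroup₁ : ∀ i e o l m g → i + e + (o + l + (m + g)) ≡ (o + i + l) + (m + g + e)
    regroup₁ = solve-∀
    regroup₂ : ∀ i m g c o l → (i + m + g) + (c + o + l) ≡ i + c + (o + l + (m + g))
    regroup₂ = solve-∀
    -- The letters of `v` above `p` are exactly the empty ones: `between` counts pipes numbered
    -- above `p`, and by the numbering none comes from a lower row.
    between : ℕ → ℕ
    between x = lt p x * lt x M
    pointwise : ∀ x → lt p x ≡ empty x + between x
    pointwise x with x <? M
    ... | yes x<M rewrite empty-< x<M | lt-< x<M = sym (*-identityʳ _)
    ... | no x≮M rewrite lt-< (<-≤-trans (bounded so zero) (≮⇒≥ x≮M)) | ≥⇒<ᵇ≡ (≮⇒≥ x≮M) = refl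
    south : sumV (λ x → f x p) v ≡ sumV empty v
    south = trans (sumV-cong pointwise v) (trans (sumV-+ empty between v)
      (trans (cong (sumV empty v +_)
        (sumV-labels-zero between (trans (cong (lt p M *_) (lt-irrefl M)) (*-zeroʳ (lt p M))) ld
          (λ i → cong (_* _) (lt-≥ (<⇒≤ (Sorted-head so i))))))
        (+-identityʳ _)))
    step : inv f u + rowSum excess rl ≡ inv f v + rowSum cost rl
    step = +-cancelʳ-≡ (sumV occupied u + rowSum (lost f) rl + (sumV empty v + rowSum (gained f) rl)) _ _ (trans
      (regroup₁ (inv f u) (rowSum excess rl) (sumV occupied u) (rowSum (lost f) rl) (sumV empty v) (rowSum (gained f) rl))
      (trans
      (cong₂ _+_ (subst (λ b → sumV occupied u + inv f u + rowSum (lost f) rl ≡ inv f v + b + rowSum (gained f) rl)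
                    south (row-invE f rl))
                 (sym (row-excessE rl)))
      (regroup₂ (inv f v) (sumV empty v) (rowSum (gained f) rl) (rowSum cost rl) (sumV occupied u) (rowSum (lost f) rl))))

  -- The status of one pair `a < b` is followed up the grid. The pair starts uninverted, and by
  -- `Sorted` neither pipe inverts it on entering from its side, so only crossings of the two change
  -- it.
  inverted+lost≡gained : ∀ {m n β ps u a b} {D : PD m n} → Sorted M β ps → a < b → b < M →
    (ld : Labelling M β ps D u) →
    inv (inverted a b) u + sumL (lost (inverted a b)) ld ≡ sumL (gained (inverted a b)) ld
  inverted+lost≡gained {n = n} {a = a} {b} so a<b b<M [] = trans (+-identityʳ _) (replicated n)
    where
    replicated : ∀ n → inv (inverted a b) (Vec.replicate n M) ≡ 0
    replicated zero = refl
    replicated (suc n) = cong₂ _+_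
      (sumV-replicate n (λ y → δ M b * δ y a) (cong (_* δ M a) (δ-≢ (<⇒≢ b<M ∘ sym)))) (replicated n)
  inverted+lost≡gained {a = a} {b} so a<b b<M (_◂_ {T = 𝗐} {p = p} {ps = ps} {u = u} {v = v} rl ld) =
    trans (regroup₁ (inv f u) _ _) (trans
      (cong (_+ sumL (lost f) ld)
        (subst₂ (λ x y → inv f u + x + rowSum (lost f) rl ≡ y + inv f v + rowSum (gained f) rl)
          north south (row-invW f rl)))
      (trans (regroup₂ (inv f v) _ _)
        (cong (rowSum (gained f) rl +_) (inverted+lost≡gained (Sorted-tail so) a<b b<M ld))))
    where
    f = inverted a b
    regroup₁ : ∀ i x y → i + (x + y) ≡ i + 0 + x + y
    regroup₁ = solve-∀
    regroup₂ : ∀ i x y → 0 + i + x + y ≡ x + (i + y)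
    regroup₂ = solve-∀
    M≢a : M ≢ a
    M≢a refl = <⇒≯ a<b b<M
    north : sumV (λ x → f x M) u ≡ 0
    north = sumV-zero _ u (λ i → trans (cong (δ (lookup u i) b *_) (δ-≢ M≢a)) (*-zeroʳ (δ (lookup u i) b)))
    south : sumV (f p) v ≡ 0
    south = sumV-labels-zero (f p) (trans (cong (δ p b *_) (δ-≢ M≢a)) (*-zeroʳ (δ p b))) ld vanish
      where
      vanish : ∀ i → f p (lookup ps i) ≡ 0
      vanish i with p ≟ b
      ... | no p≢b = cong (_* _) (δ-≢ p≢b)
      ... | yes refl = trans (cong (δ p p *_) (δ-≢ (<⇒≢ (<-trans a<b (Sorted-head so i)) ∘ sym))) (*-zeroʳ (δ p p))
  inverted+lost≡gained {a = a} {b} so a<b b<M (_◂_ {T = 𝖾} {p = p} {ps = ps} {u = u} {v = v} rl ld) =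
    trans (regroup₁ (inv f u) _ _) (trans
      (cong (_+ sumL (lost f) ld)
        (subst₂ (λ x y → x + inv f u + rowSum (lost f) rl ≡ inv f v + y + rowSum (gained f) rl)
          north south (row-invE f rl)))
      (trans (regroup₂ (inv f v) _ _)
        (cong (rowSum (gained f) rl +_) (inverted+lost≡gained (Sorted-tail so) a<b b<M ld))))
    where
    f = inverted a b
    regroup₁ : ∀ i x y → i + (x + y) ≡ 0 + i + x + y
    regroup₁ = solve-∀
    regroup₂ : ∀ i x y → i + 0 + x + y ≡ x + (i + y)
    regroup₂ = solve-∀
    M≢b : M ≢ b
    M≢b = <⇒≢ b<M ∘ sym
    north : sumV (f M) u ≡ 0
    north = sumV-zero _ u (λ i → cong (_* _) (δ-≢ M≢b))
    south : sumV (λ x → f x p) v ≡ 0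
    south = sumV-labels-zero (λ x → f x p) (cong (_* _) (δ-≢ M≢b)) ld vanish
      where
      vanish : ∀ i → f (lookup ps i) p ≡ 0
      vanish i with p ≟ a
      ... | no p≢a = trans (cong (δ (lookup ps i) b *_) (δ-≢ p≢a)) (*-zeroʳ (δ (lookup ps i) b))
      ... | yes refl = cong (_* _) (δ-≢ (<⇒≢ (<-trans (Sorted-head so i) a<b)))

  -- The bound by the total is passed on for every statistic `F′`, since the one that forces `F` to
  -- vanish at a tile may be another one, chosen from the labels of that tile.
  rowSum-zero : ∀ {n T w e} {r : Vec Tile n} {v u} F (rl : RowLabels M T w r v u e) →
    (∀ {j t w s e u} → nth r j ≡ just t → TileLabels M T t w s e u →
       (∀ F′ → F′ T t w s ≤ rowSum F′ rl) → F T t w s ≡ 0) →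
    rowSum F rl ≡ 0
  rowSum-zero F [] h = refl
  rowSum-zero F (tl ∷ rl) h = cong₂ _+_ (h {zero} refl tl (λ F′ → m≤m+n _ _))
    (rowSum-zero F rl (λ {j} eq tl′ le → h {suc j} eq tl′ (λ F′ → m≤n⇒m≤o+n _ (le F′))))

  sumL-zero : ∀ {m n β ps u} {D : PD m n} F (ld : Labelling M β ps D u) →
    (∀ {i j T t w s e u} → nth β i ≡ just T → tileAt D i j ≡ just t → TileLabels M T t w s e u →
       (∀ F′ → F′ T t w s ≤ sumL F′ ld) → F T t w s ≡ 0) →
    sumL F ld ≡ 0
  sumL-zero F [] h = refl
  sumL-zero F (rl ◂ ld) h = cong₂ _+_
    (rowSum-zero F rl (λ {j} eq tl le → h {zero} {j} refl eq tl (λ F′ → ≤-trans (le F′) (m≤m+n _ _))))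
    (sumL-zero F ld (λ {i} {j} eqβ eq tl le → h {suc i} {j} eqβ eq tl (λ F′ → m≤n⇒m≤o+n _ (le F′))))

  rowSum-tile : ∀ {n T w e} {r : Vec Tile n} {v u} (rl : RowLabels M T w r v u e) {j t} → nth r j ≡ just t →
    ∃₂ λ w s → ∃₂ λ e u → TileLabels M T t w s e u × (∀ F → F T t w s ≤ rowSum F rl)
  rowSum-tile (tl ∷ rl) {zero} refl = _ , _ , _ , _ , tl , λ F → m≤m+n _ _
  rowSum-tile (tl ∷ rl) {suc j} eq with w , s , e , u , tl′ , le ← rowSum-tile rl {j} eq =
    w , s , e , u , tl′ , λ F → m≤n⇒m≤o+n _ (le F)

  sumL-tile : ∀ {m n β ps u} {D : PD m n} (ld : Labelling M β ps D u) {i j T t} →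
    nth β i ≡ just T → tileAt D i j ≡ just t →
    ∃₂ λ w s → ∃₂ λ e u → TileLabels M T t w s e u × (∀ F → F T t w s ≤ sumL F ld)
  sumL-tile (rl ◂ ld) {zero} {j} refl eq with w , s , e , u , tl , le ← rowSum-tile rl {j} eq =
    w , s , e , u , tl , λ F → ≤-trans (le F) (m≤m+n _ _)
  sumL-tile (rl ◂ ld) {suc i} {j} eqβ eq with w , s , e , u , tl , le ← sumL-tile ld {i} {j} eqβ eq =
    w , s , e , u , tl , λ F → m≤n⇒m≤o+n _ (le F)

-- Pipes as walks

any-++ : ∀ {A : Set} (p : A → Bool) xs ys → any p (xs ++ ys) ≡ any p xs ∨ any p ys
any-++ p [] ys = refl
any-++ p (x ∷ xs) ys with p x
... | true = refl
... | false = any-++ p xs ys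

any-map : ∀ {A B : Set} (p : B → Bool) (f : A → B) xs → any p (List.map f xs) ≡ any (p ∘ f) xs
any-map p f [] = refl
any-map p f (x ∷ xs) = cong (p (f x) ∨_) (any-map p f xs)

any-false : ∀ {A : Set} {p : A → Bool} (xs : List A) → (∀ x → p x ≡ false) → any p xs ≡ false
any-false [] h = refl
any-false (x ∷ xs) h rewrite h x = any-false xs h

-- The result `nothing` means leaving across the West edge. For the tail of a longer row this is a
-- passage into the preceding column, where `RowRun-append` takes the run up again.
data RowRun {n} (r : Vec Tile n) : ℕ → Side → List ℕ → Maybe ℕ → Set where
  north : ∀ {j s t} → nth r j ≡ just t → through t s ≡ just N → RowRun r j s (j ∷ []) (just j)
  east  : ∀ {j s t js c} → nth r j ≡ just t → through t s ≡ just E → RowRun r (suc j) W js c →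
          RowRun r j s (j ∷ js) c
  west  : ∀ {j s t js c} → nth r (suc j) ≡ just t → through t s ≡ just W → RowRun r j E js c →
          RowRun r (suc j) s (suc j ∷ js) c
  off   : ∀ {s t} → nth r 0 ≡ just t → through t s ≡ just W → RowRun r 0 s (0 ∷ []) nothing

RowRun-shift : ∀ {n t} {r : Vec Tile n} {j s js c} → RowRun r j s js (just c) →
  RowRun (t ∷ r) (suc j) s (List.map suc js) (just (suc c))
RowRun-shift (north eq th) = north eq th
RowRun-shift (east eq th run) = east eq th (RowRun-shift run)
RowRun-shift (west eq th run) = west eq th (RowRun-shift run)

RowRun-append : ∀ {n t} {r : Vec Tile n} {j s js js′ c} → RowRun r j s js nothing →
  RowRun (t ∷ r) 0 E js′ c → RowRun (t ∷ r) (suc j) s (List.map suc js ++ js′) c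
RowRun-append (east eq th run) run′ = east eq th (RowRun-append run run′)
RowRun-append (west eq th run) run′ = west eq th (RowRun-append run run′)
RowRun-append (off eq th) run′ = west eq th run′

-- The walk without fuel. There is no constructor for a step South because pipes of a labelled
-- tiling only move North or along a row.
data Run {m n} (D : PD m n) : ℕ → ℕ → Side → List (ℕ × ℕ) → ℕ → Set where
  exit  : ∀ {j s t} → tileAt D 0 j ≡ just t → through t s ≡ just N → Run D 0 j s ((0 , j) ∷ []) j
  north : ∀ {i j s t ps c} → tileAt D (suc i) j ≡ just t → through t s ≡ just N → Run D i j S ps c →
          Run D (suc i) j s ((suc i , j) ∷ ps) c
  east  : ∀ {i j s t ps c} → tileAt D i j ≡ just t → through t s ≡ just E → Run D i (suc j) W ps c →
          Run D i j s ((i , j) ∷ ps) c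
  west  : ∀ {i j s t ps c} → tileAt D i (suc j) ≡ just t → through t s ≡ just W → Run D i j E ps c →
          Run D i (suc j) s ((i , suc j) ∷ ps) c

Run⇒walk : ∀ {m n} {D : PD m n} {i j s ps c} → Run D i j s ps c → ∀ f → length ps ≤ f →
  walk D f i j s ≡ (ps , just c)
Run⇒walk (exit eq th) (suc f) le rewrite eq | th = refl
Run⇒walk (north eq th run) (suc f) (s≤s le) rewrite eq | th | Run⇒walk run f le = refl
Run⇒walk (east eq th run) (suc f) (s≤s le) rewrite eq | th | Run⇒walk run f le = refl
Run⇒walk (west eq th run) (suc f) (s≤s le) rewrite eq | th | Run⇒walk run f le = refl

topRow : ℕ → ℕ × ℕ
topRow j = 0 , j

RowRun⇒Run : ∀ {m n} {r : Vec Tile n} {D : PD m n} {j s js c} → RowRun r j s js (just c) →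
  Run (r ∷ D) 0 j s (List.map topRow js) c
RowRun⇒Run (north eq th) = exit eq th
RowRun⇒Run (east eq th run) = east eq th (RowRun⇒Run run)
RowRun⇒Run (west eq th run) = west eq th (RowRun⇒Run run)

down : ℕ × ℕ → ℕ × ℕ
down (i , j) = suc i , j

Run-extend : ∀ {m n} {r : Vec Tile n} {D : PD m n} {i j s ps c js c′} → Run D i j s ps c →
  RowRun r c S js (just c′) →
  Run (r ∷ D) (suc i) j s (List.map down ps ++ List.map topRow js) c′
Run-extend (exit eq th) row = north eq th (RowRun⇒Run row)
Run-extend (north eq th run) row = north eq th (Run-extend run row)
Run-extend (east eq th run) row = east eq th (Run-extend run row)
Run-extend (west eq th run) row = west eq th (Run-extend run row)

meets : ℕ → ℕ → ℕ → Bool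
meets a h s = (h ≡ᵇ a) ∨ (s ≡ᵇ a)

count : ∀ {n} → ℕ → Vec ℕ n → ℕ
count a = sumV (λ x → δ x a)

count-nth : ∀ {n a} (v : Vec ℕ n) j → nth v j ≡ just a → 1 ≤ count a v
count-nth {a = a} (x ∷ v) zero refl = ≤-trans (≤-reflexive (sym (δ-refl a))) (m≤m+n _ _)
count-nth (x ∷ v) (suc j) eq = m≤n⇒m≤o+n _ (count-nth v j eq)

δ-zero⁻ : ∀ {x a} → δ x a ≡ 0 → x ≢ a
δ-zero⁻ {x} eq refl with trans (sym (δ-refl x)) eq
... | ()

hit : Bool → List ℕ
hit b = if b then 0 ∷ [] else []

startColumn : RowType → ℕ → ℕ
startColumn 𝗐 n = 0
startColumn 𝖾 n = n ∸ 1

startSide : RowType → Side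
startSide 𝗐 = W
startSide 𝖾 = E

module _ {M : ℕ} where

  -- The order is that of the walk, since `pipeOfRow` returns a list: in an `𝖾` row the pipe travels
  -- westward and the head tile comes last. A tile belongs to the pipe if one of its two incoming
  -- labels is `a`.
  columns : ∀ {T n w e} {r : Vec Tile n} {v u} → ℕ → RowLabels M T w r v u e → List ℕ
  columns a [] = []
  columns {T = 𝗐} a (_∷_ {w = w} {s} tl rl) = hit (meets a w s) ++ List.map suc (columns a rl)
  columns {T = 𝖾} a (_∷_ {s = s} {e} tl rl) = List.map suc (columns a rl) ++ hit (meets a e s)

  path : ∀ {m n β ps u} {D : PD m n} → ℕ → Labelling M β ps D u → List (ℕ × ℕ)
  path a [] = []
  path a (rl ◂ ld) = List.map down (path a ld) ++ List.map topRow (columns a rl)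

  routeW : ∀ {t w s e u} → TileLabels M 𝗐 t w s e u →
    (e ≡ w × u ≡ s × (w < M → through t W ≡ just E) × (s < M → through t S ≡ just N)) ⊎
    (e ≡ s × u ≡ w × (w < M → through t W ≡ just N) × (s < M → through t S ≡ just E))
  routeW blank = inj₂ (refl , refl , ⊥-elim ∘ <-irrefl refl , ⊥-elim ∘ <-irrefl refl)
  routeW (hor _) = inj₁ (refl , refl , const refl , ⊥-elim ∘ <-irrefl refl)
  routeW (ver _) = inj₁ (refl , refl , ⊥-elim ∘ <-irrefl refl , const refl)
  routeW (crs _ _ _) = inj₁ (refl , refl , const refl , const refl)
  routeW (elWN _) = inj₂ (refl , refl , const refl , ⊥-elim ∘ <-irrefl refl)
  routeW (elSE _) = inj₂ (refl , refl , ⊥-elim ∘ <-irrefl refl , const refl)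
  routeW (dbW _ _) = inj₂ (refl , refl , const refl , const refl)

  routeE : ∀ {t w s e u} → TileLabels M 𝖾 t w s e u →
    (w ≡ e × u ≡ s × (e < M → through t E ≡ just W) × (s < M → through t S ≡ just N)) ⊎
    (w ≡ s × u ≡ e × (e < M → through t E ≡ just N) × (s < M → through t S ≡ just W))
  routeE blank = inj₂ (refl , refl , ⊥-elim ∘ <-irrefl refl , ⊥-elim ∘ <-irrefl refl)
  routeE (hor _) = inj₁ (refl , refl , const refl , ⊥-elim ∘ <-irrefl refl)
  routeE (ver _) = inj₁ (refl , refl , ⊥-elim ∘ <-irrefl refl , const refl)
  routeE (crs _ _ _) = inj₁ (refl , refl , const refl , const refl)
  routeE (elEN _) = inj₂ (refl , refl , const refl , ⊥-elim ∘ <-irrefl refl)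
  routeE (elSW _) = inj₂ (refl , refl , ⊥-elim ∘ <-irrefl refl , const refl)
  routeE (dbE _ _) = inj₂ (refl , refl , const refl , const refl)

  hit-none : ∀ {a h s} → δ h a ≡ 0 → δ s a ≡ 0 → hit (meets a h s) ≡ []
  hit-none {a} {h} {s} h0 s0 rewrite ≢⇒≡ᵇ (δ-zero⁻ {h} {a} h0) | ≢⇒≡ᵇ (δ-zero⁻ {s} {a} s0) = refl

  hit-h : ∀ a s → hit (meets a a s) ≡ 0 ∷ []
  hit-h a s rewrite ≡ᵇ-refl a = refl

  hit-s : ∀ a h → hit (meets a h a) ≡ 0 ∷ []
  hit-s a h rewrite ≡ᵇ-refl a | ∨-zeroʳ (h ≡ᵇ a) = refl

  columnsW-none : ∀ {n w e} {r : Vec Tile n} {v u a} (rl : RowLabels M 𝗐 w r v u e) →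
    δ w a + count a v ≡ 0 → columns a rl ≡ []
  columnsW-none [] _ = refl
  columnsW-none {a = a} (_∷_ {w = w} {s} {e} {v = v} tl rl) eq
    rewrite hit-none {a} {w} {s} (m+n≡0⇒m≡0 _ eq) (m+n≡0⇒m≡0 _ (m+n≡0⇒n≡0 (δ w a) eq)) =
    cong (List.map suc) (columnsW-none rl rest)
    where
    rest : δ e a + count a v ≡ 0
    rest with turnW tl
    ... | inj₁ (_ , refl , _) = cong₂ _+_ (m+n≡0⇒m≡0 _ eq) (m+n≡0⇒n≡0 (δ s a) (m+n≡0⇒n≡0 (δ w a) eq))
    ... | inj₂ (_ , refl , _) = m+n≡0⇒n≡0 (δ w a) eq

  columnsE-none : ∀ {n w e} {r : Vec Tile n} {v u a} (rl : RowLabels M 𝖾 w r v u e) →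
    count a v + δ e a ≡ 0 → columns a rl ≡ []
  columnsE-none [] _ = refl
  columnsE-none {e = e} {a = a} (_∷_ {s = s} {e₁} {v = v} tl rl) eq =
    cong₂ (λ js h → List.map suc js ++ h) (columnsE-none {a = a} rl rest)
        (hit-none {a} {e₁} {s} e₁0 (m+n≡0⇒m≡0 _ (m+n≡0⇒m≡0 (δ s a + count a v) eq)))
    where
    rest : count a v + δ e a ≡ 0
    rest = m+n≡0⇒n≡0 (δ s a) (trans (sym (+-assoc (δ s a) _ _)) eq)
    e₁0 : δ e₁ a ≡ 0
    e₁0 = m+n≡0⇒m≡0 _ (trans (sym (row-permE (λ x → δ x a) rl)) rest)

  one-left : ∀ {x y} → x ≡ 1 → x + y ≤ 1 → y ≡ 0
  one-left refl (s≤s z≤n) = refl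

  -- As `a` occurs once among the incoming labels, the tiles marked by `columns` form one contiguous
  -- run, ending at the column where `a` turns North. A second strand with the same label would add
  -- tiles foreign to the walk.
  runW-west : ∀ {n w} {r : Vec Tile n} {v u a} → a < M → (rl : RowLabels M 𝗐 w r v u M) → w ≡ a →
    δ w a + count a v ≤ 1 →
    ∃ λ c → RowRun r 0 W (columns a rl) (just c) × nth u c ≡ just a
  runW-west a<M [] refl _ = ⊥-elim (<-irrefl refl a<M)
  runW-west {a = a} a<M (_∷_ {t = t} {s = s} {r = r} tl rl) refl le
    with routeW tl | one-left (δ-refl a) le
  ... | inj₁ (refl , _ , WE , _) | rest rewrite hit-h a s
      with c , run , eq ← runW-west a<M rl refl
                            (≤-reflexive (cong₂ _+_ (δ-refl a) (m+n≡0⇒n≡0 (δ s a) rest))) =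
      suc c , east refl (WE a<M) (RowRun-shift run) , eq
  ... | inj₂ (refl , refl , WN , _) | rest rewrite hit-h a s | columnsW-none {a = a} rl rest =
      0 , north refl (WN a<M) , refl

  runW-south : ∀ {n w} {r : Vec Tile n} {v u a} → a < M → (rl : RowLabels M 𝗐 w r v u M) →
    ∀ j → nth v j ≡ just a → δ w a + count a v ≤ 1 →
    ∃ λ c → RowRun r j S (columns a rl) (just c) × nth u c ≡ just a
  runW-south {a = a} a<M (_∷_ {t = t} {w} {s} {v = v} tl rl) zero refl le
    with routeW tl | one-left (δ-refl a) (≤-trans (≤-reflexive (x+[y+z]≡y+[x+z] (δ s a) (δ w a) (count a v))) le)
  ... | inj₁ (refl , refl , _ , SN) | rest rewrite hit-s a w | columnsW-none {a = a} rl rest =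
      0 , north refl (SN a<M) , refl
  ... | inj₂ (refl , refl , _ , SE) | rest rewrite hit-s a w
      with c , run , eq ← runW-west a<M rl refl
                            (≤-reflexive (cong₂ _+_ (δ-refl a) (m+n≡0⇒n≡0 (δ w a) rest))) =
      suc c , east refl (SE a<M) (RowRun-shift run) , eq
  runW-south {a = a} a<M (_∷_ {t = t} {w} {s} {e} {v = v} tl rl) (suc j) eq le =
    let c , run , eq′ = runW-south a<M rl j eq rest in
      suc c , subst (λ h → RowRun _ _ _ (h ++ _) (just (suc c))) (sym (hit-none {a} {w} {s} w0 s0)) (RowRun-shift run) , eq′
    where
    lemma : ∀ {x y z} → 1 ≤ z → x + (y + z) ≤ 1 → x ≡ 0 × y ≡ 0 × z ≤ 1
    lemma {zero} {zero} _ q = refl , refl , q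
    lemma {zero} {suc y} {z} p (s≤s q) = ⊥-elim (<⇒≢ p (sym (n≤0⇒n≡0 (≤-trans (m≤n+m z y) q))))
    lemma {suc x} {y} {z} p (s≤s q) = ⊥-elim (<⇒≢ p (sym (n≤0⇒n≡0 (≤-trans (≤-trans (m≤n+m z y) (m≤n+m _ x)) q))))
    zeros = lemma {δ w a} {δ s a} (count-nth v j eq) le
    w0 = proj₁ zeros
    s0 = proj₁ (proj₂ zeros)
    rest : δ e a + count a v ≤ 1
    rest with turnW tl
    ... | inj₁ (_ , refl , _) rewrite w0 = proj₂ (proj₂ zeros)
    ... | inj₂ (_ , refl , _) rewrite s0 = proj₂ (proj₂ zeros)

  -- The induction on an `𝖾` row removes the tile that the pipe would reach last, so a pipe may also
  -- leave the remaining row westward; its label then sits on the edge `w`, where the removed tile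
  -- takes over.
  LeavesE : ∀ {n w e} {r : Vec Tile n} {v u} → ℕ → RowLabels M 𝖾 w r v u e → ℕ → Side → Set
  LeavesE {w = w} {r = r} {u = u} a rl j s =
    (∃ λ c → RowRun r j s (columns a rl) (just c) × nth u c ≡ just a) ⊎
    (RowRun r j s (columns a rl) nothing × w ≡ a)

  leavesE-suc : ∀ {n t w s e₁ e u₀} {r : Vec Tile n} {v us a} → a < M →
    (tl : TileLabels M 𝖾 t w s e₁ u₀) (rl : RowLabels M 𝖾 e₁ r v us e) → ∀ {j d} →
    δ s a ≡ 0 → count a v + δ e a ≤ 1 → LeavesE a rl j d → LeavesE a (tl ∷ rl) (suc j) d
  leavesE-suc {s = s} {e₁} {us = us} {a} a<M tl rl s0 le (inj₁ (c , run , eq)) =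
    inj₁ (suc c , subst (λ js → RowRun _ _ _ js _) columns≡ (RowRun-shift run) , eq)
    where
    e₁0 : δ e₁ a ≡ 0
    e₁0 = n≤0⇒n≡0 (s≤s⁻¹ (begin
      suc (δ e₁ a)           ≡⟨ +-comm 1 _ ⟩
      δ e₁ a + 1             ≤⟨ +-monoʳ-≤ (δ e₁ a) (count-nth us c eq) ⟩
      δ e₁ a + count a us    ≡⟨ sym (row-permE (λ x → δ x a) rl) ⟩
      _                      ≤⟨ le ⟩
      1                      ∎))
      where open ≤-Reasoning
    columns≡ : List.map suc (columns a rl) ≡ List.map suc (columns a rl) ++ hit (meets a e₁ s)
    columns≡ = trans (sym (List.++-identityʳ _)) (cong (List.map suc (columns a rl) ++_) (sym (hit-none {a} {e₁} {s} e₁0 s0)))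
  leavesE-suc {s = s} {a = a} a<M tl rl s0 le (inj₂ (run , refl)) rewrite hit-h a s with routeE tl
  ... | inj₁ (refl , _ , EW , _) = inj₂ (RowRun-append run (off refl (EW a<M)) , refl)
  ... | inj₂ (_ , refl , EN , _) = inj₁ (0 , RowRun-append run (north refl (EN a<M)) , refl)

  runE-south : ∀ {n w e} {r : Vec Tile n} {v u a} → a < M → (rl : RowLabels M 𝖾 w r v u e) →
    ∀ j → nth v j ≡ just a → count a v + δ e a ≤ 1 → LeavesE a rl j S
  runE-south {e = e} {a = a} a<M (_∷_ {s = s} {e₁} {v = v} tl rl) zero refl le
    rewrite columnsE-none {a = a} rl (one-left (δ-refl a) (≤-trans (≤-reflexive (sym (+-assoc (δ a a) _ _))) le)) | hit-s a e₁
    with routeE tl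
  ... | inj₁ (_ , refl , _ , SN) = inj₁ (0 , north refl (SN a<M) , refl)
  ... | inj₂ (refl , _ , _ , SW) = inj₂ (off refl (SW a<M) , refl)
  runE-south {e = e} {a = a} a<M (_∷_ {s = s} {e₁} {v = v} tl rl) (suc j) eq le =
    leavesE-suc a<M tl rl s0 rest (runE-south a<M rl j eq rest)
    where
    rest : count a v + δ e a ≤ 1
    rest = ≤-trans (m≤n+m _ (δ s a)) (≤-trans (≤-reflexive (sym (+-assoc (δ s a) _ _))) le)
    s0 : δ s a ≡ 0
    s0 = n≤0⇒n≡0 (s≤s⁻¹ (begin
      suc (δ s a)                 ≡⟨ +-comm 1 _ ⟩
      δ s a + 1                   ≤⟨ +-monoʳ-≤ (δ s a) (count-nth v j eq) ⟩
      δ s a + count a v           ≤⟨ m≤m+n _ _ ⟩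
      δ s a + count a v + δ e a   ≤⟨ le ⟩
      1                           ∎))
      where open ≤-Reasoning

  runE-east : ∀ {n w e} {r : Vec Tile (suc n)} {v u a} → a < M → (rl : RowLabels M 𝖾 w r v u e) →
    e ≡ a → count a v + δ e a ≤ 1 → LeavesE a rl n E
  runE-east {a = a} a<M (_∷_ {s = s} tl []) refl le rewrite hit-h a s with routeE tl
  ... | inj₁ (refl , _ , EW , _) = inj₂ (off refl (EW a<M) , refl)
  ... | inj₂ (_ , refl , EN , _) = inj₁ (0 , north refl (EN a<M) , refl)
  runE-east {e = e} {a = a} a<M (_∷_ {s = s} {v = v} tl rl@(_ ∷ _)) refl le =
    leavesE-suc a<M tl rl (m+n≡0⇒m≡0 _ none) rest (runE-east a<M rl refl rest)
    where
    none : δ s a + count a v ≡ 0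
    none = one-left (δ-refl a) (≤-trans (≤-reflexive (+-comm (δ a a) _)) le)
    rest : count a v + δ e a ≤ 1
    rest = ≤-trans (m≤n+m _ (δ s a)) (≤-trans (≤-reflexive (sym (+-assoc (δ s a) _ _))) le)

  label≢M : ∀ {a} → a < M → δ M a ≡ 0
  label≢M a<M = δ-≢ (<⇒≢ a<M ∘ sym)

  path-none : ∀ {m n β ps u a} {D : PD m n} → a < M → (ld : Labelling M β ps D u) →
    count a ps ≡ 0 → path a ld ≡ []
  path-none a<M [] _ = refl
  path-none {a = a} a<M (_◂_ {T = 𝗐} {p = p} rl ld) eq
    rewrite path-none a<M ld (m+n≡0⇒n≡0 (δ p a) eq)
          | columnsW-none {a = a} rl (trans (cong (δ p a +_) (sumV-labels _ (label≢M a<M) ld)) eq) = refl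
  path-none {a = a} a<M (_◂_ {T = 𝖾} {p = p} rl ld) eq
    rewrite path-none a<M ld (m+n≡0⇒n≡0 (δ p a) eq)
          | columnsE-none {a = a} rl (trans (cong (_+ δ p a) (sumV-labels _ (label≢M a<M) ld)) (trans (+-comm _ (δ p a)) eq)) = refl

  Precedes⇒≢ : ∀ {T p q} → Precedes T p q → p ≢ q
  Precedes⇒≢ {𝗐} lt = <⇒≢ lt
  Precedes⇒≢ {𝖾} lt = <⇒≢ lt ∘ sym

  Sorted-unique : ∀ {m β} {ps : Vec ℕ m} → Sorted M β ps → ∀ a → count a ps ≤ 1
  Sorted-unique {β = []} {[]} so a = z≤n
  Sorted-unique {β = T ∷ β} {p ∷ ps} so a with p ≟ a
  ... | yes refl rewrite δ-refl p
      | sumV-zero (λ x → δ x p) ps (λ i → δ-≢ (Precedes⇒≢ {T} (Sorted-head so i) ∘ sym)) = ≤-refl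
  ... | no p≢a rewrite δ-≢ p≢a = Sorted-unique (Sorted-tail so) a

  -- Below its own row a pipe leaves no trace, so its walk starts in that row and is extended one
  -- row at a time, entering each from the South at the column where the word on the grid line
  -- carries its label.
  path-run : ∀ {m n β ps u} {D : PD m (suc n)} → Sorted M β ps → (ld : Labelling M β ps D u) → ∀ i →
    ∃ λ c → Run D (toℕ i) (startColumn (lookup β i) (suc n)) (startSide (lookup β i)) (path (lookup ps i) ld) c
            × nth u c ≡ just (lookup ps i)
  path-run so (_◂_ {T = 𝗐} {p = p} rl ld) zero
    rewrite path-none (bounded so zero) ld (one-left (δ-refl p) (Sorted-unique so p))
    with c , run , eq ← runW-west (bounded so zero) rl refl
      (≤-trans (≤-reflexive (cong (δ p p +_) (sumV-labels _ (label≢M (bounded so zero)) ld))) (Sorted-unique so p)) =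
    c , RowRun⇒Run run , eq
  path-run so (_◂_ {T = 𝖾} {p = p} rl ld) zero
    rewrite path-none (bounded so zero) ld (one-left (δ-refl p) (Sorted-unique so p))
    with runE-east (bounded so zero) rl refl
      (≤-trans (≤-reflexive (trans (cong (_+ δ p p) (sumV-labels _ (label≢M (bounded so zero)) ld)) (+-comm _ (δ p p)))) (Sorted-unique so p))
  ... | inj₁ (c , run , eq) = c , RowRun⇒Run run , eq
  -- The West boundary edge of an `𝖾` row is labelled `M`, so no pipe leaves there.
  ... | inj₂ (_ , eq) = ⊥-elim (<⇒≢ (bounded so zero) (sym eq))
  path-run so (_◂_ {T = 𝗐} {p = p} {ps = ps} rl ld) (suc i)
    with c , run , eq ← path-run (Sorted-tail so) ld i
    with c′ , run′ , eq′ ← runW-south (bounded so (suc i)) rl c eq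
      (≤-trans (≤-reflexive (cong (δ p (lookup ps i) +_) (sumV-labels _ (label≢M (bounded so (suc i))) ld)))
        (Sorted-unique so (lookup ps i))) =
    c′ , Run-extend run run′ , eq′
  path-run so (_◂_ {T = 𝖾} {p = p} {ps = ps} rl ld) (suc i)
    with c , run , eq ← path-run (Sorted-tail so) ld i
    with runE-south (bounded so (suc i)) rl c eq
      (≤-trans (≤-reflexive (trans (cong (_+ δ p (lookup ps i)) (sumV-labels _ (label≢M (bounded so (suc i))) ld)) (+-comm _ (δ p (lookup ps i))))) (Sorted-unique so (lookup ps i)))
  ... | inj₁ (c′ , run′ , eq′) = c′ , Run-extend run run′ , eq′
  ... | inj₂ (_ , eq′) = ⊥-elim (<⇒≢ (bounded so (suc i)) (sym eq′))

  length-hit : ∀ b → length (hit b) ≤ 1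
  length-hit true = ≤-refl
  length-hit false = z≤n

  length-columns : ∀ {T n w e} {r : Vec Tile n} {v u} a (rl : RowLabels M T w r v u e) →
    length (columns a rl) ≤ n
  length-columns a [] = z≤n
  length-columns {𝗐} a (_∷_ {w = w} {s} tl rl) = begin
    length (hit (meets a w s) ++ List.map suc (columns a rl))           ≡⟨ List.length-++ (hit (meets a w s)) ⟩
    length (hit (meets a w s)) + length (List.map suc (columns a rl))   ≡⟨ cong (length (hit (meets a w s)) +_) (List.length-map suc (columns a rl)) ⟩
    length (hit (meets a w s)) + length (columns a rl)                  ≤⟨ +-mono-≤ (length-hit (meets a w s)) (length-columns a rl) ⟩
    suc _                                                               ∎
    where open ≤-Reasoning
  length-columns {𝖾} a (_∷_ {n = n} {s = s} {e} tl rl) = begin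
    length (List.map suc (columns a rl) ++ hit (meets a e s))           ≡⟨ List.length-++ (List.map suc (columns a rl)) ⟩
    length (List.map suc (columns a rl)) + length (hit (meets a e s))   ≡⟨ cong (_+ length (hit (meets a e s))) (List.length-map suc (columns a rl)) ⟩
    length (columns a rl) + length (hit (meets a e s))                  ≤⟨ +-mono-≤ (length-columns a rl) (length-hit (meets a e s)) ⟩
    n + 1                                                               ≡⟨ +-comm n 1 ⟩
    suc n                                                               ∎
    where open ≤-Reasoning

  -- This makes the fuel `suc (m * n)` given to `walk` sufficient.
  length-path : ∀ {m n β ps u} {D : PD m n} a (ld : Labelling M β ps D u) → length (path a ld) ≤ m * n
  length-path a [] = z≤n
  length-path {suc m} {n} a (rl ◂ ld) = begin
    length (List.map down (path a ld) ++ List.map topRow (columns a rl))           ≡⟨ List.length-++ (List.map down (path a ld)) ⟩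
    length (List.map down (path a ld)) + length (List.map topRow (columns a rl))   ≡⟨ cong₂ _+_ (List.length-map down (path a ld)) (List.length-map topRow (columns a rl)) ⟩
    length (path a ld) + length (columns a rl)                                     ≤⟨ +-mono-≤ (length-path a ld) (length-columns a rl) ⟩
    m * n + n                                                                      ≡⟨ +-comm (m * n) n ⟩
    n + m * n                                                                      ∎
    where open ≤-Reasoning

-- Crossings

nth⇒< : ∀ {A : Set} {n} (v : Vec A n) j {x} → nth v j ≡ just x → j < n
nth⇒< (_ ∷ _) zero _ = z<s
nth⇒< (_ ∷ v) (suc j) eq = s<s (nth⇒< v j eq)

tileAt⇒< : ∀ {m n} {D : PD m n} i j {t} → tileAt D i j ≡ just t → i < m × j < n
tileAt⇒< {D = r ∷ D} zero j eq = z<s , nth⇒< r j eq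
tileAt⇒< {D = r ∷ D} (suc i) j eq = let p , q = tileAt⇒< {D = D} i j eq in s<s p , q

<⇒nth : ∀ {A : Set} {n} (v : Vec A n) {j} → j < n → ∃ λ x → nth v j ≡ just x
<⇒nth (x ∷ v) {zero} _ = x , refl
<⇒nth (x ∷ v) {suc j} (s≤s p) = <⇒nth v p

<⇒tileAt : ∀ {m n} (D : PD m n) {i j} → i < m → j < n → ∃ λ t → tileAt D i j ≡ just t
<⇒tileAt (r ∷ D) {zero} _ q = <⇒nth r q
<⇒tileAt (r ∷ D) {suc i} (s≤s p) q = <⇒tileAt D p q

nth-lookup : ∀ {A : Set} {n} (v : Vec A n) i → nth v (toℕ i) ≡ just (lookup v i)
nth-lookup (x ∷ v) zero = refl
nth-lookup (x ∷ v) (suc i) = nth-lookup v i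

rowType-lookup : ∀ {m} (β : Vec RowType m) i → rowType β (toℕ i) ≡ lookup β i
rowType-lookup β i rewrite nth-lookup β i = refl

inv-inverted-zero : ∀ {n} a b (v : Vec ℕ n) → count b v ≡ 0 → inv (λ x y → δ x b * δ y a) v ≡ 0
inv-inverted-zero a b [] _ = refl
inv-inverted-zero a b (x ∷ v) eq rewrite m+n≡0⇒m≡0 (δ x b) eq =
  cong₂ _+_ (sumV-zero (λ _ → 0) v (λ _ → refl)) (inv-inverted-zero a b v (m+n≡0⇒n≡0 (δ x b) eq))

inv-inverted≤1 : ∀ {n} a b (v : Vec ℕ n) → count a v ≤ 1 → count b v ≤ 1 → inv (λ x y → δ x b * δ y a) v ≤ 1
inv-inverted≤1 a b [] _ _ = z≤n
inv-inverted≤1 a b (x ∷ v) la lb with x ≟ b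
... | yes refl rewrite δ-refl x
      | inv-inverted-zero a x v (n≤0⇒n≡0 (s≤s⁻¹ lb))
      | +-identityʳ (sumV (λ y → δ y a + 0) v)
      | sumV-cong (λ y → +-identityʳ (δ y a)) v = ≤-trans (m≤n+m _ (δ x a)) la
... | no x≢b rewrite δ-≢ x≢b | sumV-zero (λ _ → 0) v (λ _ → refl) =
      inv-inverted≤1 a b v (≤-trans (m≤n+m _ (δ x a)) la) lb

isCrsIn : ∀ {n} → Vec Tile n → ℕ → Bool
isCrsIn r j = maybe isCrs false (nth r j)

any-hit-suc : ∀ j b js → any (suc j ≡ᵇ_) (hit b ++ List.map suc js) ≡ any (j ≡ᵇ_) js
any-hit-suc j true js = any-map (suc j ≡ᵇ_) suc js
any-hit-suc j false js = any-map (suc j ≡ᵇ_) suc js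

any-hit-zero : ∀ b js → any (0 ≡ᵇ_) (hit b ++ List.map suc js) ≡ b
any-hit-zero true js = refl
any-hit-zero false js = trans (any-map (0 ≡ᵇ_) suc js) (any-false js (λ _ → refl))

any-comm : ∀ {A : Set} (p : A → Bool) xs ys → any p (xs ++ ys) ≡ any p (ys ++ xs)
any-comm p xs ys = trans (any-++ p xs ys) (trans (∨-comm (any p xs) (any p ys)) (sym (any-++ p ys xs)))

countᵇ-comm : ∀ {A : Set} (p : A → Bool) xs ys → countᵇ p (xs ++ ys) ≡ countᵇ p (ys ++ xs)
countᵇ-comm p xs ys = trans (countᵇ-++ p xs ys) (trans (+-comm (countᵇ p xs) _) (sym (countᵇ-++ p ys xs)))

countᵇ-hit : ∀ {n} t (r : Vec Tile n) A B as bs →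
  countᵇ (λ j → isCrsIn (t ∷ r) j ∧ any (j ≡ᵇ_) (hit B ++ List.map suc bs)) (hit A ++ List.map suc as) ≡
  𝟙 (isCrs t ∧ (A ∧ B)) + countᵇ (λ j → isCrsIn r j ∧ any (j ≡ᵇ_) bs) as
countᵇ-hit t r A B as bs = trans (countᵇ-++ p (hit A) (List.map suc as)) (cong₂ _+_ (first A)
  (trans (countᵇ-map p suc as) (countᵇ-cong as (λ j → cong (isCrsIn r j ∧_) (any-hit-suc j B bs)))))
  where
  p : ℕ → Bool
  p j = isCrsIn (t ∷ r) j ∧ any (j ≡ᵇ_) (hit B ++ List.map suc bs)
  first : ∀ A → countᵇ p (hit A) ≡ 𝟙 (isCrs t ∧ (A ∧ B))
  first true rewrite any-hit-zero B bs = +-identityʳ _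
  first false rewrite ∧-zeroʳ (isCrs t) = refl

crossing : ℕ → ℕ → Stat
crossing a b _ t h s = 𝟙 (isCrs t ∧ (meets a h s ∧ meets b h s))

meets-both : ∀ {a b h s} → a ≢ b → h ≢ s →
  𝟙 (meets a h s ∧ meets b h s) ≡ inverted a b h s + inverted a b s h
meets-both {a} {b} {h} {s} a≢b h≢s with h ≟ a | s ≟ b
... | yes refl | yes refl rewrite ≡ᵇ-refl h | ≡ᵇ-refl s | ≢⇒≡ᵇ a≢b = refl
... | yes refl | no s≢b rewrite ≡ᵇ-refl h | ≢⇒≡ᵇ a≢b | ≢⇒≡ᵇ s≢b = refl
... | no h≢a | yes refl rewrite ≡ᵇ-refl s | ≢⇒≡ᵇ h≢a | ≢⇒≡ᵇ (a≢b ∘ sym) | *-zeroʳ (δ h s) = refl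
... | no h≢a | no s≢b rewrite ≢⇒≡ᵇ h≢a | ≢⇒≡ᵇ s≢b with h ≡ᵇ b | s ≡ᵇ a
...   | true | true = refl
...   | true | false = refl
...   | false | true = refl
...   | false | false = refl

inverted-<⇒zero : ∀ {a b x y} → a < b → lt y x ≡ 0 → inverted a b x y ≡ 0
inverted-<⇒zero {a} {b} {x} {y} a<b eq with x ≟ b | y ≟ a
... | no x≢b | _ = cong (_* δ y a) (δ-≢ x≢b)
... | yes _ | no y≢a = trans (cong (δ x b *_) (δ-≢ y≢a)) (*-zeroʳ (δ x b))
... | yes refl | yes refl with trans (sym (lt-< a<b)) eq
...   | ()

module _ {M : ℕ} where

  -- In an `𝖾` row `columns` looks at the East label, while a statistic sees the West one. At a
  -- cross both are the same pipe, and elsewhere the crossing statistic is 0.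
  crossing-turn : ∀ a b {T t w s e u} → TileLabels M T t w s e u → crossing a b T t e s ≡ crossing a b T t w s
  crossing-turn a b blank = refl
  crossing-turn a b (hor _) = refl
  crossing-turn a b (ver _) = refl
  crossing-turn a b (crs _ _ _) = refl
  crossing-turn a b (elWN _) = refl
  crossing-turn a b (elSE _) = refl
  crossing-turn a b (dbW _ _) = refl
  crossing-turn a b (elEN _) = refl
  crossing-turn a b (elSW _) = refl
  crossing-turn a b (dbE _ _) = refl

  columns-crossing : ∀ {T n w e} {r : Vec Tile n} {v u} a b (rl : RowLabels M T w r v u e) →
    countᵇ (λ j → isCrsIn r j ∧ any (j ≡ᵇ_) (columns b rl)) (columns a rl) ≡ rowSum (crossing a b) rl
  columns-crossing a b [] = refl
  columns-crossing {𝗐} a b (_∷_ {t = t} {w} {s} {r = r} tl rl) =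
    trans (countᵇ-hit t r (meets a w s) (meets b w s) (columns a rl) (columns b rl))
      (cong (crossing a b 𝗐 t w s +_) (columns-crossing a b rl))
  columns-crossing {𝖾} a b (_∷_ {t = t} {w} {s} {e} {r = r} tl rl) = begin
    countᵇ (λ j → isCrsIn (t ∷ r) j ∧ any (j ≡ᵇ_) (bs ++ hit B)) (as ++ hit A)
      ≡⟨ countᵇ-cong (as ++ hit A) (λ j → cong (isCrsIn (t ∷ r) j ∧_) (any-comm (j ≡ᵇ_) bs (hit B))) ⟩
    countᵇ (λ j → isCrsIn (t ∷ r) j ∧ any (j ≡ᵇ_) (hit B ++ bs)) (as ++ hit A)
      ≡⟨ countᵇ-comm _ as (hit A) ⟩
    countᵇ (λ j → isCrsIn (t ∷ r) j ∧ any (j ≡ᵇ_) (hit B ++ bs)) (hit A ++ as)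
      ≡⟨ countᵇ-hit t r A B (columns a rl) (columns b rl) ⟩
    crossing a b 𝖾 t e s + _
      ≡⟨ cong₂ _+_ (crossing-turn a b tl) (columns-crossing a b rl) ⟩
    crossing a b 𝖾 t w s + rowSum (crossing a b) rl ∎
    where
    open ≡-Reasoning
    A = meets a e s
    B = meets b e s
    as = List.map suc (columns a rl)
    bs = List.map suc (columns b rl)

  path-crossing : ∀ {m n β ps u} {D : PD m n} a b (ld : Labelling M β ps D u) →
    countᵇ (λ q → isCrsAt D q ∧ memPos q (path b ld)) (path a ld) ≡ sumL (crossing a b) ld
  path-crossing a b [] = refl
  path-crossing a b (_◂_ {r = r} {D = D} rl ld) = begin
    countᵇ p (List.map down (path a ld) ++ List.map topRow (columns a rl))
      ≡⟨ countᵇ-comm p (List.map down (path a ld)) _ ⟩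
    countᵇ p (List.map topRow (columns a rl) ++ List.map down (path a ld))
      ≡⟨ countᵇ-++ p (List.map topRow (columns a rl)) _ ⟩
    countᵇ p (List.map topRow (columns a rl)) + countᵇ p (List.map down (path a ld))
      ≡⟨ cong₂ _+_ (trans (countᵇ-map p topRow (columns a rl)) (countᵇ-cong (columns a rl) (λ j → cong (isCrsIn r j ∧_) (memTop j))))
                   (trans (countᵇ-map p down (path a ld)) (countᵇ-cong (path a ld) (λ q → cong (isCrsAt D q ∧_) (memBelow q)))) ⟩
    countᵇ (λ j → isCrsIn r j ∧ any (j ≡ᵇ_) (columns b rl)) (columns a rl) + countᵇ (λ q → isCrsAt D q ∧ memPos q (path b ld)) (path a ld)
      ≡⟨ cong₂ _+_ (columns-crossing a b rl) (path-crossing a b ld) ⟩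
    rowSum (crossing a b) rl + sumL (crossing a b) ld ∎
    where
    open ≡-Reasoning
    p : ℕ × ℕ → Bool
    p q = isCrsAt (r ∷ D) q ∧ memPos q (List.map down (path b ld) ++ List.map topRow (columns b rl))
    memTop : ∀ j → memPos (topRow j) (List.map down (path b ld) ++ List.map topRow (columns b rl)) ≡ any (j ≡ᵇ_) (columns b rl)
    memTop j = trans (any-++ _ (List.map down (path b ld)) _)
      (trans (cong₂ _∨_ (trans (any-map _ down (path b ld)) (any-false (path b ld) (λ _ → refl))) refl)
        (any-map _ topRow (columns b rl)))
    memBelow : ∀ q → memPos (down q) (List.map down (path b ld) ++ List.map topRow (columns b rl)) ≡ memPos q (path b ld)
    memBelow q = trans (any-comm _ (List.map down (path b ld)) _) (trans (any-++ _ (List.map topRow (columns b rl)) _)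
      (trans (cong₂ _∨_ (trans (any-map _ topRow (columns b rl)) (any-false (columns b rl) (λ _ → refl))) refl)
        (any-map _ down (path b ld))))

  inverted-M : ∀ {a b} x → a < M → b < M → inverted a b M x ≡ 0 × inverted a b x M ≡ 0
  inverted-M {a} {b} x a<M b<M =
    cong (_* δ x a) (label≢M {M} b<M) , trans (cong (δ x b *_) (label≢M {M} a<M)) (*-zeroʳ (δ x b))

  -- A crossing of `a` and `b` reverses their order in the word, so it either undoes or creates
  -- their inversion. At `hor` and `ver` one label is `M`, which is neither `a` nor `b`.
  crossing-tile : ∀ {a b T t w s e u} → a < M → b < M → a ≢ b → TileLabels M T t w s e u →
    crossing a b T t w s ≡ lost (inverted a b) T t w s + gained (inverted a b) T t w s
  crossing-tile {T = 𝗐} a<M b<M a≢b blank = refl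
  crossing-tile {T = 𝖾} a<M b<M a≢b blank = refl
  crossing-tile {T = 𝗐} a<M b<M a≢b (hor {a = x} _) =
    let p , q = inverted-M x a<M b<M in sym (cong₂ _+_ q p)
  crossing-tile {T = 𝖾} a<M b<M a≢b (hor {a = x} _) =
    let p , q = inverted-M x a<M b<M in sym (cong₂ _+_ p q)
  crossing-tile {T = 𝗐} a<M b<M a≢b (ver {b = x} _) =
    let p , q = inverted-M x a<M b<M in sym (cong₂ _+_ p q)
  crossing-tile {T = 𝖾} a<M b<M a≢b (ver {b = x} _) =
    let p , q = inverted-M x a<M b<M in sym (cong₂ _+_ q p)
  crossing-tile {T = 𝗐} a<M b<M a≢b (crs _ _ h≢s) = meets-both a≢b h≢s
  crossing-tile {a} {b} {T = 𝖾} a<M b<M a≢b (crs {a = h} {s} _ _ h≢s) =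
    trans (meets-both a≢b h≢s) (+-comm (inverted a b h s) _)
  crossing-tile a<M b<M a≢b (elWN _) = refl
  crossing-tile a<M b<M a≢b (elSE _) = refl
  crossing-tile a<M b<M a≢b (dbW _ _) = refl
  crossing-tile a<M b<M a≢b (elEN _) = refl
  crossing-tile a<M b<M a≢b (elSW _) = refl
  crossing-tile a<M b<M a≢b (dbE _ _) = refl

  crossing-row : ∀ {a b T n w e} {r : Vec Tile n} {v u} → a < M → b < M → a ≢ b → (rl : RowLabels M T w r v u e) →
    rowSum (crossing a b) rl ≡ rowSum (lost (inverted a b)) rl + rowSum (gained (inverted a b)) rl
  crossing-row a<M b<M a≢b [] = refl
  crossing-row {a} {b} {T} a<M b<M a≢b (_∷_ {t = t} {w} {s} tl rl) =
    trans (cong₂ _+_ (crossing-tile a<M b<M a≢b tl) (crossing-row a<M b<M a≢b rl))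
      (+-interchange (lost (inverted a b) T t w s) _ _ _)

  crossing-total : ∀ {a b m n β ps u} {D : PD m n} → a < M → b < M → a ≢ b → (ld : Labelling M β ps D u) →
    sumL (crossing a b) ld ≡ sumL (lost (inverted a b)) ld + sumL (gained (inverted a b)) ld
  crossing-total a<M b<M a≢b [] = refl
  crossing-total {a} {b} a<M b<M a≢b (rl ◂ ld) =
    trans (cong₂ _+_ (crossing-row a<M b<M a≢b rl) (crossing-total a<M b<M a≢b ld))
      (+-interchange (rowSum (lost (inverted a b)) rl) _ _ _)

  pipeOfRow-path : ∀ {m n β ps u} {D : PD m (suc n)} → Sorted M β ps → (ld : Labelling M β ps D u) → ∀ i →
    ∃ λ c → pipeOfRow β D (toℕ i) ≡ (path (lookup ps i) ld , just c) × nth u c ≡ just (lookup ps i)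
  pipeOfRow-path {m} {n} {β} {ps} so ld i
    with rowType β (toℕ i) | rowType-lookup β i | path-run so ld i
  ... | 𝗐 | eq | c , run , eq′ rewrite sym eq =
        c , Run⇒walk run _ (m≤n⇒m≤1+n (length-path (lookup ps i) ld)) , eq′
  ... | 𝖾 | eq | c , run , eq′ rewrite sym eq =
        c , Run⇒walk run _ (m≤n⇒m≤1+n (length-path (lookup ps i) ld)) , eq′

  crossings-label : ∀ {m n β ps u} {D : PD m (suc n)} → Sorted M β ps → (ld : Labelling M β ps D u) → ∀ i₁ i₂ →
    crossings β D (toℕ i₁) (toℕ i₂) ≡ sumL (crossing (lookup ps i₁) (lookup ps i₂)) ld
  crossings-label {β = β} {ps} {D = D} so ld i₁ i₂ with pipeOfRow-path so ld i₁ | pipeOfRow-path so ld i₂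
  ... | _ , eq₁ , _ | _ , eq₂ , _ rewrite eq₁ | eq₂ =
    trans (length-filterᵇ _ (path (lookup ps i₁) ld)) (path-crossing (lookup ps i₁) (lookup ps i₂) ld)

  lost-tile-zero : ∀ {a b T t w s e u} → a < b → b < M → TileLabels M T t w s e u →
    excess T t w s ≡ 0 → lost (inverted a b) T t w s ≡ 0
  lost-tile-zero {T = 𝗐} a<b b<M blank _ = refl
  lost-tile-zero {T = 𝖾} a<b b<M blank _ = refl
  lost-tile-zero {T = 𝗐} a<b b<M (hor {a = x} _) _ = proj₂ (inverted-M x (<-trans a<b b<M) b<M)
  lost-tile-zero {T = 𝖾} a<b b<M (hor {a = x} _) _ = proj₁ (inverted-M x (<-trans a<b b<M) b<M)
  lost-tile-zero {T = 𝗐} a<b b<M (ver {b = x} _) _ = proj₁ (inverted-M x (<-trans a<b b<M) b<M)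
  lost-tile-zero {T = 𝖾} a<b b<M (ver {b = x} _) _ = proj₂ (inverted-M x (<-trans a<b b<M) b<M)
  lost-tile-zero {T = 𝗐} a<b b<M (crs {a = h} {s} _ _ _) eq = inverted-<⇒zero {x = h} {s} a<b (m+n≡0⇒m≡0 (lt s h) eq)
  lost-tile-zero {T = 𝖾} a<b b<M (crs {a = h} {s} _ _ _) eq = inverted-<⇒zero {x = s} {h} a<b (m+n≡0⇒m≡0 (lt h s) eq)
  lost-tile-zero a<b b<M (elWN _) _ = refl
  lost-tile-zero a<b b<M (elSE _) _ = refl
  lost-tile-zero a<b b<M (dbW _ _) _ = refl
  lost-tile-zero a<b b<M (elEN _) _ = refl
  lost-tile-zero a<b b<M (elSW _) _ = refl
  lost-tile-zero a<b b<M (dbE _ _) ()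

  lost-zero : ∀ {a b m n β ps u} {D : PD m n} → a < b → b < M → (ld : Labelling M β ps D u) →
    sumL (excess) ld ≡ 0 → sumL (lost (inverted a b)) ld ≡ 0
  lost-zero a<b b<M ld eq = sumL-zero _ ld (λ _ _ tl le →
    lost-tile-zero a<b b<M tl (n≤0⇒n≡0 (≤-trans (le excess) (≤-reflexive eq))))

  labels-unique : ∀ {a m n β ps u} {D : PD m n} → Sorted M β ps → a < M → Labelling M β ps D u → count a u ≤ 1
  labels-unique {a} so a<M ld = ≤-trans (≤-reflexive (sumV-labels _ (label≢M {M} a<M) ld)) (Sorted-unique so a)

  crossing-comm : ∀ {m n β ps u} {D : PD m n} a b (ld : Labelling M β ps D u) →
    sumL (crossing a b) ld ≡ sumL (crossing b a) ld
  crossing-comm a b [] = refl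
  crossing-comm a b (rl ◂ ld) = cong₂ _+_ (row rl) (crossing-comm a b ld)
    where
    row : ∀ {T n w e} {r : Vec Tile n} {v u} (rl : RowLabels M T w r v u e) → rowSum (crossing a b) rl ≡ rowSum (crossing b a) rl
    row [] = refl
    row (_∷_ {t = t} {w} {s} _ rl) = cong₂ _+_ (cong (λ x → 𝟙 (isCrs t ∧ x)) (∧-comm (meets a w s) _)) (row rl)

  -- Without excess no inversion is ever undone, so every crossing of the two pipes creates one.
  -- Their number is then the number of inversions of the pair in the final word, where each label
  -- occurs at most once.
  crossing≤1 : ∀ {a b m n β ps u} {D : PD m n} → Sorted M β ps → a < b → b < M → (ld : Labelling M β ps D u) →
    sumL (excess) ld ≡ 0 → sumL (crossing a b) ld ≤ 1
  crossing≤1 {a} {b} {u = u} so a<b b<M ld eq = begin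
    sumL (crossing a b) ld        ≡⟨ crossing-total (<-trans a<b b<M) b<M (<⇒≢ a<b) ld ⟩
    sumL (lost f) ld + sumL (gained f) ld   ≡⟨ cong₂ _+_ (lost-zero a<b b<M ld eq) (sym (inverted+lost≡gained so a<b b<M ld)) ⟩
    inv f u + sumL (lost f) ld    ≡⟨ cong (inv f u +_) (lost-zero a<b b<M ld eq) ⟩
    inv f u + 0                   ≡⟨ +-identityʳ _ ⟩
    inv f u                       ≤⟨ inv-inverted≤1 a b u (labels-unique so (<-trans a<b b<M) ld) (labels-unique so b<M ld) ⟩
    1                             ∎
    where
    open ≤-Reasoning
    f = inverted a b

  -- What is undone must also have been created: the final count is nonnegative, so `gained` is at
  -- least `lost`, and the crossings number at least twice `lost`.
  lost⇒crossing≥2 : ∀ {a b m n β ps u} {D : PD m n} → Sorted M β ps → a < b → b < M → (ld : Labelling M β ps D u) →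
    1 ≤ sumL (lost (inverted a b)) ld → 2 ≤ sumL (crossing a b) ld
  lost⇒crossing≥2 {a} {b} {u = u} so a<b b<M ld le = begin
    1 + 1                                             ≤⟨ +-mono-≤ le le ⟩
    sumL (lost f) ld + sumL (lost f) ld               ≤⟨ +-monoʳ-≤ (sumL (lost f) ld) (m≤n+m _ (inv f u)) ⟩
    sumL (lost f) ld + (inv f u + sumL (lost f) ld)   ≡⟨ cong (sumL (lost f) ld +_) (inverted+lost≡gained so a<b b<M ld) ⟩
    sumL (lost f) ld + sumL (gained f) ld             ≡⟨ sym (crossing-total (<-trans a<b b<M) b<M (<⇒≢ a<b) ld) ⟩
    sumL (crossing a b) ld                            ∎
    where
    open ≤-Reasoning
    f = inverted a b

  tile-condition : ∀ {τ t w s e u} → TileLabels M τ t w s e u → excess τ t w s ≡ 0 →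
    T (if isW τ then not (isVer t) else not (isDouble t))
  tile-condition {𝗐} blank _ = tt
  tile-condition {𝖾} blank _ = tt
  tile-condition {𝗐} (hor _) _ = tt
  tile-condition {𝖾} (hor _) _ = tt
  tile-condition {𝗐} (ver b<M) eq with trans (sym (lt-< b<M)) (m+n≡0⇒m≡0 _ eq)
  ... | ()
  tile-condition {𝖾} (ver _) _ = tt
  tile-condition {𝗐} (crs _ _ _) _ = tt
  tile-condition {𝖾} (crs _ _ _) _ = tt
  tile-condition (elWN _) _ = tt
  tile-condition (elSE _) _ = tt
  tile-condition (dbW _ _) _ = tt
  tile-condition (elEN _) _ = tt
  tile-condition (elSW _) _ = tt
  tile-condition (dbE _ _) ()

  excess≡0⇒conditions : ∀ {m n β ps u} {D : PD m (suc n)} → Sorted M β ps → (ld : Labelling M β ps D u) →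
    sumL (excess) ld ≡ 0 → T (nongenericConditions β D)
  excess≡0⇒conditions {m} {n} {β} {ps} {D = D} so ld eq = ∧⁺
    (allℕ⁺ (λ i i<m → allℕ⁺ (λ j j<n → tiles i i<m j j<n)))
    (allℕ⁺ (λ i₁ p₁ → allℕ⁺ (λ i₂ p₂ → pairs i₁ p₁ i₂ p₂)))
    where
    tiles : ∀ i → i < m → ∀ j → j < suc n →
      T (maybe (λ t → if isW (rowType β i) then not (isVer t) else not (isDouble t)) false (tileAt D i j))
    tiles i i<m j j<n
      with τ , eqτ ← <⇒nth β i<m
      with t , eqt ← <⇒tileAt D i<m j<n
      with w , s , e , u , tl , le ← sumL-tile ld {i} {j} eqτ eqt
      rewrite eqτ | eqt = tile-condition tl (n≤0⇒n≡0 (≤-trans (le excess) (≤-reflexive eq)))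
    pairs : ∀ i₁ → i₁ < m → ∀ i₂ → i₂ < m → T ((i₁ ≡ᵇ i₂) ∨ (crossings β D i₁ i₂ <ᵇ 2))
    pairs i₁ p₁ i₂ p₂ with i₁ ≟ i₂
    ... | yes refl rewrite ≡ᵇ-refl i₁ = tt
    ... | no i₁≢i₂ = Equivalence.from T-∨ (inj₂ (<⇒<ᵇ (s≤s bound)))
      where
      k₁ = fromℕ< p₁
      k₂ = fromℕ< p₂
      labels : sumL (crossing (lookup ps k₁) (lookup ps k₂)) ld ≤ 1
      labels with <-cmp (lookup ps k₁) (lookup ps k₂)
      ... | tri< lt _ _ = crossing≤1 so lt (bounded so k₂) ld eq
      ... | tri> _ _ lt = ≤-trans (≤-reflexive (crossing-comm (lookup ps k₁) _ ld)) (crossing≤1 so lt (bounded so k₁) ld eq)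
      ... | tri≈ _ same _ with <-cmp i₁ i₂
      ...   | tri< lt _ _ = ⊥-elim (Precedes⇒≢ {M} {lookup β k₁} (ordered so (subst₂ _<_ (sym (Fin.toℕ-fromℕ< p₁)) (sym (Fin.toℕ-fromℕ< p₂)) lt)) same)
      ...   | tri≈ _ e _ = ⊥-elim (i₁≢i₂ e)
      ...   | tri> _ _ lt = ⊥-elim (Precedes⇒≢ {M} {lookup β k₂} (ordered so (subst₂ _<_ (sym (Fin.toℕ-fromℕ< p₂)) (sym (Fin.toℕ-fromℕ< p₁)) lt)) (sym same))
      bound : crossings β D i₁ i₂ ≤ 1
      bound = subst₂ (λ x y → crossings β D x y ≤ 1) (Fin.toℕ-fromℕ< p₁) (Fin.toℕ-fromℕ< p₂)
        (≤-trans (≤-reflexive (crossings-label so ld k₁ k₂)) labels)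

  -- Excess is charged to the labels at a tile, whereas the conditions speak of pairs of rows;
  -- `onto` provides the rows in which the pipes with these labels enter.
  conditions⇒excess≡0 : ∀ {m n β ps u} {D : PD m (suc n)} → Sorted M β ps →
    (∀ a → a < M → ∃ λ i → lookup ps i ≡ a) → (ld : Labelling M β ps D u) →
    T (nongenericConditions β D) → sumL (excess) ld ≡ 0
  conditions⇒excess≡0 {m} {n} {β} {ps} {D = D} so onto ld conds = sumL-zero excess ld tile
    where
    tileOK : ℕ → ℕ → Bool
    tileOK i j = maybe (λ t → if isW (rowType β i) then not (isVer t) else not (isDouble t)) false (tileAt D i j)
    pairOK : ℕ → ℕ → Bool
    pairOK i₁ i₂ = (i₁ ≡ᵇ i₂) ∨ (crossings β D i₁ i₂ <ᵇ 2)
    both : T (allℕ m (λ i → allℕ (suc n) (tileOK i))) × T (allℕ m (λ i₁ → allℕ m (pairOK i₁)))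
    both = ∧⁻ conds
    tiles : ∀ i → i < m → ∀ j → j < suc n → T (tileOK i j)
    tiles i p = allℕ⁻ {suc n} {tileOK i} (allℕ⁻ {m} {λ i → allℕ (suc n) (tileOK i)} (proj₁ both) i p)
    pairs : ∀ i → i < m → ∀ j → j < m → T (pairOK i j)
    pairs i p = allℕ⁻ {m} {pairOK i} (allℕ⁻ {m} {λ i → allℕ m (pairOK i)} (proj₂ both) i p)
    below : ∀ {a b} → a < b → b < M → ¬ 1 ≤ sumL (lost (inverted a b)) ld
    below a<b b<M le with i , refl ← onto _ (<-trans a<b b<M) | k , refl ← onto _ b<M
      with Equivalence.to (T-∨ {toℕ i ≡ᵇ toℕ k}) (pairs (toℕ i) (Fin.toℕ<n i) (toℕ k) (Fin.toℕ<n k))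
    ... | inj₁ same = <⇒≢ a<b (cong (lookup ps) (Fin.toℕ-injective (≡ᵇ⇒≡ _ _ same)))
    ... | inj₂ few = <⇒≱ (<ᵇ⇒< _ 2 few)
          (≤-trans (lost⇒crossing≥2 so a<b b<M ld le) (≤-reflexive (sym (crossings-label so ld i k))))
    condition : ∀ {i j τ t} → nth β i ≡ just τ → tileAt D i j ≡ just t →
      T (if isW τ then not (isVer t) else not (isDouble t))
    condition {i} {j} eqτ eqt
      with i<m , j<n ← tileAt⇒< {D = D} i j eqt
      with c ← tiles i i<m j j<n
      rewrite eqτ | eqt = c
    tile : ∀ {i j τ t w s e u} → nth β i ≡ just τ → tileAt D i j ≡ just t → TileLabels M τ t w s e u →
      (∀ F → F τ t w s ≤ sumL F ld) → excess τ t w s ≡ 0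
    tile {τ = 𝗐} _ _ blank _ = refl
    tile {τ = 𝖾} _ _ blank _ = refl
    tile {τ = 𝗐} _ _ (hor a<M) _ = cong₂ _+_ (lt-≥ (<⇒≤ a<M)) (lt-≥ (<⇒≤ a<M))
    tile {τ = 𝖾} _ _ (hor _) _ = refl
    tile {τ = 𝗐} eqτ eqt (ver _) _ = ⊥-elim (condition eqτ eqt)
    tile {τ = 𝖾} _ _ (ver _) _ = refl
    tile {τ = 𝗐} _ _ (crs {a = h} {s} h<M s<M h≢s) le with <-cmp h s
    ... | tri< h<s _ _ = cong₂ _+_ (lt-≥ (<⇒≤ h<s)) (lt-≥ (<⇒≤ h<s))
    ... | tri≈ _ h≡s _ = ⊥-elim (h≢s h≡s)
    -- The tile at hand undoes the inversion of `s` and `h`; this makes the corresponding `lost`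
    -- total positive and so forces two crossings.
    ... | tri> _ _ s<h = ⊥-elim (below s<h h<M (≤-trans (≤-reflexive (sym (cong₂ _*_ (δ-refl h) (δ-refl s)))) (le (lost (inverted s h)))))
    tile {τ = 𝖾} _ _ (crs {a = h} {s} h<M s<M h≢s) le with <-cmp h s
    ... | tri> _ _ s<h = cong₂ _+_ (lt-≥ (<⇒≤ s<h)) (lt-≥ (<⇒≤ s<h))
    ... | tri≈ _ h≡s _ = ⊥-elim (h≢s h≡s)
    ... | tri< h<s _ _ = ⊥-elim (below h<s s<M (≤-trans (≤-reflexive (sym (cong₂ _*_ (δ-refl s) (δ-refl h)))) (le (lost (inverted h s)))))
    tile _ _ (elWN _) _ = refl
    tile _ _ (elSE _) _ = refl
    tile _ _ (dbW _ _) _ = refl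
    tile _ _ (elEN _) _ = refl
    tile _ _ (elSW _) _ = refl
    tile eqτ eqt (dbE _ _) _ = ⊥-elim (condition eqτ eqt)

-- Validity of a filling

useIn : ∀ {n} → Vec Tile n → ℕ → Side → Bool
useIn r j s = maybe (λ t → uses t s) false (nth r j)

record IndexOK {m n} (β : Vec RowType m) (D : PD m n) : Set where
  field
    allowedAt : ∀ i j → i < m → j < n → T (maybe (allowed (rowType β i)) false (tileAt D i j))
    horizontal : ∀ i j → i < m → suc j < n → usesAt D i j E ≡ usesAt D i (suc j) W
    vertical : ∀ i j → suc i < m → j < n → usesAt D i j S ≡ usesAt D (suc i) j N
    westEdge : ∀ i → i < m → usesAt D i 0 W ≡ isW (rowType β i)
    eastEdge : ∀ i → i < m → usesAt D i (n ∸ 1) E ≡ not (isW (rowType β i))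
    southEdge : ∀ j → j < n → usesAt D (m ∸ 1) j S ≡ false
open IndexOK

if-<ᵇ⁻ : ∀ {x y b} → T (if x <ᵇ y then b else true) → x < y → T b
if-<ᵇ⁻ h lt rewrite <⇒<ᵇ≡ lt = h

if-<ᵇ⁺ : ∀ x y {b} → (x < y → T b) → T (if x <ᵇ y then b else true)
if-<ᵇ⁺ x y h with x <? y
... | yes lt rewrite <⇒<ᵇ≡ lt = h lt
... | no ≮ rewrite ≥⇒<ᵇ≡ (≮⇒≥ ≮) = tt

module _ {m n} (β : Vec RowType m) (D : PD m n) where
  private
    matchE matchS cellOK : ℕ → ℕ → Bool
    matchE i j = if suc j <ᵇ n then eqBool (usesAt D i j E) (usesAt D i (suc j) W) else true
    matchS i j = if suc i <ᵇ m then eqBool (usesAt D i j S) (usesAt D (suc i) j N) else true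
    cellOK i j = maybe (allowed (rowType β i)) false (tileAt D i j) ∧ matchE i j ∧ matchS i j
    edgeOK southOK : ℕ → Bool
    edgeOK i = eqBool (usesAt D i 0 W) (isW (rowType β i)) ∧ eqBool (usesAt D i (n ∸ 1) E) (not (isW (rowType β i)))
    southOK j = not (usesAt D (m ∸ 1) j S)

  valid⇒IndexOK : T (valid β D) → IndexOK β D
  valid⇒IndexOK v = record
    { allowedAt = λ i j p q → proj₁ (split i j p q)
    ; horizontal = λ i j p q → eqBool⁻ (if-<ᵇ⁻ (proj₁ (proj₂ (split i j p (<-trans (n<1+n j) q)))) q)
    ; vertical = λ i j p q → eqBool⁻ (if-<ᵇ⁻ (proj₂ (proj₂ (split i j (<-trans (n<1+n i) p) q))) p)
    ; westEdge = λ i p → eqBool⁻ (proj₁ (edges i p))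
    ; eastEdge = λ i p → eqBool⁻ (proj₂ (edges i p))
    ; southEdge = λ j q → Equivalence.to T-not-≡ (allℕ⁻ {n} {southOK} (proj₂ rest) j q)
    }
    where
    parts : T (allℕ m (λ i → allℕ n (cellOK i))) × T (allℕ m edgeOK ∧ allℕ n southOK)
    parts = ∧⁻ v
    rest : T (allℕ m edgeOK) × T (allℕ n southOK)
    rest = ∧⁻ (proj₂ parts)
    edges : ∀ i → i < m → T (eqBool (usesAt D i 0 W) (isW (rowType β i))) × T (eqBool (usesAt D i (n ∸ 1) E) (not (isW (rowType β i))))
    edges i p = ∧⁻ (allℕ⁻ {m} {edgeOK} (proj₁ rest) i p)
    split : ∀ i j → i < m → j < n →
      T (maybe (allowed (rowType β i)) false (tileAt D i j)) × T (matchE i j) × T (matchS i j)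
    split i j p q =
      let cell = allℕ⁻ {n} {cellOK i} (allℕ⁻ {m} {λ i → allℕ n (cellOK i)} (proj₁ parts) i p) j q
          a , bc = ∧⁻ {maybe (allowed (rowType β i)) false (tileAt D i j)} cell
      in a , ∧⁻ {matchE i j} bc

  IndexOK⇒valid : IndexOK β D → T (valid β D)
  IndexOK⇒valid ok = ∧⁺ {allℕ m (λ i → allℕ n (cellOK i))}
    (allℕ⁺ {m} {λ i → allℕ n (cellOK i)} (λ i p → allℕ⁺ {n} {cellOK i} (λ j q →
      ∧⁺ {maybe (allowed (rowType β i)) false (tileAt D i j)} (allowedAt ok i j p q)
        (∧⁺ {matchE i j} (if-<ᵇ⁺ (suc j) n (λ q′ → eqBool⁺ (horizontal ok i j p q′)))
                         (if-<ᵇ⁺ (suc i) m (λ p′ → eqBool⁺ (vertical ok i j p′ q)))))))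
    (∧⁺ {allℕ m edgeOK}
      (allℕ⁺ {m} {edgeOK} (λ i p → ∧⁺ (eqBool⁺ (westEdge ok i p)) (eqBool⁺ (eastEdge ok i p))))
      (allℕ⁺ {n} {southOK} (λ j q → Equivalence.from T-not-≡ (southEdge ok j q))))

RowOK : ∀ {n} → RowType → Bool → Vec Tile n → Bool → Set
RowOK τ b [] e = b ≡ e
RowOK τ b (t ∷ r) e = T (allowed τ t) × uses t W ≡ b × RowOK τ (uses t E) r e

useVec : ∀ {n} → Side → Vec Tile n → Vec Bool n
useVec s = Vec.map (λ t → uses t s)

-- While `valid` compares adjacent tiles by index, here the vector `pat` of occupied North edges
-- links each row to the one above, which suits induction on rows.
GridOK : ∀ {m n} → Vec RowType m → PD m n → Vec Bool n → Set
GridOK [] [] pat = pat ≡ Vec.replicate _ false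
GridOK (τ ∷ β) (r ∷ D) pat = RowOK τ (isW τ) r (not (isW τ)) × useVec N r ≡ pat × GridOK β D (useVec S r)

rowOK : ∀ {n} τ {b e} (r : Vec Tile (suc n)) → (∀ j → j < suc n → T (maybe (allowed τ) false (nth r j))) →
  (∀ j → suc j < suc n → useIn r j E ≡ useIn r (suc j) W) → useIn r 0 W ≡ b → useIn r n E ≡ e → RowOK τ b r e
rowOK τ (t ∷ []) al hz w e = al 0 z<s , w , e
rowOK τ (t ∷ r@(_ ∷ _)) al hz w e =
  al 0 z<s , w , rowOK τ r (λ j p → al (suc j) (s<s p)) (λ j p → hz (suc j) (s<s p)) (sym (hz 0 (s<s z<s))) e

RowOK-allowed : ∀ {n} τ {b e} (r : Vec Tile n) → RowOK τ b r e → ∀ j → j < n → T (maybe (allowed τ) false (nth r j))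
RowOK-allowed τ (t ∷ r) (al , _ , ok) zero _ = al
RowOK-allowed τ (t ∷ r) (al , _ , ok) (suc j) (s≤s p) = RowOK-allowed τ r ok j p

RowOK-horizontal : ∀ {n} τ {b e} (r : Vec Tile n) → RowOK τ b r e → ∀ j → suc j < n → useIn r j E ≡ useIn r (suc j) W
RowOK-horizontal τ (t ∷ t′ ∷ r) (_ , _ , _ , eq , _) zero _ = sym eq
RowOK-horizontal τ (t ∷ r) (_ , _ , ok) (suc j) (s≤s p) = RowOK-horizontal τ r ok j p

RowOK-west : ∀ {n} τ {b e} (r : Vec Tile (suc n)) → RowOK τ b r e → useIn r 0 W ≡ b
RowOK-west τ (t ∷ r) (_ , eq , _) = eq

RowOK-east : ∀ {n} τ {b e} (r : Vec Tile (suc n)) → RowOK τ b r e → useIn r n E ≡ e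
RowOK-east τ (t ∷ []) (_ , _ , eq) = eq
RowOK-east τ (t ∷ r@(_ ∷ _)) (_ , _ , ok) = RowOK-east τ r ok

useVec-≡ : ∀ {n s s′} (r r′ : Vec Tile n) → (∀ j → j < n → useIn r j s ≡ useIn r′ j s′) → useVec s r ≡ useVec s′ r′
useVec-≡ [] [] h = refl
useVec-≡ (t ∷ r) (t′ ∷ r′) h = cong₂ _∷_ (h 0 z<s) (useVec-≡ r r′ (λ j p → h (suc j) (s<s p)))

useVec-false : ∀ {n s} (r : Vec Tile n) → (∀ j → j < n → useIn r j s ≡ false) → useVec s r ≡ Vec.replicate n false
useVec-false [] h = refl
useVec-false (t ∷ r) h = cong₂ _∷_ (h 0 z<s) (useVec-false r (λ j p → h (suc j) (s<s p)))

useVec⁻ : ∀ {n s s′} (r r′ : Vec Tile n) → useVec s r ≡ useVec s′ r′ → ∀ j → j < n → useIn r j s ≡ useIn r′ j s′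
useVec⁻ (t ∷ r) (t′ ∷ r′) eq zero _ = Vec.∷-injectiveˡ eq
useVec⁻ (t ∷ r) (t′ ∷ r′) eq (suc j) (s≤s p) = useVec⁻ r r′ (Vec.∷-injectiveʳ eq) j p

useVec-false⁻ : ∀ {n s} (r : Vec Tile n) → useVec s r ≡ Vec.replicate n false → ∀ j → j < n → useIn r j s ≡ false
useVec-false⁻ (t ∷ r) eq zero _ = Vec.∷-injectiveˡ eq
useVec-false⁻ (t ∷ r) eq (suc j) (s≤s p) = useVec-false⁻ r (Vec.∷-injectiveʳ eq) j p

IndexOK⇒GridOK : ∀ {m n} {β : Vec RowType (suc m)} {D : PD (suc m) (suc n)} → IndexOK β D → GridOK β D (useVec N (Vec.head D))
IndexOK⇒GridOK {β = τ ∷ []} {r ∷ []} ok =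
  rowOK τ r (λ j → allowedAt ok 0 j z<s) (λ j → horizontal ok 0 j z<s) (westEdge ok 0 z<s) (eastEdge ok 0 z<s) ,
  refl , useVec-false r (southEdge ok)
IndexOK⇒GridOK {β = τ ∷ β@(_ ∷ _)} {r ∷ D@(r′ ∷ _)} ok =
  rowOK τ r (λ j → allowedAt ok 0 j z<s) (λ j → horizontal ok 0 j z<s) (westEdge ok 0 z<s) (eastEdge ok 0 z<s) ,
  refl , subst (GridOK β D) (sym (useVec-≡ r r′ (λ j → vertical ok 0 j (s<s z<s)))) (IndexOK⇒GridOK below)
  where
  below : IndexOK β D
  below = record
    { allowedAt = λ i j p → allowedAt ok (suc i) j (s<s p)
    ; horizontal = λ i j p → horizontal ok (suc i) j (s<s p)
    ; vertical = λ i j p → vertical ok (suc i) j (s<s p)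
    ; westEdge = λ i p → westEdge ok (suc i) (s<s p)
    ; eastEdge = λ i p → eastEdge ok (suc i) (s<s p)
    ; southEdge = southEdge ok }

GridOK⇒IndexOK : ∀ {m n} (β : Vec RowType (suc m)) (D : PD (suc m) (suc n)) {pat} → GridOK β D pat → IndexOK β D
GridOK⇒IndexOK (τ ∷ []) (r ∷ []) (row , _ , south) = record
  { allowedAt = λ { zero j _ → RowOK-allowed τ r row j ; (suc i) j (s≤s ()) }
  ; horizontal = λ { zero j _ → RowOK-horizontal τ r row j ; (suc i) j (s≤s ()) }
  ; vertical = λ { i j (s≤s ()) }
  ; westEdge = λ { zero _ → RowOK-west τ r row ; (suc i) (s≤s ()) }
  ; eastEdge = λ { zero _ → RowOK-east τ r row ; (suc i) (s≤s ()) }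
  ; southEdge = useVec-false⁻ r south }
GridOK⇒IndexOK (τ ∷ β@(_ ∷ _)) (r ∷ D@(r′ ∷ _)) (row , _ , grid@(_ , eq , _)) = record
  { allowedAt = λ { zero j _ → RowOK-allowed τ r row j ; (suc i) j (s≤s p) → allowedAt ok i j p }
  ; horizontal = λ { zero j _ → RowOK-horizontal τ r row j ; (suc i) j (s≤s p) → horizontal ok i j p }
  ; vertical = λ { zero j _ → useVec⁻ r r′ (sym eq) j ; (suc i) j (s≤s p) → vertical ok i j p }
  ; westEdge = λ { zero _ → RowOK-west τ r row ; (suc i) (s≤s p) → westEdge ok i p }
  ; eastEdge = λ { zero _ → RowOK-east τ r row ; (suc i) (s≤s p) → eastEdge ok i p }
  ; southEdge = southEdge ok }
  where ok = GridOK⇒IndexOK β D grid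

-- Labelled tilings against valid fillings

module _ {M : ℕ} where

  present : ℕ → Bool
  present x = x <ᵇ M

  present-M : present M ≡ false
  present-M = ≥⇒<ᵇ≡ (≤-refl {M})

  tile-uses : ∀ {τ t w s e u} → TileLabels M τ t w s e u →
    T (allowed τ t) × uses t W ≡ present w × uses t S ≡ present s × uses t E ≡ present e × uses t N ≡ present u
  tile-uses {𝗐} blank rewrite present-M = tt , refl , refl , refl , refl
  tile-uses {𝖾} blank rewrite present-M = tt , refl , refl , refl , refl
  tile-uses {𝗐} (hor a) rewrite present-M | <⇒<ᵇ≡ a = tt , refl , refl , refl , refl
  tile-uses {𝖾} (hor a) rewrite present-M | <⇒<ᵇ≡ a = tt , refl , refl , refl , refl
  tile-uses {𝗐} (ver a) rewrite present-M | <⇒<ᵇ≡ a = tt , refl , refl , refl , refl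
  tile-uses {𝖾} (ver a) rewrite present-M | <⇒<ᵇ≡ a = tt , refl , refl , refl , refl
  tile-uses {𝗐} (crs a b _) rewrite <⇒<ᵇ≡ a | <⇒<ᵇ≡ b = tt , refl , refl , refl , refl
  tile-uses {𝖾} (crs a b _) rewrite <⇒<ᵇ≡ a | <⇒<ᵇ≡ b = tt , refl , refl , refl , refl
  tile-uses (elWN a) rewrite present-M | <⇒<ᵇ≡ a = tt , refl , refl , refl , refl
  tile-uses (elSE a) rewrite present-M | <⇒<ᵇ≡ a = tt , refl , refl , refl , refl
  tile-uses (dbW a b) rewrite <⇒<ᵇ≡ a | <⇒<ᵇ≡ b = tt , refl , refl , refl , refl
  tile-uses (elEN a) rewrite present-M | <⇒<ᵇ≡ a = tt , refl , refl , refl , refl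
  tile-uses (elSW a) rewrite present-M | <⇒<ᵇ≡ a = tt , refl , refl , refl , refl
  tile-uses (dbE a b) rewrite <⇒<ᵇ≡ a | <⇒<ᵇ≡ b = tt , refl , refl , refl , refl

  row-uses : ∀ {τ n w e} {r : Vec Tile n} {v u} → RowLabels M τ w r v u e →
    RowOK τ (present w) r (present e) × useVec S r ≡ Vec.map present v × useVec N r ≡ Vec.map present u
  row-uses [] = refl , refl , refl
  row-uses (tl ∷ rl) with al , w , s , e , n ← tile-uses tl | ok , ss , ns ← row-uses rl rewrite sym e =
    (al , w , ok) , cong₂ _∷_ s ss , cong₂ _∷_ n ns

  Labelling⇒GridOK : ∀ {m n β ps u} {D : PD m n} → Sorted M β ps → Labelling M β ps D u → GridOK β D (Vec.map present u)
  Labelling⇒GridOK so ([] {n}) = trans (Vec.map-replicate present M n) (cong (Vec.replicate n) present-M)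
  Labelling⇒GridOK {D = r ∷ D} so (_◂_ {T = 𝗐} {β = β} rl ld) with ok , ss , ns ← row-uses rl
    rewrite <⇒<ᵇ≡ (bounded so zero) | present-M = ok , ns , subst (GridOK β D) (sym ss) (Labelling⇒GridOK (Sorted-tail so) ld)
  Labelling⇒GridOK {D = r ∷ D} so (_◂_ {T = 𝖾} {β = β} rl ld) with ok , ss , ns ← row-uses rl
    rewrite <⇒<ᵇ≡ (bounded so zero) | present-M = ok , ns , subst (GridOK β D) (sym ss) (Labelling⇒GridOK (Sorted-tail so) ld)

  Label : Bool → ℕ → Set
  Label true x = x < M
  Label false x = x ≡ M

  LabelVec : ∀ {n} → Vec Bool n → Vec ℕ n → Set
  LabelVec [] [] = ⊤
  LabelVec (b ∷ bs) (x ∷ xs) = Label b x × LabelVec bs xs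

  LabelVec-replicate : ∀ n → LabelVec (Vec.replicate n false) (Vec.replicate n M)
  LabelVec-replicate zero = tt
  LabelVec-replicate (suc n) = refl , LabelVec-replicate n

  label-tileW : ∀ t {w s} → T (allowed 𝗐 t) → Label (uses t W) w → Label (uses t S) s → (w < M → w ≢ s) →
    ∃₂ λ e u → TileLabels M 𝗐 t w s e u × Label (uses t E) e × Label (uses t N) u
  label-tileW blank _ refl refl _ = _ , _ , blank , refl , refl
  label-tileW hor _ w refl _ = _ , _ , hor w , w , refl
  label-tileW ver _ refl s _ = _ , _ , ver s , refl , s
  label-tileW crs _ w s ne = _ , _ , crs w s (ne w) , w , s
  label-tileW elWN _ w refl _ = _ , _ , elWN w , refl , w
  label-tileW elSE _ refl s _ = _ , _ , elSE s , s , refl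
  label-tileW dbW _ w s _ = _ , _ , dbW w s , s , w

  label-tileE : ∀ t {e s} → T (allowed 𝖾 t) → Label (uses t E) e → Label (uses t S) s → (e < M → e ≢ s) →
    ∃₂ λ w u → TileLabels M 𝖾 t w s e u × Label (uses t W) w × Label (uses t N) u
  label-tileE blank _ refl refl _ = _ , _ , blank , refl , refl
  label-tileE hor _ e refl _ = _ , _ , hor e , e , refl
  label-tileE ver _ refl s _ = _ , _ , ver s , refl , s
  label-tileE crs _ e s ne = _ , _ , crs e s (ne e) , e , s
  label-tileE elEN _ e refl _ = _ , _ , elEN e , refl , e
  label-tileE elSW _ refl s _ = _ , _ , elSW s , s , refl
  label-tileE dbE _ e s _ = _ , _ , dbE e s , s , e

  two-copies : ∀ {a k} → ¬ δ a a + (δ a a + k) ≤ 1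
  two-copies {a} rewrite δ-refl a = λ { (s≤s ()) }

  distinct-east : ∀ {n t w s e u} {v : Vec ℕ n} → TileLabels M 𝗐 t w s e u →
    (∀ a → a < M → δ w a + (δ s a + count a v) ≤ 1) → ∀ a → a < M → δ e a + count a v ≤ 1
  distinct-east {w = w} {s} tl distinct a a<M with turnW tl
  ... | inj₁ (_ , refl , _) = ≤-trans (+-monoʳ-≤ (δ w a) (m≤n+m _ (δ s a))) (distinct a a<M)
  ... | inj₂ (_ , refl , _) = ≤-trans (m≤n+m _ (δ w a)) (distinct a a<M)

  -- By conservation of labels, `w` is one of the letters of `v p`; equal to `s`, it would occur
  -- twice among `s`, `v` and `p`. So no pipe crosses itself, as the distinct labels of `crs`
  -- demand.
  label-apart : ∀ {n w s p} {r : Vec Tile n} {v us} → RowLabels M 𝖾 w r v us p →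
    (∀ a → a < M → δ s a + count a v + δ p a ≤ 1) → w < M → w ≢ s
  label-apart {s = s} {p} {v = v} rl distinct w<M refl = two-copies {s} (≤-trans (≤-reflexive (begin
    δ s s + (δ s s + _)           ≡⟨ cong (δ s s +_) (sym (row-permE (λ x → δ x s) rl)) ⟩
    δ s s + (count s v + δ p s)   ≡⟨ sym (+-assoc (δ s s) _ _) ⟩
    δ s s + count s v + δ p s     ∎)) (distinct s w<M))
    where open ≡-Reasoning

  label-rowW : ∀ {n b w} (r : Vec Tile n) {v} → RowOK 𝗐 b r false → Label b w → LabelVec (useVec S r) v →
    (∀ a → a < M → δ w a + count a v ≤ 1) → ∃ λ u → RowLabels M 𝗐 w r v u M × LabelVec (useVec N r) u
  label-rowW [] {[]} refl refl _ _ = [] , [] , tt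
  label-rowW {w = w} (t ∷ r) {s ∷ v} (al , refl , ok) lw (ls , lv) distinct
    with e , u , tl , le , ln ← label-tileW t al lw ls (λ { w<M refl → two-copies {w} (distinct w w<M) })
    with us , rl , lns ← label-rowW r ok le lv (distinct-east {v = v} tl distinct) = u ∷ us , tl ∷ rl , ln , lns

  label-rowE : ∀ {n b p} (r : Vec Tile n) {v} → p < M → RowOK 𝖾 b r true → LabelVec (useVec S r) v →
    (∀ a → a < M → count a v + δ p a ≤ 1) → ∃₂ λ w u → RowLabels M 𝖾 w r v u p × Label b w × LabelVec (useVec N r) u
  label-rowE [] {[]} p<M refl _ _ = _ , [] , [] , p<M , tt
  label-rowE {p = p} (t ∷ r) {s ∷ v} p<M (al , refl , ok) (ls , lv) distinct
    with w′ , us , rl , lw , lns ← label-rowE r p<M ok lv (λ a a<M →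
           ≤-trans (m≤n+m _ (δ s a)) (≤-trans (≤-reflexive (sym (+-assoc (δ s a) _ _))) (distinct a a<M)))
    with w , u , tl , lw′ , ln ← label-tileE t al lw ls (label-apart rl distinct) = w , u ∷ us , tl ∷ rl , lw′ , ln , lns

  -- The tiles of a valid filling propagate labels deterministically: from the bottom row upward,
  -- eastward in `𝗐` rows and westward in `𝖾` rows, starting at the boundary edges where the pipes
  -- enter.
  label-grid : ∀ {m n ps pat} (β : Vec RowType m) (D : PD m n) → Sorted M β ps → GridOK β D pat →
    ∃ λ u → Labelling M β ps D u × LabelVec pat u
  label-grid {n = n} {[]} [] [] so refl = _ , [] , LabelVec-replicate n
  label-grid {ps = p ∷ ps} (𝗐 ∷ β) (r ∷ D) so (ok , refl , grid)
    with v , ld , lv ← label-grid β D (Sorted-tail so) grid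
    with u , rl , lu ← label-rowW r ok (bounded so zero) lv (λ a a<M →
           ≤-trans (≤-reflexive (cong (δ p a +_) (sumV-labels _ (label≢M {M} a<M) ld))) (Sorted-unique so a)) =
    u , rl ◂ ld , lu
  label-grid {ps = p ∷ ps} (𝖾 ∷ β) (r ∷ D) so (ok , refl , grid)
    with v , ld , lv ← label-grid β D (Sorted-tail so) grid
    -- The West edge of the row is unoccupied, so the label that arrives there is `M`; this is the
    -- match on `refl`.
    with w , u , rl , refl , lu ← label-rowE r (bounded so zero) ok lv (λ a a<M →
           ≤-trans (≤-reflexive (trans (cong (_+ δ p a) (sumV-labels _ (label≢M {M} a<M) ld)) (+-comm _ (δ p a)))) (Sorted-unique so a)) =
    u , rl ◂ ld , lu

-- Pipe numbers and connectivity

∑-prefix-< : ∀ {i k} f → i < k → 1 ≤ f i → ∑ i f < ∑ k f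
∑-prefix-< {zero} {suc k} f _ le = ≤-trans le (m≤m+n _ _)
∑-prefix-< {suc i} {suc k} f (s≤s p) le = +-monoʳ-< (f 0) (∑-prefix-< (f ∘ suc) p le)

∑-mono-< : ∀ n {f g : ℕ → ℕ} k → k < n → f k < g k → (∀ i → i < n → f i ≤ g i) → ∑ n f < ∑ n g
∑-mono-< (suc n) zero _ lt h = +-mono-<-≤ lt (∑-mono n (λ i p → h (suc i) (s<s p)))
∑-mono-< (suc n) (suc k) (s≤s p) lt h = +-mono-≤-< (h 0 z<s) (∑-mono-< n k p lt (λ i q → h (suc i) (s<s q)))

𝟙≤1 : ∀ b → 𝟙 b ≤ 1
𝟙≤1 true = ≤-refl
𝟙≤1 false = z≤n

module _ {m} (β : Vec RowType m) where
  private
    westRow : ℕ → ℕ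
    westRow i = 𝟙 (isW (rowType β i))
    eastBelow : ℕ → ℕ → ℕ
    eastBelow i k = 𝟙 ((i <ᵇ k) ∧ not (isW (rowType β k)))

  -- For an `𝖾` row, each row adds at most 1 to the two counts together and row `i` itself adds
  -- nothing, whence the strict bound.
  φ-bounded : ∀ i → i < m → φ β i < m
  φ-bounded i i<m with rowType β i in eq
  ... | 𝗐 rewrite length-filter-upTo (λ k → isW (rowType β k)) i =
        ≤-<-trans (≤-trans (∑-mono i (λ k _ → 𝟙≤1 _)) (≤-reflexive (trans (∑-const i 1) (*-identityʳ i)))) i<m
  ... | 𝖾 rewrite length-filter-upTo (λ k → isW (rowType β k)) m
                | length-filter-upTo (λ k → (i <ᵇ k) ∧ not (isW (rowType β k))) m = begin-strict
        ∑ m westRow + ∑ m (eastBelow i)         ≡⟨ sym (∑-+ m westRow (eastBelow i)) ⟩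
        ∑ m (λ k → westRow k + eastBelow i k)   <⟨ ∑-mono-< m i i<m improves (λ k _ → bound k) ⟩
        ∑ m (λ _ → 1)                        ≡⟨ trans (∑-const m 1) (*-identityʳ m) ⟩
        m                                    ∎
        where
        open ≤-Reasoning
        bound : ∀ k → westRow k + eastBelow i k ≤ 1
        bound k with isW (rowType β k)
        ... | true rewrite ∧-zeroʳ (i <ᵇ k) = ≤-refl
        ... | false = 𝟙≤1 _
        improves : westRow i + eastBelow i i < 1
        improves rewrite eq | ≥⇒<ᵇ≡ (≤-refl {i}) = ≤-refl

  φ-ordered : ∀ i j → i < j → j < m → Precedes (rowType β i) (φ β i) (φ β j)
  φ-ordered i j i<j j<m with rowType β i in eqi | rowType β j in eqj
  ... | 𝗐 | 𝗐 rewrite length-filter-upTo (λ k → isW (rowType β k)) i | length-filter-upTo (λ k → isW (rowType β k)) j =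
        ∑-prefix-< westRow i<j (≤-reflexive (sym (cong (𝟙 ∘ isW) eqi)))
  ... | 𝗐 | 𝖾 rewrite length-filter-upTo (λ k → isW (rowType β k)) i | length-filter-upTo (λ k → isW (rowType β k)) m =
        <-≤-trans (∑-prefix-< westRow (<-trans i<j j<m) (≤-reflexive (sym (cong (𝟙 ∘ isW) eqi)))) (m≤m+n _ _)
  ... | 𝖾 | 𝗐 rewrite length-filter-upTo (λ k → isW (rowType β k)) j | length-filter-upTo (λ k → isW (rowType β k)) m =
        <-≤-trans (∑-prefix-< westRow j<m (≤-reflexive (sym (cong (𝟙 ∘ isW) eqj)))) (m≤m+n _ _)
  ... | 𝖾 | 𝖾 rewrite length-filter-upTo (λ k → (i <ᵇ k) ∧ not (isW (rowType β k))) m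
                     | length-filter-upTo (λ k → (j <ᵇ k) ∧ not (isW (rowType β k))) m =
        +-monoʳ-< (countℕ m (λ k → isW (rowType β k))) (∑-mono-< m j j<m improves (λ k _ → 𝟙-mono (further k)))
        where
        improves : eastBelow j j < eastBelow i j
        improves rewrite eqj | ≥⇒<ᵇ≡ (≤-refl {j}) | <⇒<ᵇ≡ i<j = ≤-refl
        further : ∀ k → T ((j <ᵇ k) ∧ not (isW (rowType β k))) → T ((i <ᵇ k) ∧ not (isW (rowType β k)))
        further k h with p , q ← ∧⁻ {j <ᵇ k} h = ∧⁺ (<⇒<ᵇ (<-trans i<j (<ᵇ⇒< j k p))) q

  φs : Vec ℕ m
  φs = Vec.tabulate (φ β ∘ toℕ)

  φs-lookup : ∀ i → lookup φs i ≡ φ β (toℕ i)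
  φs-lookup = Vec.lookup∘tabulate (φ β ∘ toℕ)

  φ-sorted : Sorted m β φs
  φ-sorted .bounded i rewrite φs-lookup i = φ-bounded (toℕ i) (Fin.toℕ<n i)
  φ-sorted .ordered {i} {j} i<j rewrite φs-lookup i | φs-lookup j | sym (rowType-lookup β i) =
    φ-ordered (toℕ i) (toℕ j) i<j (Fin.toℕ<n j)

∑-count : ∀ {n} M (v : Vec ℕ n) → (∀ i → lookup v i < M) → ∑ M (λ a → count a v) ≡ n
∑-count M [] h = ∑-zero M (λ _ _ → refl)
∑-count {suc n} M (x ∷ v) h = trans (∑-+ M (δ x) (λ a → count a v)) (cong₂ _+_ one (∑-count M v (h ∘ suc)))
  where
  one : ∑ M (δ x) ≡ 1
  one = trans (∑-cong M (λ c _ → sym (*-identityʳ (δ x c)))) (∑-δ (λ _ → 1) (h zero))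

count⇒lookup : ∀ {n a} (v : Vec ℕ n) → 1 ≤ count a v → ∃ λ i → lookup v i ≡ a
count⇒lookup {a = a} (x ∷ v) le with x ≟ a
... | yes eq = zero , eq
... | no x≢a rewrite δ-≢ x≢a = let i , eq = count⇒lookup v le in suc i , eq

-- A pigeonhole argument: the counts of the m labels are at most 1 and add up to m.
Sorted-onto : ∀ {m} {β : Vec RowType m} {ps} → Sorted m β ps → ∀ a → a < m → ∃ λ i → lookup ps i ≡ a
Sorted-onto {m} {ps = ps} so a a<m with count a ps in eq
... | suc _ = count⇒lookup ps (≤-trans (s≤s z≤n) (≤-reflexive (sym eq)))
... | zero = ⊥-elim (<-irrefl refl (begin-strict
  m                          ≡⟨ sym (∑-count m ps (bounded so)) ⟩
  ∑ m (λ a → count a ps)     <⟨ ∑-mono-< m a a<m (≤-reflexive (cong suc eq)) (λ b _ → Sorted-unique {m} so b) ⟩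
  ∑ m (λ _ → 1)              ≡⟨ trans (∑-const m 1) (*-identityʳ m) ⟩
  m                          ∎))
  where open ≤-Reasoning

nth≤sumV : ∀ {n} g (v : Vec ℕ n) j {x} → nth v j ≡ just x → g x ≤ sumV g v
nth≤sumV g (x ∷ v) zero refl = m≤m+n _ _
nth≤sumV g (x ∷ v) (suc j) eq = m≤n⇒m≤o+n (g x) (nth≤sumV g v j eq)

nth-unique : ∀ {n a} (v : Vec ℕ n) → count a v ≤ 1 → ∀ i j → nth v i ≡ just a → nth v j ≡ just a → i ≡ j
nth-unique (x ∷ v) le zero zero _ _ = refl
nth-unique {a = a} (x ∷ v) le zero (suc j) refl eq rewrite δ-refl a =
  ⊥-elim (<⇒≱ (count-nth v j eq) (s≤s⁻¹ le))
nth-unique {a = a} (x ∷ v) le (suc i) zero eq refl rewrite δ-refl a =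
  ⊥-elim (<⇒≱ (count-nth v i eq) (s≤s⁻¹ le))
nth-unique {a = a} (x ∷ v) le (suc i) (suc j) p q = cong suc (nth-unique v (≤-trans (m≤n+m _ (δ x a)) le) i j p q)

-- By `only` and `atMost` a column outside the image of `π` carries `m`. The word is thus the
-- inverse of π̂ with all values from `m` on replaced by `m`.
record Word {m n} (π : Fin m → Fin n) (u : Vec ℕ n) : Set where
  field
    at : ∀ k → k < m → nth u (πℕ π k) ≡ just k
    only : ∀ c a → nth u c ≡ just a → a < m → c ≡ πℕ π a
    atMost : ∀ c a → nth u c ≡ just a → a ≤ m
open Word

πℕ-toℕ : ∀ {m n} (π : Fin m → Fin n) k → πℕ π (toℕ k) ≡ toℕ (π k)
πℕ-toℕ {m} π k with toℕ k <? m
... | yes p = cong (toℕ ∘ π) (Fin.fromℕ<-toℕ k p)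
... | no ¬p = ⊥-elim (¬p (Fin.toℕ<n k))

πℕ-fromℕ< : ∀ {m n} (π : Fin m → Fin n) {k} (p : k < m) → πℕ π k ≡ toℕ (π (fromℕ< p))
πℕ-fromℕ< π p = trans (cong (πℕ π) (sym (Fin.toℕ-fromℕ< p))) (πℕ-toℕ π (fromℕ< p))

module _ {m n} {π : Fin m → Fin (suc n)} {β : Vec RowType m} {ps} (so : Sorted m β ps)
         (φ≡ : ∀ i → lookup ps i ≡ φ β (toℕ i)) {D : PD m (suc n)} {u} (ld : Labelling m β ps D u) where

  connected⇒Word : T (hasConnectivity β π D) → Word π u
  connected⇒Word conn = record
    { at = λ k k<m → let i , eq = Sorted-onto so k k<m in
        subst (λ a → nth u (πℕ π a) ≡ just a) eq (row i)
    ; only = λ c a eq a<m → let i , eq′ = Sorted-onto so a a<m in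
        nth-unique u (labels-unique so a<m ld) c _ eq (subst (λ a → nth u (πℕ π a) ≡ just a) eq′ (row i))
    -- A letter above `m` would be counted by `lt m`, which vanishes at `m` and at every pipe
    -- number.
    ; atMost = λ c a eq → ≮⇒≥ (λ m<a → 1≢0 (trans (sym (lt-< m<a)) (n≤0⇒n≡0
        (≤-trans (nth≤sumV (lt m) u c eq) (≤-reflexive (sumV-labels-zero (lt m) (lt-irrefl m) ld (λ i → lt-≥ (<⇒≤ (bounded so i)))))))))
    }
    where
    1≢0 : 1 ≢ 0
    1≢0 ()
    row : ∀ i → nth u (πℕ π (lookup ps i)) ≡ just (lookup ps i)
    row i with c , eq , eq′ ← pipeOfRow-path so ld i
      with h ← allℕ⁻ {m} {λ i → eqMaybeℕ (proj₂ (pipeOfRow β D i)) (just (πℕ π (φ β i)))} conn (toℕ i) (Fin.toℕ<n i)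
      rewrite eq | sym (φ≡ i) with c ≟ πℕ π (lookup ps i)
    ... | yes refl = eq′

  Word⇒connected : Word π u → T (hasConnectivity β π D)
  Word⇒connected word = allℕ⁺ {m} {λ i → eqMaybeℕ (proj₂ (pipeOfRow β D i)) (just (πℕ π (φ β i)))}
    (λ i i<m → subst (λ i → T (eqMaybeℕ (proj₂ (pipeOfRow β D i)) (just (πℕ π (φ β i))))) (Fin.toℕ-fromℕ< i<m) (row (fromℕ< i<m)))
    where
    row : ∀ i → T (eqMaybeℕ (proj₂ (pipeOfRow β D (toℕ i))) (just (πℕ π (φ β (toℕ i)))))
    row i with c , eq , eq′ ← pipeOfRow-path so ld i
      rewrite eq | sym (φ≡ i) | only word c (lookup ps i) eq′ (bounded so i)
      with πℕ π (lookup ps i) ≟ πℕ π (lookup ps i)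
    ... | yes _ = tt
    ... | no ne = ⊥-elim (ne refl)

label : ∀ {m n} → (Fin m → Fin n) → Fin n → ℕ
label {m} π c with Fin.any? (λ k → π k Fin.≟ c)
... | yes (k , _) = toℕ k
... | no _ = m

label-image : ∀ {m n} {π : Fin m → Fin n} → Injective _≡_ _≡_ π → ∀ k → label π (π k) ≡ toℕ k
label-image {π = π} inj k with Fin.any? (λ k′ → π k′ Fin.≟ π k)
... | yes (k′ , eq) = cong toℕ (inj eq)
... | no none = ⊥-elim (none (k , refl))

label-cases : ∀ {m n} (π : Fin m → Fin n) c → (∃ λ k → π k ≡ c × label π c ≡ toℕ k) ⊎ label π c ≡ m
label-cases π c with Fin.any? (λ k → π k Fin.≟ c)
... | yes (k , eq) = inj₁ (k , eq , refl)
... | no _ = inj₂ refl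

nth-fin : ∀ {n} (v : Vec ℕ n) c {a} → nth v c ≡ just a → ∃ λ i → toℕ i ≡ c × lookup v i ≡ a
nth-fin (x ∷ v) zero refl = zero , refl , refl
nth-fin (x ∷ v) (suc c) eq = let i , p , q = nth-fin v c eq in suc i , cong suc p , q

wordOf : ∀ {m n} → (Fin m → Fin n) → Vec ℕ n
wordOf π = Vec.tabulate (label π)

wordOf-Word : ∀ {m n} {π : Fin m → Fin n} → Injective _≡_ _≡_ π → Word π (wordOf π)
wordOf-Word {m} {π = π} inj = record
  { at = λ k k<m → trans (cong (nth (wordOf π)) (πℕ-fromℕ< π k<m))
      (trans (nth-lookup (wordOf π) (π (fromℕ< k<m)))
        (cong just (trans (Vec.lookup∘tabulate (label π) _) (trans (label-image inj _) (Fin.toℕ-fromℕ< k<m)))))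
  ; only = onlyAt
  ; atMost = bound }
  where
  onlyAt : ∀ c a → nth (wordOf π) c ≡ just a → a < m → c ≡ πℕ π a
  onlyAt c a eq a<m with i , refl , eq′ ← nth-fin (wordOf π) c eq
    with label-cases π i | trans (sym (Vec.lookup∘tabulate (label π) i)) eq′
  ... | inj₁ (k , refl , q) | l rewrite trans (sym l) q = sym (πℕ-toℕ π k)
  ... | inj₂ q | l = ⊥-elim (<⇒≢ a<m (trans (sym l) q))
  bound : ∀ c a → nth (wordOf π) c ≡ just a → a ≤ m
  bound c a eq with i , refl , eq′ ← nth-fin (wordOf π) c eq
    with label-cases π i | trans (sym (Vec.lookup∘tabulate (label π) i)) eq′
  ... | inj₁ (k , _ , q) | l rewrite trans (sym l) q = <⇒≤ (Fin.toℕ<n k)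
  ... | inj₂ q | l = ≤-reflexive (trans (sym l) q)

-- The length of the completed permutation

𝟙-∧ : ∀ a b → 𝟙 (a ∧ b) ≡ 𝟙 a * 𝟙 b
𝟙-∧ true b = sym (+-identityʳ _)
𝟙-∧ false b = refl

any-applyUpTo⁺ : ∀ (p : ℕ → Bool) f n i → i < n → p (f i) ≡ true → any p (List.applyUpTo f n) ≡ true
any-applyUpTo⁺ p f (suc n) zero _ eq rewrite eq = refl
any-applyUpTo⁺ p f (suc n) (suc i) (s≤s lt) eq
  rewrite any-applyUpTo⁺ p (f ∘ suc) n i lt eq = ∨-zeroʳ (p (f 0))

any-applyUpTo-false : ∀ (p : ℕ → Bool) f n → (∀ i → i < n → p (f i) ≡ false) → any p (List.applyUpTo f n) ≡ false
any-applyUpTo-false p f zero h = refl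
any-applyUpTo-false p f (suc n) h rewrite h 0 z<s = any-applyUpTo-false p (f ∘ suc) n (λ i lt → h (suc i) (s<s lt))

countᵇ-filterᵇ : ∀ {A : Set} (p q : A → Bool) xs → countᵇ q (filterᵇ p xs) ≡ countᵇ (λ x → p x ∧ q x) xs
countᵇ-filterᵇ p q [] = refl
countᵇ-filterᵇ p q (x ∷ xs) with p x
... | true = cong (𝟙 (q x) +_) (countᵇ-filterᵇ p q xs)
... | false = countᵇ-filterᵇ p q xs

countᵇ-nthL : ∀ (q : ℕ → Bool) xs → ∑ (length xs) (λ j → 𝟙 (q (nthL xs j))) ≡ countᵇ q xs
countᵇ-nthL q [] = refl
countᵇ-nthL q (x ∷ xs) = cong (𝟙 (q x) +_) (countᵇ-nthL q xs)

nthL-All : ∀ {P : ℕ → Set} {xs} → All P xs → ∀ j → j < length xs → P (nthL xs j)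
nthL-All (p ∷ _) zero _ = p
nthL-All (_ ∷ ps) (suc j) (s≤s lt) = nthL-All ps j lt

nthL-increasing : ∀ {xs} → AllPairs _<_ xs → ∀ i j → i < j → j < length xs → nthL xs i < nthL xs j
nthL-increasing (p ∷ _) zero (suc j) _ (s≤s lt) = nthL-All p j lt
nthL-increasing (_ ∷ ps) (suc i) (suc j) (s≤s i<j) (s≤s lt) = nthL-increasing ps i j i<j lt

countᵇ-cartesianProduct : ∀ (p : ℕ × ℕ → Bool) f m ys →
  countᵇ p (List.cartesianProduct (List.applyUpTo f m) ys) ≡ ∑ m (λ i → countᵇ (λ y → p (f i , y)) ys)
countᵇ-cartesianProduct p f zero ys = refl
countᵇ-cartesianProduct p f (suc m) ys = trans (countᵇ-++ p (List.map (f 0 ,_) ys) _)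
  (cong₂ _+_ (countᵇ-map p (f 0 ,_) ys) (countᵇ-cartesianProduct p (f ∘ suc) m ys))

entry : ∀ {n} → Vec ℕ n → ℕ → ℕ
entry u c = maybe id 0 (nth u c)

nth-entry : ∀ {n} (u : Vec ℕ n) {c} → c < n → nth u c ≡ just (entry u c)
nth-entry u {c} c<n with x , eq ← <⇒nth u c<n rewrite eq = refl

entry-nth : ∀ {n} {u : Vec ℕ n} {c a} → nth u c ≡ just a → entry u c ≡ a
entry-nth eq rewrite eq = refl

sumV-entry : ∀ {n} g (v : Vec ℕ n) → sumV g v ≡ ∑ n (λ d → g (entry v d))
sumV-entry g [] = refl
sumV-entry g (x ∷ v) = cong (g x +_) (sumV-entry g v)

inv-entry : ∀ {n} f (v : Vec ℕ n) → inv f v ≡ ∑ n (λ c → ∑ n (λ d → lt c d * f (entry v c) (entry v d)))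
inv-entry f [] = refl
inv-entry {suc n} f (x ∷ v) = cong₂ _+_
  (trans (sumV-entry (f x) v) (∑-cong n (λ d _ → sym (+-identityʳ _)))) (inv-entry f v)

module _ {m n} {π : Fin m → Fin n} (inj : Injective _≡_ _≡_ π) {u : Vec ℕ n} (word : Word π u) where
  private
    val : ℕ → ℕ
    val = entry u
    p : ℕ → ℕ
    p = πℕ π

  πℕ< : ∀ k → k < m → p k < n
  πℕ< k k<m rewrite πℕ-fromℕ< π k<m = Fin.toℕ<n _

  entry-π : ∀ k → k < m → val (p k) ≡ k
  entry-π k k<m = entry-nth {u = u} {p k} (at word k k<m)

  entry-≤ : ∀ c → c < n → val c ≤ m
  entry-≤ c c<n = atMost word c _ (nth-entry u c<n)

  entry-only : ∀ c → c < n → val c < m → c ≡ p (val c)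
  entry-only c c<n = only word c _ (nth-entry u c<n)

  δ-π : ∀ c → c < n → ∀ k → k < m → δ (p k) c ≡ δ (val c) k
  δ-π c c<n k k<m with val c ≟ k
  ... | yes refl rewrite sym (entry-only c c<n k<m) = trans (δ-refl c) (sym (δ-refl (val c)))
  ... | no ne = trans (δ-≢ {p k} {c} (λ { refl → ne (entry-π k k<m) })) (sym (δ-≢ ne))

  ∑-π : ∀ c → c < n → ∀ h → ∑ m (λ k → δ (p k) c * h k) ≡ lt (val c) m * h (val c)
  ∑-π c c<n h = trans (∑-cong m (λ k k<m → cong (_* h k) (δ-π c c<n k k<m))) (collapse (val c <? m))
    where
    collapse : _ → _
    collapse (yes v<m) = trans (∑-δ h v<m) (sym (trans (cong (_* h (val c)) (lt-< v<m)) (*-identityˡ _)))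
    collapse (no v≮m) = trans (∑-zero m (λ k k<m → cong (_* h k) (δ-≢ {val c} {k} (λ { refl → v≮m k<m }))))
      (sym (cong (_* h (val c)) (lt-≥ (≮⇒≥ v≮m))))

  imageᵇ : ℕ → Bool
  imageᵇ c = any (λ i → p i ≡ᵇ c) (upTo m)

  imageᵇ-entry : ∀ c → c < n → imageᵇ c ≡ (val c <ᵇ m)
  imageᵇ-entry c c<n with val c <? m
  ... | yes v<m = trans (any-applyUpTo⁺ (λ i → p i ≡ᵇ c) id m (val c) v<m
        (T⇒≡ (≡⇒≡ᵇ _ _ (sym (entry-only c c<n v<m))))) (sym (<⇒<ᵇ≡ v<m))
  ... | no v≮m = trans (any-applyUpTo-false (λ i → p i ≡ᵇ c) id m
        (λ i i<m → ≢⇒≡ᵇ {p i} {c} (λ { refl → v≮m (subst (_< m) (sym (entry-π i i<m)) i<m) })))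
        (sym (≥⇒<ᵇ≡ (≮⇒≥ v≮m)))

  -- The right letter of an inversion is not the largest, so it is a pipe `i` in column `p i`; the
  -- left letter is a pipe `j > i` or belongs to a column outside the image. Sums over columns are
  -- re-indexed by pipes through `∑-π`.
  inv-word : inv (flip lt) u ≡ ∑ m (λ i →
    ∑ m (λ j → lt i j * lt (p j) (p i)) + ∑ n (λ c → 𝟙 (not (imageᵇ c)) * lt c (p i)))
  inv-word = begin
    inv (flip lt) u
      ≡⟨ inv-entry (flip lt) u ⟩
    ∑ n (λ c → ∑ n (λ d → lt c d * lt (val d) (val c)))
      ≡⟨ ∑-comm n n _ ⟩
    ∑ n g
      ≡⟨ ∑-cong n (λ d d<n → sym (trans (∑-π d d<n (λ _ → g d)) (occupied-only d d<n))) ⟩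
    ∑ n (λ d → ∑ m (λ i → δ (p i) d * g d))
      ≡⟨ ∑-comm n m _ ⟩
    ∑ m (λ i → ∑ n (λ d → δ (p i) d * g d))
      ≡⟨ ∑-cong m (λ i i<m → trans (∑-δ g (πℕ< i i<m)) (column i i<m)) ⟩
    _ ∎
    where
    open ≡-Reasoning
    g : ℕ → ℕ
    g d = ∑ n (λ c → lt c d * lt (val d) (val c))
    occupied-only : ∀ d → d < n → lt (val d) m * g d ≡ g d
    occupied-only d d<n with val d <? m
    ... | yes v<m rewrite lt-< v<m = *-identityˡ (g d)
    ... | no v≮m rewrite ≥⇒<ᵇ≡ (≮⇒≥ v≮m) = sym (∑-zero n (λ c c<n →
          trans (cong (lt c d *_) (lt-≥ (≤-trans (entry-≤ c c<n) (≮⇒≥ v≮m)))) (*-zeroʳ (lt c d))))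
    pointwise : ∀ i → i < m → ∀ c → c < n →
      lt i (val c) ≡ ∑ m (λ j → δ (p j) c * lt i j) + 𝟙 (not (imageᵇ c))
    pointwise i i<m c c<n rewrite imageᵇ-entry c c<n | ∑-π c c<n (lt i) with val c <? m
    ... | yes v<m rewrite <⇒<ᵇ≡ v<m = sym (trans (+-identityʳ _) (+-identityʳ _))
    ... | no v≮m rewrite ≥⇒<ᵇ≡ (≮⇒≥ v≮m) = lt-< (<-≤-trans i<m (≮⇒≥ v≮m))
    regroup : ∀ x y z → x * (y * z) ≡ y * (z * x)
    regroup = solve-∀
    pull : ∀ c x (h : ℕ → ℕ) → x * ∑ m (λ j → δ (p j) c * h j) ≡ ∑ m (λ j → δ (p j) c * (h j * x))
    pull c x h = trans (*-comm x _) (trans (sym (∑-*ʳ m _ x)) (∑-cong m (λ j _ → *-assoc (δ (p j) c) (h j) x)))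
    column : ∀ i → i < m → g (p i) ≡ ∑ m (λ j → lt i j * lt (p j) (p i)) + ∑ n (λ c → 𝟙 (not (imageᵇ c)) * lt c (p i))
    column i i<m = begin
      ∑ n (λ c → lt c (p i) * lt (val (p i)) (val c))
        ≡⟨ ∑-cong n (λ c c<n → cong (lt c (p i) *_) (trans (cong (λ x → lt x (val c)) (entry-π i i<m)) (pointwise i i<m c c<n))) ⟩
      ∑ n (λ c → lt c (p i) * (∑ m (λ j → δ (p j) c * lt i j) + 𝟙 (not (imageᵇ c))))
        ≡⟨ ∑-cong n (λ c _ → trans (*-distribˡ-+ (lt c (p i)) _ _) (cong₂ _+_ (pull c (lt c (p i)) (lt i)) (*-comm (lt c (p i)) _))) ⟩
      ∑ n (λ c → ∑ m (λ j → δ (p j) c * (lt i j * lt c (p i))) + 𝟙 (not (imageᵇ c)) * lt c (p i))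
        ≡⟨ ∑-+ n (λ c → ∑ m (λ j → δ (p j) c * (lt i j * lt c (p i)))) free ⟩
      ∑ n (λ c → ∑ m (λ j → δ (p j) c * (lt i j * lt c (p i)))) + ∑ n free
        ≡⟨ cong (_+ ∑ n free) (trans (∑-comm n m _) (∑-cong m (λ j j<m → ∑-δ (λ c → lt i j * lt c (p i)) (πℕ< j j<m)))) ⟩
      _ ∎
      where
      free : ℕ → ℕ
      free c = 𝟙 (not (imageᵇ c)) * lt c (p i)

  private
    L : List ℕ
    L = filterᵇ (λ j → not (any (λ i → πℕ π i ≡ᵇ j) (upTo m))) (upTo n)

  ∑-image : ∑ n (λ c → 𝟙 (imageᵇ c)) ≡ m
  ∑-image = begin
    ∑ n (λ c → 𝟙 (imageᵇ c))           ≡⟨ ∑-cong n (λ c c<n → trans (cong 𝟙 (imageᵇ-entry c c<n)) (sym (trans (∑-π c c<n (λ _ → 1)) (*-identityʳ _)))) ⟩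
    ∑ n (λ c → ∑ m (λ k → δ (p k) c * 1)) ≡⟨ ∑-comm n m _ ⟩
    ∑ m (λ k → ∑ n (λ c → δ (p k) c * 1)) ≡⟨ ∑-cong m (λ k k<m → ∑-δ (λ _ → 1) (πℕ< k k<m)) ⟩
    ∑ m (λ _ → 1)                      ≡⟨ trans (∑-const m 1) (*-identityʳ m) ⟩
    m ∎
    where open ≡-Reasoning

  length-L : length L + m ≡ n
  length-L = begin
    length L + m ≡⟨ cong₂ _+_ (length-filter-upTo (not ∘ imageᵇ) n) (sym ∑-image) ⟩
    ∑ n (λ c → 𝟙 (not (imageᵇ c))) + ∑ n (λ c → 𝟙 (imageᵇ c)) ≡⟨ sym (∑-+ n _ _) ⟩
    ∑ n (λ c → 𝟙 (not (imageᵇ c)) + 𝟙 (imageᵇ c)) ≡⟨ ∑-cong n (λ c _ → one (imageᵇ c)) ⟩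
    ∑ n (λ _ → 1) ≡⟨ trans (∑-const n 1) (*-identityʳ n) ⟩
    n ∎
    where
    open ≡-Reasoning
    one : ∀ b → 𝟙 (not b) + 𝟙 b ≡ 1
    one true = refl
    one false = refl

  L-increasing : AllPairs _<_ L
  L-increasing = AllPairs.filter⁺ (T? ∘ (not ∘ imageᵇ)) (AllPairs.applyUpTo⁺₁ id n (λ i<j _ → i<j))

  lengthHat-∑ : lengthHat π ≡ ∑ n (λ i → ∑ n (λ j → lt i j * lt (πhat π j) (πhat π i)))
  lengthHat-∑ = trans (length-filterᵇ q (List.cartesianProduct (upTo n) (upTo n)))
    (trans (countᵇ-cartesianProduct q id n (upTo n))
      (∑-cong n (λ i _ → trans (countᵇ-applyUpTo (λ j → q (i , j)) id n) (∑-cong n (λ j _ → 𝟙-∧ (i <ᵇ j) _)))))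
    where
    q : ℕ × ℕ → Bool
    q ij = (proj₁ ij <ᵇ proj₂ ij) ∧ (πhat π (proj₂ ij) <ᵇ πhat π (proj₁ ij))

  πhat-< : ∀ k → k < m → πhat π k ≡ p k
  πhat-< k k<m = cong (λ b → if b then p k else nthL L (k ∸ m)) (<⇒<ᵇ≡ k<m)

  πhat-+ : ∀ k → πhat π (m + k) ≡ nthL L k
  πhat-+ k = trans (cong (λ b → if b then p (m + k) else nthL L (m + k ∸ m)) (≥⇒<ᵇ≡ (m≤m+n m k)))
    (cong (nthL L) (m+n∸m≡n m k))

  -- The inversions of π̂ are split at the index `m`. Pairs of pipes and pairs of a pipe with a
  -- missing column match the two sums of `inv-word`; pairs of missing columns are not inverted,
  -- since these are listed in increasing order.
  lengthHat≡inv : lengthHat π ≡ inv (flip lt) u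
  lengthHat≡inv = trans lengthHat-∑ (trans (trans (cong outer (sym n≡)) (trans (∑-split m k _)
      (trans (cong₂ _+_ (∑-cong m row) (∑-zero k below)) (+-identityʳ _)))) (sym inv-word))
    where
    open ≡-Reasoning
    k = length L
    n≡ : m + k ≡ n
    n≡ = trans (+-comm m k) length-L
    term : ℕ → ℕ → ℕ
    term i j = lt i j * lt (πhat π j) (πhat π i)
    outer : ℕ → ℕ
    outer x = ∑ x (λ i → ∑ n (term i))
    row : ∀ i → i < m → ∑ n (term i) ≡ ∑ m (λ j → lt i j * lt (p j) (p i)) + ∑ n (λ c → 𝟙 (not (imageᵇ c)) * lt c (p i))
    row i i<m = begin
      ∑ n (term i)        ≡⟨ cong (λ x → ∑ x (term i)) (sym n≡) ⟩
      ∑ (m + k) (term i)  ≡⟨ ∑-split m k (term i) ⟩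
      ∑ m (term i) + ∑ k (λ j → term i (m + j))
        ≡⟨ cong₂ _+_ (∑-cong m (λ j j<m → cong₂ (λ x y → lt i j * lt x y) (πhat-< j j<m) (πhat-< i i<m))) tail ⟩
      _ ∎
      where
      tail : ∑ k (λ j → term i (m + j)) ≡ ∑ n (λ c → 𝟙 (not (imageᵇ c)) * lt c (p i))
      tail = begin
        ∑ k (λ j → term i (m + j))
          ≡⟨ ∑-cong k (λ j _ → trans (cong₂ _*_ (lt-< (<-≤-trans i<m (m≤m+n m j))) (cong₂ lt (πhat-+ j) (πhat-< i i<m))) (+-identityʳ _)) ⟩
        ∑ k (λ j → lt (nthL L j) (p i))      ≡⟨ countᵇ-nthL (_<ᵇ p i) L ⟩
        countᵇ (_<ᵇ p i) L                   ≡⟨ countᵇ-filterᵇ (not ∘ imageᵇ) (_<ᵇ p i) (upTo n) ⟩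
        countᵇ (λ c → not (imageᵇ c) ∧ (c <ᵇ p i)) (upTo n) ≡⟨ countᵇ-applyUpTo (λ c → not (imageᵇ c) ∧ (c <ᵇ p i)) id n ⟩
        ∑ n (λ c → 𝟙 (not (imageᵇ c) ∧ (c <ᵇ p i)))        ≡⟨ ∑-cong n (λ c _ → 𝟙-∧ (not (imageᵇ c)) _) ⟩
        _ ∎
    below : ∀ i → i < k → ∑ n (term (m + i)) ≡ 0
    below i i<k = trans (cong (λ x → ∑ x (term (m + i))) (sym n≡)) (trans (∑-split m k _) (cong₂ _+_
      (∑-zero m (λ j j<m → cong (_* lt (πhat π j) (πhat π (m + i))) (lt-≥ (≤-trans (<⇒≤ j<m) (m≤m+n m i)))))
      (∑-zero k (λ j j<k → later j j<k))))
      where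
      later : ∀ j → j < k → term (m + i) (m + j) ≡ 0
      later j j<k with i <? j
      ... | yes i<j = trans (cong (lt (m + i) (m + j) *_) (trans (cong₂ lt (πhat-+ j) (πhat-+ i))
            (lt-≥ (<⇒≤ (nthL-increasing L-increasing i j i<j j<k))))) (*-zeroʳ (lt (m + i) (m + j)))
      ... | no i≮j = cong (_* lt (πhat π (m + j)) (πhat π (m + i))) (lt-≥ (+-monoʳ-≤ m (≮⇒≥ i≮j)))

-- A nongeneric pipe dream for every connectivity

module _ {M : ℕ} where

  -- The search runs downward: `u` and the two end labels are given, the tiles and the word below
  -- are found.
  ExcessFree : ∀ {n} → RowType → ℕ → Vec ℕ n → ℕ → Set
  ExcessFree {n} τ w u e = ∃₂ λ (r : Vec Tile n) v → Σ (RowLabels M τ w r v u e) λ rl → rowSum excess rl ≡ 0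

  prepend : ∀ {n τ t w s e₁ x e} {us : Vec ℕ n} → TileLabels M τ t w s e₁ x → excess τ t w s ≡ 0 →
    ExcessFree τ e₁ us e → ExcessFree τ w (x ∷ us) e
  prepend tl eq (r , v , rl , eqs) = _ , _ , tl ∷ rl , cong₂ _+_ eq eqs

  next : ∀ {n} → Vec ℕ n → ℕ
  next [] = M
  next (x ∷ xs) with x ≟ M
  ... | yes _ = next xs
  ... | no _ = x

  next≤M : ∀ {n} (u : Vec ℕ n) → (∀ i → lookup u i ≤ M) → next u ≤ M
  next≤M [] _ = ≤-refl
  next≤M (x ∷ xs) h with x ≟ M
  ... | yes _ = next≤M xs (h ∘ suc)
  ... | no _ = h zero

  next-label : ∀ {n x} (xs : Vec ℕ n) → x < M → next (x ∷ xs) ≡ x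
  next-label {x = x} xs x<M with x ≟ M
  ... | yes refl = ⊥-elim (<-irrefl refl x<M)
  ... | no _ = refl

  -- Every pipe turns North at the column of the label it delivers, and the next pipe comes up there.
  slide : ∀ {n} (u : Vec ℕ n) → (∀ i → lookup u i ≤ M) → ExcessFree 𝗐 (next u) u M
  slide [] _ = [] , [] , [] , refl
  slide (x ∷ xs) h with x ≟ M | next xs ≟ M | slide xs (h ∘ suc)
  ... | yes refl | yes q≡M | rest rewrite q≡M = prepend blank refl rest
  ... | yes refl | no q≢M | rest = prepend (hor (≤∧≢⇒< q≤M q≢M)) (cong₂ _+_ (lt-≥ q≤M) (lt-≥ q≤M)) rest
    where q≤M = next≤M xs (h ∘ suc)
  ... | no x≢M | yes q≡M | rest rewrite q≡M = prepend (elWN (≤∧≢⇒< (h zero) x≢M)) refl rest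
  ... | no x≢M | no q≢M | rest =
    prepend (dbW (≤∧≢⇒< (h zero) x≢M) (≤∧≢⇒< (next≤M xs (h ∘ suc)) q≢M)) refl rest

  -- Since `p` is the least label, crossing other pipes on the way to its column creates inversions
  -- and undoes none, at no excess. From that column on vertical tiles would cost excess, so the
  -- remaining labels are shifted by `slide`, whose incoming label is then `p` itself.
  insertW : ∀ {n p} (u : Vec ℕ n) → p < M → (∀ i → p ≤ lookup u i × lookup u i ≤ M) → 1 ≤ count p u →
    ExcessFree 𝗐 p u M
  insertW {p = p} (x ∷ xs) p<M h le with x ≟ p | x ≟ M
  ... | yes refl | _ = subst (λ w → ExcessFree 𝗐 w (x ∷ xs) M) (next-label xs p<M) (slide (x ∷ xs) (proj₂ ∘ h))
  ... | no x≢p | yes refl rewrite δ-≢ x≢p = prepend (hor p<M) (cong₂ _+_ (lt-≥ (<⇒≤ p<M)) (lt-≥ (<⇒≤ p<M))) (insertW xs p<M (h ∘ suc) le)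
  ... | no x≢p | no x≢M rewrite δ-≢ x≢p =
    prepend (crs p<M (≤∧≢⇒< (proj₂ (h zero)) x≢M) (x≢p ∘ sym))
      (cong₂ _+_ (lt-≥ (proj₁ (h zero))) (lt-≥ (proj₁ (h zero)))) (insertW xs p<M (h ∘ suc) le)

  crossE : ∀ {n p} (u : Vec ℕ n) → p < M → (∀ i → lookup u i ≡ M ⊎ lookup u i ≤ p) → count p u ≡ 0 →
    ExcessFree 𝖾 p u p
  crossE [] _ _ _ = [] , [] , [] , refl
  crossE {p = p} (x ∷ xs) p<M h eq with h zero | crossE xs p<M (h ∘ suc) (m+n≡0⇒n≡0 (δ x p) eq)
  ... | inj₁ refl | rest = prepend (hor p<M) refl rest
  ... | inj₂ x≤p | rest = prepend (crs p<M (≤-<-trans x≤p p<M) (δ-zero⁻ {x} (m+n≡0⇒m≡0 _ eq) ∘ sym))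
        (cong₂ _+_ (lt-≥ x≤p) (lt-≥ x≤p)) rest

  -- The largest pipe `p` comes from the East, crosses smaller labels at no excess and turns North
  -- in its column. West of it the other pipes go straight up, since vertical tiles are free in an
  -- `𝖾` row, and no double elbow arises.
  insertE : ∀ {n p} (u : Vec ℕ n) → p < M → (∀ i → lookup u i ≡ M ⊎ lookup u i ≤ p) → count p u ≡ 1 →
    ExcessFree 𝖾 M u p
  insertE {p = p} (x ∷ xs) p<M h eq with x ≟ p | h zero
  ... | yes refl | _ rewrite δ-refl x = prepend (elEN p<M) refl (crossE xs p<M (h ∘ suc) (suc-injective eq))
  ... | no x≢p | inj₁ refl rewrite δ-≢ x≢p = prepend blank refl (insertE xs p<M (h ∘ suc) eq)
  ... | no x≢p | inj₂ x≤p rewrite δ-≢ x≢p = prepend (ver (≤-<-trans x≤p p<M)) refl (insertE xs p<M (h ∘ suc) eq)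

  south≤M : ∀ {τ n w e} {r : Vec Tile n} {v u} → RowLabels M τ w r v u e → ∀ i → lookup v i ≤ M
  south≤M (blank ∷ _) zero = ≤-refl
  south≤M (hor _ ∷ _) zero = ≤-refl
  south≤M (ver p ∷ _) zero = <⇒≤ p
  south≤M (crs _ p _ ∷ _) zero = <⇒≤ p
  south≤M (elWN _ ∷ _) zero = ≤-refl
  south≤M (elSE p ∷ _) zero = <⇒≤ p
  south≤M (dbW _ p ∷ _) zero = <⇒≤ p
  south≤M (elEN _ ∷ _) zero = ≤-refl
  south≤M (elSW p ∷ _) zero = <⇒≤ p
  south≤M (dbE _ p ∷ _) zero = <⇒≤ p
  south≤M (_ ∷ rl) (suc i) = south≤M rl i

  all-M : ∀ {n} (u : Vec ℕ n) → (∀ i → lookup u i ≤ M) → (∀ a → a < M → count a u ≡ 0) → u ≡ Vec.replicate n M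
  all-M [] _ _ = refl
  all-M (x ∷ xs) h none = cong₂ _∷_ x≡M (all-M xs (h ∘ suc) (λ a a<M → m+n≡0⇒n≡0 (δ x a) (none a a<M)))
    where
    x≡M : x ≡ M
    x≡M with x ≟ M
    ... | yes eq = eq
    ... | no x≢M = ⊥-elim (δ-zero⁻ {x} {x} (m+n≡0⇒m≡0 _ (none x (≤∧≢⇒< (h zero) x≢M))) refl)

  -- The hypothesis on counts says that the word holds exactly the pipes of the remaining rows. The
  -- pipe of the top row is therefore the smallest or the largest one present, as insertion
  -- requires, and conservation of labels carries the hypothesis over to the word below.
  construct : ∀ {m n} (β : Vec RowType m) {ps} (u : Vec ℕ n) → Sorted M β ps → (∀ i → lookup u i ≤ M) →
    (∀ a → a < M → count a u ≡ count a ps) →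
    ∃ λ D → Σ (Labelling M β ps D u) λ ld → sumL excess ld ≡ 0
  construct [] {[]} u so h cnt rewrite all-M u h cnt = [] , [] , refl
  construct (τ ∷ β) {p ∷ ps} u so h cnt = grid τ so
    where
    head-or-tail : ∀ i → lookup u i < M → lookup u i ≡ p ⊎ ∃ λ k → lookup ps k ≡ lookup u i
    head-or-tail i x<M with p ≟ lookup u i
    ... | yes eq = inj₁ (sym eq)
    ... | no p≢x = inj₂ (count⇒lookup ps (begin
      1                                        ≤⟨ count-nth u (toℕ i) (nth-lookup u i) ⟩
      count (lookup u i) u                     ≡⟨ cnt _ x<M ⟩
      δ p (lookup u i) + count (lookup u i) ps ≡⟨ cong (_+ count (lookup u i) ps) (δ-≢ p≢x) ⟩
      count (lookup u i) ps                    ∎))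
      where open ≤-Reasoning
    grid : ∀ τ → Sorted M (τ ∷ β) (p ∷ ps) → ∃ λ D → Σ (Labelling M (τ ∷ β) (p ∷ ps) D u) λ ld → sumL excess ld ≡ 0
    grid 𝗐 so with insertW u (bounded so zero) (λ i → least i , h i)
                     (≤-trans (≤-reflexive (sym (δ-refl p))) (≤-trans (m≤m+n _ _) (≤-reflexive (sym (cnt p (bounded so zero))))))
      where
      least : ∀ i → p ≤ lookup u i
      least i with lookup u i <? M
      ... | no ≮ = ≤-trans (<⇒≤ (bounded so zero)) (≮⇒≥ ≮)
      ... | yes x<M with head-or-tail i x<M
      ...   | inj₁ eq = ≤-reflexive (sym eq)
      ...   | inj₂ (k , eq) = ≤-trans (<⇒≤ (Sorted-head so k)) (≤-reflexive eq)
    ... | r , v , rl , eq with construct β {ps} v (Sorted-tail so) (south≤M rl) (λ a a<M → +-cancelˡ-≡ (δ p a) _ _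
            (trans (row-permW (λ x → δ x a) rl) (trans (cong (count a u +_) (label≢M {M} a<M)) (trans (+-identityʳ _) (cnt a a<M)))))
    ...   | D , ld , eq′ = r ∷ D , rl ◂ ld , cong₂ _+_ eq eq′
    grid 𝖾 so with insertE u (bounded so zero) greatest
                     (trans (cnt p (bounded so zero)) (cong₂ _+_ (δ-refl p)
                       (sumV-zero (λ x → δ x p) ps (λ k → δ-≢ (<⇒≢ (Sorted-head so k))))))
      where
      greatest : ∀ i → lookup u i ≡ M ⊎ lookup u i ≤ p
      greatest i with lookup u i <? M
      ... | no ≮ = inj₁ (≤-antisym (h i) (≮⇒≥ ≮))
      ... | yes x<M with head-or-tail i x<M
      ...   | inj₁ eq = inj₂ (≤-reflexive eq)
      ...   | inj₂ (k , eq) = inj₂ (≤-trans (≤-reflexive (sym eq)) (<⇒≤ (Sorted-head so k)))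
    ... | r , v , rl , eq with construct β {ps} v (Sorted-tail so) (south≤M rl) (λ a a<M → +-cancelˡ-≡ (δ p a) _ _
            (trans (+-comm (δ p a) _) (trans (row-permE (λ x → δ x a) rl) (trans (cong (_+ count a u) (label≢M {M} a<M)) (cnt a a<M)))))
    ...   | D , ld , eq′ = r ∷ D , rl ◂ ld , cong₂ _+_ eq eq′

lookup-Word : ∀ {m n} {π : Fin m → Fin n} {u} → Word π u → ∀ i → lookup u i ≤ m
lookup-Word {u = u} word i = atMost word (toℕ i) _ (nth-lookup u i)

count-∑ : ∀ {n} a (v : Vec ℕ n) → count a v ≡ ∑ n (λ c → δ (entry v c) a)
count-∑ a v = sumV-entry (λ x → δ x a) v

count-Word : ∀ {m n} {π : Fin m → Fin n} {u} → Injective _≡_ _≡_ π → Word π u → ∀ a → a < m → count a u ≡ 1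
count-Word {m} {n} {π} {u} inj word a a<m = trans (count-∑ a u)
  (trans (∑-cong n (λ c c<n → trans (sym (δ-π inj word c c<n a a<m)) (sym (*-identityʳ _))))
    (∑-δ (λ _ → 1) (πℕ< inj word a a<m)))

count-Sorted : ∀ {m} {β : Vec RowType m} {ps} → Sorted m β ps → ∀ a → a < m → count a ps ≡ 1
count-Sorted {m} {ps = ps} so a a<m with i , refl ← Sorted-onto so a a<m =
  ≤-antisym (Sorted-unique {m} so (lookup ps i)) (count-nth ps (toℕ i) (nth-lookup ps i))

-- Leading forms of polynomials

Term : ℕ → ℕ → Set
Term m n = ℤ × Mono m n

module _ {m n : ℕ} where

  mulT : Term m n → Term m n → Term m n
  mulT t u = proj₁ t ℤ.* proj₁ u , monoMul (proj₂ t) (proj₂ u)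

  infixl 7 _⊠_

  -- Definitionally the clause of `toPoly` for `_⊗_`.
  _⊠_ : Poly m n → Poly m n → Poly m n
  p ⊠ q = concatMap (λ t → List.map (mulT t) q) p

  record Grading : Set where
    field
      grade : Mono m n → ℕ
      grade-1 : grade mono1 ≡ 0
      grade-mul : ∀ e e′ → grade (monoMul e e′) ≡ grade e + grade e′
  open Grading

  -- Under `A + 2B` the weights `A + B`, `B - x + y` and `A + x - y` have the single top terms `B`,
  -- `B` and `A`, so top parts of products are monomials. The B-degree alone leaves `A + x - y`
  -- whole, and no nonzero coefficient is visible at once.
  gradeB gradeA+2B : Grading
  gradeB = record { grade = eB ; grade-1 = refl ; grade-mul = λ _ _ → refl }
  gradeA+2B = record
    { grade = λ e → eA e + (eB e + eB e) ; grade-1 = refl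
    ; grade-mul = λ e e′ → distribute (eA e) (eA e′) (eB e) (eB e′) }
    where
    distribute : ∀ a a′ b b′ → a + a′ + (b + b′ + (b + b′)) ≡ a + (b + b) + (a′ + (b′ + b′))
    distribute = solve-∀

  -- The list of terms is filtered without collecting like monomials. Top parts of products are
  -- then, as lists, the products of top parts, and cancellation has to be faced only in the value
  -- of `degB`.
  top : Grading → ℕ → Poly m n → Poly m n
  top g d = filterᵇ (λ t → grade g (proj₂ t) ≡ᵇ d)

  Bounded : Grading → ℕ → Poly m n → Set
  Bounded g d = All (λ t → grade g (proj₂ t) ≤ d)

  top-++ : ∀ g d p q → top g d (p ++ q) ≡ top g d p ++ top g d q
  top-++ g d p q = List.filter-++ (λ t → T? (grade g (proj₂ t) ≡ᵇ d)) p q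

  top-< : ∀ g {d d′ p} → Bounded g d p → d < d′ → top g d′ p ≡ []
  top-< g [] _ = refl
  top-< g {d} {d′} (_∷_ {x = t} le ps) lt
    rewrite ≢⇒≡ᵇ (<⇒≢ (≤-<-trans le lt)) = top-< g ps lt

  Bounded-map : ∀ g {a d q} t → grade g (proj₂ t) ≤ a → Bounded g d q → Bounded g (a + d) (List.map (mulT t) q)
  Bounded-map g t le [] = []
  Bounded-map g t le (_∷_ {x = u} le′ qs) =
    ≤-trans (≤-reflexive (grade-mul g (proj₂ t) (proj₂ u))) (+-mono-≤ le le′) ∷ Bounded-map g t le qs

  Bounded-⊠ : ∀ g {a d p q} → Bounded g a p → Bounded g d q → Bounded g (a + d) (p ⊠ q)
  Bounded-⊠ g [] qs = []
  Bounded-⊠ g (_∷_ {x = t} le ps) qs = All.++⁺ (Bounded-map g t le qs) (Bounded-⊠ g ps qs)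

  top-map : ∀ g {d} q t → top g (grade g (proj₂ t) + d) (List.map (mulT t) q) ≡ List.map (mulT t) (top g d q)
  top-map g [] t = refl
  top-map g {d} (u ∷ q) t with grade g (proj₂ u) ≟ d
  ... | yes refl rewrite grade-mul g (proj₂ t) (proj₂ u) | ≡ᵇ-refl (grade g (proj₂ t) + grade g (proj₂ u)) | ≡ᵇ-refl (grade g (proj₂ u)) =
        cong (mulT t u ∷_) (top-map g q t)
  ... | no ne rewrite grade-mul g (proj₂ t) (proj₂ u) | ≢⇒≡ᵇ (ne ∘ +-cancelˡ-≡ (grade g (proj₂ t)) _ _) | ≢⇒≡ᵇ ne =
        top-map g q t

  top-⊠ : ∀ g {a d p q} → Bounded g a p → Bounded g d q → top g (a + d) (p ⊠ q) ≡ top g a p ⊠ top g d q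
  top-⊠ g [] qs = refl
  top-⊠ g {a} {d} {q = q} (_∷_ {x = t} {xs = p} le ps) qs with grade g (proj₂ t) ≟ a
  ... | yes refl rewrite ≡ᵇ-refl (grade g (proj₂ t)) =
        trans (top-++ g _ (List.map (mulT t) q) (p ⊠ q)) (cong₂ _++_ (top-map g q t) (top-⊠ g ps qs))
  ... | no ne rewrite ≢⇒≡ᵇ ne =
        trans (top-++ g _ (List.map (mulT t) q) (p ⊠ q))
          (cong₂ _++_ (top-< g (Bounded-map g t ≤-refl qs) (+-monoˡ-< d (≤∧≢⇒< le ne))) (top-⊠ g ps qs))

  Leading : Grading → Expr m n → ℕ → Poly m n → Set
  Leading g p d q = Bounded g d (toPoly p) × top g d (toPoly p) ≡ q

  Leading-1 : ∀ g → Leading g (con 1ℤ) 0 (toPoly (con 1ℤ))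
  Leading-1 g rewrite grade-1 g = ≤-reflexive (grade-1 g) ∷ [] , refl

  Leading-⊗ : ∀ g {p q a d p′ q′} → Leading g p a p′ → Leading g q d q′ → Leading g (p ⊗ q) (a + d) (p′ ⊠ q′)
  Leading-⊗ g (b₁ , refl) (b₂ , refl) = Bounded-⊠ g b₁ b₂ , top-⊠ g b₁ b₂

  raiseT : ℕ → Term m n → Term m n
  raiseT k (c , mono a b x y) = c , mono a (k + b) x y

  raise : ℕ → Poly m n → Poly m n
  raise k = List.map (raiseT k)

  mulT-raise : ∀ k l t u → mulT (raiseT k t) (raiseT l u) ≡ raiseT (k + l) (mulT t u)
  mulT-raise k l (c , mono a b x y) (c′ , mono a′ b′ x′ y′) =
    cong (λ b″ → c ℤ.* c′ , mono (a + a′) b″ (Vec.zipWith _+_ x x′) (Vec.zipWith _+_ y y′)) (+-interchange k b l b′)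

  raise-⊠ : ∀ k l p q → raise k p ⊠ raise l q ≡ raise (k + l) (p ⊠ q)
  raise-⊠ k l [] q = refl
  raise-⊠ k l (t ∷ p) q = trans (cong₂ _++_ (row q) (raise-⊠ k l p q))
    (sym (List.map-++ (raiseT (k + l)) (List.map (mulT t) q) (p ⊠ q)))
    where
    row : ∀ q → List.map (mulT (raiseT k t)) (raise l q) ≡ raise (k + l) (List.map (mulT t) q)
    row [] = refl
    row (u ∷ q) = cong₂ _∷_ (mulT-raise k l t u) (row q)

  monomial : ℕ → ℕ → Poly m n
  monomial a b = (1ℤ , mono a b zeroVec zeroVec) ∷ []

  zeroVec-+ : ∀ {k} (x : Vec ℕ k) → Vec.zipWith _+_ zeroVec x ≡ x
  zeroVec-+ [] = refl
  zeroVec-+ (x ∷ xs) = cong (x ∷_) (zeroVec-+ xs)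

  monomial-⊠ : ∀ a b a′ b′ → monomial a b ⊠ monomial a′ b′ ≡ monomial (a + a′) (b + b′)
  monomial-⊠ a b a′ b′ = cong₂ (λ x y → (1ℤ , mono (a + a′) (b + b′) x y) ∷ []) (zeroVec-+ zeroVec) (zeroVec-+ zeroVec)

  toPoly-B^ : ∀ d → toPoly (Bᴱ {m} {n} ^E d) ≡ monomial 0 d
  toPoly-B^ zero = refl
  toPoly-B^ (suc d) = trans (cong (monomial 0 1 ⊠_) (toPoly-B^ d)) (monomial-⊠ 0 1 0 d)

  monomial-raise : ∀ d p → monomial 0 d ⊠ p ≡ raise d p
  monomial-raise d p = trans (List.++-identityʳ _) (shift p)
    where
    shift : ∀ p → List.map (mulT (1ℤ , mono 0 d zeroVec zeroVec)) p ≡ raise d p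
    shift [] = refl
    shift ((c , mono a b x y) ∷ p) = cong₂ _∷_
      (trans (cong (λ c′ → c′ , _) (ℤ.*-identityˡ c)) (cong₂ (λ x′ y′ → c , mono a (d + b) x′ y′) (zeroVec-+ x) (zeroVec-+ y)))
      (shift p)

  toPoly-B^⊗ : ∀ d p → toPoly ((Bᴱ ^E d) ⊗ p) ≡ raise d (toPoly p)
  toPoly-B^⊗ d p = trans (cong (_⊠ toPoly p) (toPoly-B^ d)) (monomial-raise d (toPoly p))

  -- Coefficients and the degree in `B`

  vecEq⇒≡ : ∀ {k} (x y : Vec ℕ k) → T (vecEq x y) → x ≡ y
  vecEq⇒≡ [] [] _ = refl
  vecEq⇒≡ (a ∷ x) (b ∷ y) h with p , q ← ∧⁻ {a ≡ᵇ b} h = cong₂ _∷_ (≡ᵇ⇒≡ a b p) (vecEq⇒≡ x y q)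

  vecEq-refl : ∀ {k} (x : Vec ℕ k) → vecEq x x ≡ true
  vecEq-refl [] = refl
  vecEq-refl (a ∷ x) rewrite ≡ᵇ-refl a = vecEq-refl x

  monoEq⇒≡ : ∀ (e e′ : Mono m n) → T (monoEq e e′) → e ≡ e′
  monoEq⇒≡ (mono a b x y) (mono a′ b′ x′ y′) h
    with p , h′ ← ∧⁻ {a ≡ᵇ a′} h
    with q , h″ ← ∧⁻ {b ≡ᵇ b′} h′
    with r , s ← ∧⁻ {vecEq x x′} h″
    with refl ← ≡ᵇ⇒≡ a a′ p | refl ← ≡ᵇ⇒≡ b b′ q | refl ← vecEq⇒≡ x x′ r | refl ← vecEq⇒≡ y y′ s = refl

  monoEq-refl : ∀ (e : Mono m n) → monoEq e e ≡ true
  monoEq-refl (mono a b x y) rewrite ≡ᵇ-refl a | ≡ᵇ-refl b | vecEq-refl x | vecEq-refl y = refl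

  coeff-++ : ∀ (p q : Poly m n) e → coeff (p ++ q) e ≡ coeff p e ℤ.+ coeff q e
  coeff-++ [] q e = sym (ℤ.+-identityˡ _)
  coeff-++ (t ∷ p) q e with monoEq (proj₂ t) e
  ... | true = trans (cong (ℤ._+_ (proj₁ t)) (coeff-++ p q e)) (sym (ℤ.+-assoc (proj₁ t) _ _))
  ... | false = coeff-++ p q e

  coeff-zero : ∀ e′ (p : Poly m n) e → coeff ((0ℤ , e′) ∷ p) e ≡ coeff p e
  coeff-zero e′ p e with monoEq e′ e
  ... | true = ℤ.+-identityˡ _
  ... | false = refl

  coeff-∷ : ∀ t (p : Poly m n) e →
    coeff (t ∷ p) e ≡ (if monoEq (proj₂ t) e then proj₁ t ℤ.+ coeff p e else coeff p e)
  coeff-∷ t p e with monoEq (proj₂ t) e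
  ... | true = refl
  ... | false = refl

  top-∷ : ∀ g d t p → top g d (t ∷ p) ≡ (if grade g (proj₂ t) ≡ᵇ d then t ∷ top g d p else top g d p)
  top-∷ g d t p with grade g (proj₂ t) ≡ᵇ d
  ... | true = refl
  ... | false = refl

  coeff-top : ∀ g p e → coeff (top g (grade g e) p) e ≡ coeff p e
  coeff-top g [] e = refl
  coeff-top g (t ∷ p) e rewrite top-∷ g (grade g e) t p | coeff-∷ t p e with grade g (proj₂ t) ≟ grade g e
  ... | yes eq rewrite eq | ≡ᵇ-refl (grade g e) =
        trans (coeff-∷ t (top g (grade g e) p) e)
          (cong (λ c → if monoEq (proj₂ t) e then proj₁ t ℤ.+ c else c) (coeff-top g p e))
  ... | no ne rewrite ≢⇒≡ᵇ ne | ¬T⇒≡ {monoEq (proj₂ t) e} (λ h → ne (cong (grade g) (monoEq⇒≡ (proj₂ t) e h))) =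
        coeff-top g p e

  coeff-> : ∀ g {d p} e → Bounded g d p → d < grade g e → coeff p e ≡ 0ℤ
  coeff-> g {p = p} e b lt = trans (sym (coeff-top g p e)) (cong (λ q → coeff q e) (top-< g {p = p} b lt))

  coeff≢0⇒∈ : ∀ (p : Poly m n) e → coeff p e ≢ 0ℤ → ∃ λ c → (c , e) ∈ p
  coeff≢0⇒∈ [] e ne = ⊥-elim (ne refl)
  coeff≢0⇒∈ (t ∷ p) e ne with monoEq (proj₂ t) e in eq
  ... | true = proj₁ t , here (cong (proj₁ t ,_) (sym (monoEq⇒≡ (proj₂ t) e (≡⇒T eq))))
  ... | false = let c , i = coeff≢0⇒∈ p e ne in c , there i

  private
    maxB : (Term m n → Bool) → Poly m n → ℕ
    maxB f p = foldr _⊔_ 0 (List.map (λ t → eB (proj₂ t)) (filterᵇ f p))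

    maxB-≤ : ∀ f {d p} → Bounded gradeB d p → maxB f p ≤ d
    maxB-≤ f [] = z≤n
    maxB-≤ f (_∷_ {x = t} le ps) with f t
    ... | true = ⊔-lub le (maxB-≤ f ps)
    ... | false = maxB-≤ f ps

    maxB-≥ : ∀ f {t p} → t ∈ p → f t ≡ true → eB (proj₂ t) ≤ maxB f p
    maxB-≥ f {t} (here refl) eq rewrite eq = m≤m⊔n _ _
    maxB-≥ f {t} (there {x = u} i) eq with f u
    ... | true = ≤-trans (maxB-≥ f i eq) (m≤n⊔m (eB (proj₂ u)) _)
    ... | false = maxB-≥ f i eq

  -- `degB` ranges over the terms whose collected coefficient is nonzero, so one monomial of
  -- exponent `d` that survives cancellation is enough to attain the bound.
  degB-≡ : ∀ {d p} e → Bounded gradeB d p → eB e ≡ d → coeff p e ≢ 0ℤ → degB p ≡ d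
  degB-≡ {d} {p} e b refl ne with c , i ← coeff≢0⇒∈ p e ne = ≤-antisym (maxB-≤ f b) (maxB-≥ f i (nonzero {c}))
    where
    f : Term m n → Bool
    f t = not ⌊ coeff p (proj₂ t) ℤ.≟ 0ℤ ⌋
    nonzero : ∀ {c} → f (c , e) ≡ true
    nonzero with coeff p e ℤ.≟ 0ℤ
    ... | yes eq = ⊥-elim (ne eq)
    ... | no _ = refl

  leadB-top : ∀ {d p} e → Bounded gradeB d p → eB e ≡ d → coeff p e ≢ 0ℤ → leadB p ≡ top gradeB d p
  leadB-top {p = p} e b eq ne = cong (λ d → top gradeB d p) (degB-≡ e b eq ne)

-- Leading forms of weights

module _ {m n : ℕ} (x : Fin m) (y : Fin n) where
  private
    xᴱ yᴱ : Expr m n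
    xᴱ = var (varX x)
    yᴱ = var (varY y)

  TileKind : RowType → Tile → Set
  TileKind r t =
    (tileCost r t ≡ 0 × tileWeightS r t xᴱ yᴱ ≡ con 1ℤ ×
      (tileWeight r t xᴱ yᴱ ≡ Aᴱ ⊕ Bᴱ ⊎ tileWeight r t xᴱ yᴱ ≡ Bᴱ ⊖ xᴱ ⊕ yᴱ)) ⊎
    (tileCost r t ≡ 1 × tileWeightS r t xᴱ yᴱ ≡ xᴱ ⊖ yᴱ × tileWeight r t xᴱ yᴱ ≡ Aᴱ ⊕ xᴱ ⊖ yᴱ)

  tileKind : ∀ r t → TileKind r t
  tileKind 𝗐 blank = inj₁ (refl , refl , inj₂ refl)
  tileKind 𝗐 hor = inj₂ (refl , refl , refl)
  tileKind 𝗐 ver = inj₂ (refl , refl , refl)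
  tileKind 𝗐 crs = inj₂ (refl , refl , refl)
  tileKind 𝗐 elWN = inj₁ (refl , refl , inj₁ refl)
  tileKind 𝗐 elSE = inj₁ (refl , refl , inj₁ refl)
  tileKind 𝗐 elEN = inj₁ (refl , refl , inj₁ refl)
  tileKind 𝗐 elSW = inj₁ (refl , refl , inj₁ refl)
  tileKind 𝗐 dbW = inj₁ (refl , refl , inj₁ refl)
  tileKind 𝗐 dbE = inj₁ (refl , refl , inj₁ refl)
  tileKind 𝖾 blank = inj₂ (refl , refl , refl)
  tileKind 𝖾 hor = inj₁ (refl , refl , inj₂ refl)
  tileKind 𝖾 ver = inj₁ (refl , refl , inj₂ refl)
  tileKind 𝖾 crs = inj₁ (refl , refl , inj₂ refl)
  tileKind 𝖾 elWN = inj₁ (refl , refl , inj₁ refl)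
  tileKind 𝖾 elSE = inj₁ (refl , refl , inj₁ refl)
  tileKind 𝖾 elEN = inj₁ (refl , refl , inj₁ refl)
  tileKind 𝖾 elSW = inj₁ (refl , refl , inj₁ refl)
  tileKind 𝖾 dbW = inj₁ (refl , refl , inj₁ refl)
  tileKind 𝖾 dbE = inj₁ (refl , refl , inj₁ refl)

  -- Here the substitution of `A + x` for `x` arises: a tile of cost 1 has the weight `A + x - y`,
  -- free of `B`, which is the shifted factor `x - y` of `S`. A tile of cost 0 has top part `B`
  -- against a factor 1 in `S`.
  tile-leadingB : ∀ r t → let b = 1 ∸ tileCost r t in
    Leading gradeB (tileWeight r t xᴱ yᴱ) b (raise b (toPoly (substE shiftX (tileWeightS r t xᴱ yᴱ))))
  tile-leadingB r t with tileKind r t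
  ... | inj₁ (c , s , inj₁ w) rewrite c | s | w = z≤n ∷ ≤-refl ∷ [] , refl
  ... | inj₁ (c , s , inj₂ w) rewrite c | s | w = ≤-refl ∷ z≤n ∷ z≤n ∷ [] , refl
  ... | inj₂ (c , s , w) rewrite c | s | w = z≤n ∷ z≤n ∷ z≤n ∷ [] , refl

  tile-leadingA+2B : ∀ r t → let c = tileCost r t ; b = 1 ∸ c in
    Leading gradeA+2B (tileWeight r t xᴱ yᴱ) (c + (b + b)) (monomial c b)
  tile-leadingA+2B r t with tileKind r t
  ... | inj₁ (c , s , inj₁ w) rewrite c | w = s≤s z≤n ∷ ≤-refl ∷ [] , refl
  ... | inj₁ (c , s , inj₂ w) rewrite c | w = ≤-refl ∷ z≤n ∷ z≤n ∷ [] , refl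
  ... | inj₂ (c , s , w) rewrite c | w = ≤-refl ∷ z≤n ∷ z≤n ∷ [] , refl

-- `R p q c b` relates a weight `p` and a companion product `q` to a cost `c` and a degree `b`; one
-- induction over the grid then yields the leading forms for both gradings.
module Products {m n : ℕ} (R : Expr m n → Expr m n → ℕ → ℕ → Set) (R-1 : R (con 1ℤ) (con 1ℤ) 0 0)
  (R-⊗ : ∀ {p p′ q q′ c c′ b b′} → R p q c b → R p′ q′ c′ b′ → R (p ⊗ p′) (q ⊗ q′) (c + c′) (b + b′)) where

  R-applyUpTo : ∀ k (f h : ℕ → Expr m n) c b → (∀ i → i < k → R (f i) (h i) (c i) (b i)) →
    R (prodE (List.applyUpTo f k)) (prodE (List.applyUpTo h k)) (∑ k c) (∑ k b)
  R-applyUpTo zero f h c b r = R-1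
  R-applyUpTo (suc k) f h c b r =
    R-⊗ (r 0 z<s) (R-applyUpTo k (f ∘ suc) (h ∘ suc) (c ∘ suc) (b ∘ suc) (λ i i<k → r (suc i) (s<s i<k)))

  R-upTo : ∀ k (f h : ℕ → Expr m n) c b → (∀ i → i < k → R (f i) (h i) (c i) (b i)) →
    R (prodE (List.map f (upTo k))) (prodE (List.map h (upTo k))) (∑ k c) (∑ k b)
  R-upTo k f h c b r rewrite List.map-upTo f k | List.map-upTo h k = R-applyUpTo k f h c b r

cellCost : ∀ {m n} → Vec RowType m → PD m n → ℕ → ℕ → ℕ
cellCost β D i j = maybe (tileCost (rowType β i)) 0 (tileAt D i j)

gridCost degree : ∀ {m n} → Vec RowType m → PD m n → ℕ
gridCost {m} {n} β D = ∑ m (λ i → ∑ n (cellCost β D i))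
degree {m} {n} β D = ∑ m (λ i → ∑ n (λ j → 1 ∸ cellCost β D i j))

cellCost≤1 : ∀ {m n} (β : Vec RowType m) (D : PD m n) i j → cellCost β D i j ≤ 1
cellCost≤1 β D i j with tileAt D i j
... | nothing = z≤n
... | just t with rowType β i
...   | 𝗐 = 𝟙≤1 (isStraight t)
...   | 𝖾 = 𝟙≤1 (isBlank t)

degree+gridCost : ∀ {m n} (β : Vec RowType m) (D : PD m n) → degree β D + gridCost β D ≡ m * n
degree+gridCost {m} {n} β D = trans (sym (∑-+ m _ _)) (trans (∑-cong m (λ i _ → trans (sym (∑-+ n _ _))
  (trans (∑-cong n (λ j _ → m∸n+n≡m (cellCost≤1 β D i j))) (trans (∑-const n 1) (*-identityʳ n))))) (∑-const m n))

rowSum-cost : ∀ {M τ n w e} {r : Vec Tile n} {v u} (rl : RowLabels M τ w r v u e) →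
  rowSum cost rl ≡ ∑ n (λ j → maybe (tileCost τ) 0 (nth r j))
rowSum-cost [] = refl
rowSum-cost {τ = τ} (_∷_ {t = t} _ rl) = cong (tileCost τ t +_) (rowSum-cost rl)

sumL-cost : ∀ {M m n β ps u} {D : PD m n} (ld : Labelling M β ps D u) → sumL cost ld ≡ gridCost β D
sumL-cost [] = refl
sumL-cost (rl ◂ ld) = cong₂ _+_ (rowSum-cost rl) (sumL-cost ld)

xE-< : ∀ {m n k} → k < m → ∃ λ x → xE {m} {n} k ≡ var (varX x)
xE-< {m} {k = k} k<m with k <? m
... | yes p = fromℕ< p , refl
... | no ¬p = ⊥-elim (¬p k<m)

yE-< : ∀ {m n j} → j < n → ∃ λ y → yE {m} {n} j ≡ var (varY y)
yE-< {n = n} {j} j<n with j <? n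
... | yes p = fromℕ< p , refl
... | no ¬p = ⊥-elim (¬p j<n)

module _ {m n} (β : Vec RowType m) (D : PD m n) where

  cellWeight : (RowType → Tile → Expr m n → Expr m n → Expr m n) → ℕ → ℕ → Expr m n
  cellWeight w i j = maybe (λ t → w (rowType β i) t (xE (φ β i)) (yE j)) (con 1ℤ) (tileAt D i j)

  weight-leadingB : Leading gradeB (weight β D) (degree β D) (raise (degree β D) (toPoly (substE shiftX (weightS β D))))
  weight-leadingB = R-upTo m _ _ (λ i → ∑ n (cellCost β D i)) _
    (λ i i<m → R-upTo n _ _ (cellCost β D i) _ (λ j j<n → cell i i<m j j<n))
    where
    open Products {m} {n} (λ p q _ b → Leading gradeB p b (raise b (toPoly (substE shiftX q)))) (Leading-1 gradeB)
      (λ {p} {p′} {q} {q′} {b = b} {b′} l l′ → subst (Leading gradeB (p ⊗ p′) (b + b′))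
        (raise-⊠ b b′ (toPoly (substE shiftX q)) (toPoly (substE shiftX q′))) (Leading-⊗ gradeB {p} {p′} l l′))
    cell : ∀ i → i < m → ∀ j → j < n → let b = 1 ∸ cellCost β D i j in
      Leading gradeB (cellWeight tileWeight i j) b (raise b (toPoly (substE shiftX (cellWeight tileWeightS i j))))
    cell i i<m j j<n
      with t , eq ← <⇒tileAt D i<m j<n
      with x , eqx ← xE-< {m} {n} (φ-bounded β i i<m) | y , eqy ← yE-< {m} {n} j<n
      rewrite eq | eqx | eqy = tile-leadingB x y (rowType β i) t

  weight-leadingA+2B : Leading gradeA+2B (weight β D) (gridCost β D + (degree β D + degree β D)) (monomial (gridCost β D) (degree β D))
  weight-leadingA+2B = R-upTo m _ (λ _ → con 1ℤ) (λ i → ∑ n (cellCost β D i)) _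
    (λ i i<m → R-upTo n _ (λ _ → con 1ℤ) (cellCost β D i) _ (λ j j<n → cell i i<m j j<n))
    where
    regroup : ∀ c c′ b b′ → c + (b + b) + (c′ + (b′ + b′)) ≡ c + c′ + (b + b′ + (b + b′))
    regroup = solve-∀
    open Products {m} {n} (λ p _ c b → Leading gradeA+2B p (c + (b + b)) (monomial c b)) (Leading-1 gradeA+2B)
      (λ {p} {p′} {c = c} {c′} {b} {b′} l l′ → subst₂ (Leading gradeA+2B (p ⊗ p′))
        (regroup c c′ b b′) (monomial-⊠ c b c′ b′) (Leading-⊗ gradeA+2B {p} {p′} l l′))
    cell : ∀ i → i < m → ∀ j → j < n → let c = cellCost β D i j ; b = 1 ∸ cellCost β D i j in
      Leading gradeA+2B (cellWeight tileWeight i j) (c + (b + b)) (monomial c b)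
    cell i i<m j j<n
      with t , eq ← <⇒tileAt D i<m j<n
      with x , eqx ← xE-< {m} {n} (φ-bounded β i i<m) | y , eqy ← yE-< {m} {n} j<n
      rewrite eq | eqx | eqy = tile-leadingA+2B x y (rowType β i) t

-- The leading form of the sum

module LeadingSum {m n : ℕ} {A : Set} (gen cond : A → Bool) (w wS : A → Expr m n) (M : Mono m n)
  (bounded : ∀ D → T (gen D) → Bounded gradeB (eB M) (toPoly (w D)))
  (leading : ∀ D → T (gen D) → T (cond D) → top gradeB (eB M) (toPoly (w D)) ≡ raise (eB M) (toPoly (substE shiftX (wS D))))
  (nothing-leading : ∀ D → T (gen D) → T (not (cond D)) → top gradeB (eB M) (toPoly (w D)) ≡ [])
  (unit : ∀ D → T (gen D) → T (cond D) → coeff (toPoly (w D)) M ≡ 1ℤ) where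

  private
    d : ℕ
    d = eB M

  nongen : A → Bool
  nongen D = gen D ∧ cond D

  total totalS : List A → Expr m n
  total L = sumE (List.map w (filterᵇ gen L))
  totalS L = sumE (List.map wS (filterᵇ nongen L))

  total-bounded : ∀ L → Bounded gradeB d (toPoly (total L))
  total-bounded [] = z≤n ∷ []
  total-bounded (D ∷ L) with gen D in eq
  ... | true = All.++⁺ (bounded D (≡⇒T eq)) (total-bounded L)
  ... | false = total-bounded L

  coeff-top-++ : ∀ (p q : Poly m n) e → coeff (top gradeB d (p ++ q)) e ≡ coeff (top gradeB d p) e ℤ.+ coeff (top gradeB d q) e
  coeff-top-++ p q e = trans (cong (λ r → coeff r e) (top-++ gradeB d p q)) (coeff-++ (top gradeB d p) _ e)

  total-leading : ∀ L e → coeff (top gradeB d (toPoly (total L))) e ≡ coeff (raise d (toPoly (substE shiftX (totalS L)))) e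
  total-leading [] e = trans zeroˡ (sym (coeff-zero (mono 0 (d + 0) zeroVec zeroVec) [] e))
    where
    -- The empty sum is a one-term list with coefficient 0, and `top` keeps that term when `d` is 0.
    zeroˡ : coeff (top gradeB d ((0ℤ , mono1) ∷ [])) e ≡ 0ℤ
    zeroˡ with 0 ≡ᵇ d
    ... | true = coeff-zero mono1 [] e
    ... | false = refl
  total-leading (D ∷ L) e with gen D in eqg | cond D in eqc
  ... | false | _ = total-leading L e
  ... | true | false = trans (coeff-top-++ (toPoly (w D)) (toPoly (total L)) e)
        (trans (cong₂ ℤ._+_ (cong (λ q → coeff q e) (nothing-leading D (≡⇒T eqg) (Equivalence.from T-not-≡ eqc))) (total-leading L e)) (ℤ.+-identityˡ _))
  ... | true | true = trans (coeff-top-++ (toPoly (w D)) (toPoly (total L)) e)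
        (trans (cong₂ ℤ._+_ (cong (λ q → coeff q e) (leading D (≡⇒T eqg) (≡⇒T eqc))) (total-leading L e))
          (sym (trans (cong (λ q → coeff q e) (List.map-++ (raiseT d) (toPoly (substE shiftX (wS D))) _))
            (coeff-++ (raise d (toPoly (substE shiftX (wS D)))) _ e))))

  -- Each nongeneric summand contributes 1 and the others 0, so the coefficient is a count and is
  -- nonzero as soon as one such pipe dream exists.
  total-coeff : ∀ L → coeff (toPoly (total L)) M ≡ ℤ.+ countᵇ nongen L
  total-coeff [] = coeff-zero mono1 [] M
  total-coeff (D ∷ L) with gen D in eqg | cond D in eqc
  ... | false | _ = total-coeff L
  ... | true | false = trans (coeff-++ (toPoly (w D)) (toPoly (total L)) M)
        (trans (cong₂ ℤ._+_ (trans (sym (coeff-top gradeB (toPoly (w D)) M))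
          (cong (λ q → coeff q M) (nothing-leading D (≡⇒T eqg) (Equivalence.from T-not-≡ eqc)))) (total-coeff L)) (ℤ.+-identityˡ _))
  ... | true | true = trans (coeff-++ (toPoly (w D)) (toPoly (total L)) M)
        (cong₂ ℤ._+_ (unit D (≡⇒T eqg) (≡⇒T eqc)) (total-coeff L))

countᵇ-∈ : ∀ {A : Set} (p : A → Bool) {x xs} → x ∈ xs → T (p x) → 1 ≤ countᵇ p xs
countᵇ-∈ p (here refl) h rewrite T⇒≡ h = s≤s z≤n
countᵇ-∈ p (there {x = y} i) h = m≤n⇒m≤o+n (𝟙 (p y)) (countᵇ-∈ p i h)

∈-allVecs : ∀ {A : Set} {xs : List A} {k} (v : Vec A k) → (∀ i → lookup v i ∈ xs) → v ∈ allVecs k xs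
∈-allVecs [] h = here refl
∈-allVecs (x ∷ v) h = ∈-concatMap⁺ _ (Any.map (λ { refl → ∈-map⁺ (x ∷_) (∈-allVecs v (h ∘ suc)) }) (h zero))

∈-allTiles : ∀ t → t ∈ allTiles
∈-allTiles blank = here refl
∈-allTiles hor = there (here refl)
∈-allTiles ver = there (there (here refl))
∈-allTiles crs = there (there (there (here refl)))
∈-allTiles elWN = there (there (there (there (here refl))))
∈-allTiles elSE = there (there (there (there (there (here refl)))))
∈-allTiles elEN = there (there (there (there (there (there (here refl))))))
∈-allTiles elSW = there (there (there (there (there (there (there (here refl)))))))
∈-allTiles dbW = there (there (there (there (there (there (there (there (here refl))))))))
∈-allTiles dbE = there (there (there (there (there (there (there (there (there (here refl)))))))))

∈-allPD : ∀ {m n} (D : PD m n) → D ∈ allPD m n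
∈-allPD D = ∈-allVecs D (λ i → ∈-allVecs (lookup D i) (λ j → ∈-allTiles _))

m≡o∸n : ∀ {m n o} → m + n ≡ o → m ≡ o ∸ n
m≡o∸n {m} {n} refl = sym (m+n∸n≡m m n)

m≤o∸k : ∀ {m n o k x} → m + n ≡ o → k + x ≡ n → m ≤ o ∸ k
m≤o∸k {m} {k = k} {x} refl refl = subst (m ≤_) (m≡o∸n (regroup m k x)) (m≤m+n m x)
  where
  regroup : ∀ m k x → m + x + k ≡ m + (k + x)
  regroup = solve-∀

m<o∸k : ∀ {m n o k x} → m + n ≡ o → k + x ≡ n → x ≢ 0 → m < o ∸ k
m<o∸k {x = zero} _ _ x≢0 = ⊥-elim (x≢0 refl)
m<o∸k {m} {k = k} {suc x} refl refl _ = m≤o∸k {suc m} {k + x} {k = k} {x} (regroup m k x) refl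
  where
  regroup : ∀ m k x → suc m + (k + x) ≡ m + (k + suc x)
  regroup = solve-∀

module _ {m n} (π : Fin (suc m) → Fin (suc n)) (inj : Injective _≡_ _≡_ π) (β : Vec RowType (suc m)) where

  private
    so : Sorted (suc m) β (φs β)
    so = φ-sorted β

  -- The witness `x` is the total excess of the labelling, whose vanishing is equivalent to the
  -- nongeneric conditions.
  generic-cost : ∀ D → T (isGeneric β π D) → ∃ λ x → lengthHat π + x ≡ gridCost β D ×
    (T (nongenericConditions β D) → x ≡ 0) × (x ≡ 0 → T (nongenericConditions β D))
  generic-cost D gen
    with ok , conn ← ∧⁻ {valid β D} gen
    with u , ld , _ ← label-grid β D so (IndexOK⇒GridOK (valid⇒IndexOK β D ok)) =
    sumL excess ld ,
    trans (cong (_+ sumL excess ld) (lengthHat≡inv inj (connected⇒Word so (φs-lookup β) ld conn)))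
      (trans (inv+excess≡cost so ld) (sumL-cost ld)) ,
    conditions⇒excess≡0 so (Sorted-onto so) ld ,
    excess≡0⇒conditions so ld

  nongeneric-exists : ∃ λ D → T (isNongeneric β π D)
  nongeneric-exists
    with word ← wordOf-Word inj
    with D , ld , eq ← construct β (wordOf π) so (lookup-Word word)
           (λ a a<m → trans (count-Word inj word a a<m) (sym (count-Sorted so a a<m))) =
    D , ∧⁺ {isGeneric β π D}
      (∧⁺ {valid β D} (IndexOK⇒valid β D (GridOK⇒IndexOK β D (Labelling⇒GridOK so ld)))
        (Word⇒connected so (φs-lookup β) ld word))
      (excess≡0⇒conditions so ld eq)

  leadDegree : ℕ
  leadDegree = suc m * suc n ∸ lengthHat π

  nongeneric-gridCost : ∀ D → T (isGeneric β π D) → T (nongenericConditions β D) → gridCost β D ≡ lengthHat π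
  nongeneric-gridCost D gen cond = let x , eq , zero-excess , _ = generic-cost D gen in
    trans (sym eq) (trans (cong (lengthHat π +_) (zero-excess cond)) (+-identityʳ _))

  nongeneric-degree : ∀ D → T (isGeneric β π D) → T (nongenericConditions β D) → degree β D ≡ leadDegree
  nongeneric-degree D gen cond = trans (m≡o∸n {n = gridCost β D} (degree+gridCost β D)) (cong (suc m * suc n ∸_) (nongeneric-gridCost D gen cond))

  generic-degree : ∀ D → T (isGeneric β π D) → T (not (nongenericConditions β D)) → degree β D < leadDegree
  generic-degree D gen ¬cond = let x , eq , _ , conditions = generic-cost D gen in
    m<o∸k {n = gridCost β D} {k = lengthHat π} (degree+gridCost β D) eq
      (λ x≡0 → subst T (Equivalence.to T-not-≡ ¬cond) (conditions x≡0))

  generic-degree≤ : ∀ D → T (isGeneric β π D) → degree β D ≤ leadDegree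
  generic-degree≤ D gen = m≤o∸k {n = gridCost β D} {k = lengthHat π} (degree+gridCost β D) (proj₁ (proj₂ (generic-cost D gen)))

  -- The monomial A^ℓ(π̂) B^(mn − ℓ(π̂)) has coefficient 1 in the weight of every nongeneric pipe dream
  -- and 0 in the other weights, which rules out cancellation in the B-leading form of G.
  witness : Mono (suc m) (suc n)
  witness = mono (lengthHat π) leadDegree zeroVec zeroVec

  weight-bounded : ∀ D → T (isGeneric β π D) → Bounded gradeB leadDegree (toPoly (weight β D))
  weight-bounded D gen = All.map (λ le → ≤-trans le (generic-degree≤ D gen)) (proj₁ (weight-leadingB β D))

  weight-leading : ∀ D → T (isGeneric β π D) → T (nongenericConditions β D) →
    top gradeB leadDegree (toPoly (weight β D)) ≡ raise leadDegree (toPoly (substE shiftX (weightS β D)))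
  weight-leading D gen cond = subst (λ d → top gradeB d (toPoly (weight β D)) ≡ raise d (toPoly (substE shiftX (weightS β D))))
    (nongeneric-degree D gen cond) (proj₂ (weight-leadingB β D))

  weight-nothing-leading : ∀ D → T (isGeneric β π D) → T (not (nongenericConditions β D)) →
    top gradeB leadDegree (toPoly (weight β D)) ≡ []
  weight-nothing-leading D gen ¬cond = top-< gradeB (proj₁ (weight-leadingB β D)) (generic-degree D gen ¬cond)

  weight-witness : ∀ D → T (isGeneric β π D) → T (nongenericConditions β D) → coeff (toPoly (weight β D)) witness ≡ 1ℤ
  weight-witness D gen cond = begin
    coeff (toPoly (weight β D)) witness
      -- The `A + 2B`-grade of `witness` is the top grade of the weight, and the top part there is
      -- this one monomial.
      ≡⟨ sym (coeff-top gradeA+2B (toPoly (weight β D)) witness) ⟩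
    coeff (top gradeA+2B (lengthHat π + (leadDegree + leadDegree)) (toPoly (weight β D))) witness
      ≡⟨ cong (λ q → coeff q witness) (subst₂ (λ c b → top gradeA+2B (c + (b + b)) (toPoly (weight β D)) ≡ monomial c b)
           (nongeneric-gridCost D gen cond) (nongeneric-degree D gen cond) (proj₂ (weight-leadingA+2B β D))) ⟩
    coeff (monomial (lengthHat π) leadDegree) witness
      ≡⟨ coeff-∷ (1ℤ , witness) [] witness ⟩
    (if monoEq witness witness then 1ℤ ℤ.+ 0ℤ else 0ℤ)
      ≡⟨ cong (λ b → if b then 1ℤ ℤ.+ 0ℤ else 0ℤ) (monoEq-refl witness) ⟩
    1ℤ ∎
    where open ≡-Reasoning

  open LeadingSum (isGeneric β π) (nongenericConditions β) (weight β) (weightS β) witness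
    weight-bounded weight-leading weight-nothing-leading weight-witness

  G-leading : leadB (toPoly (G β π)) ≈P toPoly ((Bᴱ ^E leadDegree) ⊗ substE shiftX (Sβ β π))
  G-leading e = begin
    coeff (leadB (toPoly (G β π))) e
      ≡⟨ cong (λ q → coeff q e) (leadB-top witness (total-bounded L) refl nonzero) ⟩
    coeff (top gradeB leadDegree (toPoly (G β π))) e
      ≡⟨ total-leading L e ⟩
    coeff (raise leadDegree (toPoly (substE shiftX (Sβ β π)))) e
      ≡⟨ cong (λ q → coeff q e) (sym (toPoly-B^⊗ leadDegree (substE shiftX (Sβ β π)))) ⟩
    coeff (toPoly ((Bᴱ ^E leadDegree) ⊗ substE shiftX (Sβ β π))) e ∎
    where
    open ≡-Reasoning
    L : List (PD (suc m) (suc n))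
    L = allPD (suc m) (suc n)
    nonzero : coeff (toPoly (G β π)) witness ≢ 0ℤ
    nonzero eq = let D , good = nongeneric-exists in
      <⇒≢ (countᵇ-∈ (isNongeneric β π) (∈-allPD D) good) (sym (ℤ.+-injective (trans (sym (total-coeff L)) eq)))

  generic-no-contribution : ∀ D → T (isGeneric β π D) → T (not (nongenericConditions β D)) →
    ∀ e → leadDegree ≤ eB e → coeff (toPoly (weight β D)) e ≡ 0ℤ
  generic-no-contribution D gen ¬cond e le =
    coeff-> gradeB e (proj₁ (weight-leadingB β D)) (<-≤-trans (generic-degree D gen ¬cond) le)

  nongeneric-leading : ∀ D → T (isNongeneric β π D) →
    leadB (toPoly (weight β D)) ≈P toPoly ((Bᴱ ^E leadDegree) ⊗ substE shiftX (weightS β D))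
  nongeneric-leading D good e = cong (λ q → coeff q e) (begin
    leadB (toPoly (weight β D))
      ≡⟨ leadB-top witness (weight-bounded D gen) refl (λ eq → 1≢0 (trans (sym (weight-witness D gen cond)) eq)) ⟩
    top gradeB leadDegree (toPoly (weight β D))
      ≡⟨ weight-leading D gen cond ⟩
    raise leadDegree (toPoly (substE shiftX (weightS β D)))
      ≡⟨ sym (toPoly-B^⊗ leadDegree (substE shiftX (weightS β D))) ⟩
    toPoly ((Bᴱ ^E leadDegree) ⊗ substE shiftX (weightS β D)) ∎)
    where
    open ≡-Reasoning
    gen : T (isGeneric β π D)
    gen = proj₁ (∧⁻ {isGeneric β π D} good)
    cond : T (nongenericConditions β D)
    cond = proj₂ (∧⁻ {isGeneric β π D} good)
    1≢0 : 1ℤ ≢ 0ℤ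
    1≢0 ()

theorem4p5 : ∀ {m n} → 1 ≤ m → m ≤ n
    → (π : Fin m → Fin n) → Injective _≡_ _≡_ π
    → (β : Vec RowType m)
    → (leadB (toPoly (G β π))
         ≈P toPoly ((Bᴱ ^E (m * n ∸ lengthHat π)) ⊗ substE shiftX (Sβ β π)))
      × (∀ (D : PD m n) → T (isGeneric β π D) → T (not (nongenericConditions β D))
           → ∀ e → m * n ∸ lengthHat π ≤ eB e → coeff (toPoly (weight β D)) e ≡ 0ℤ)
      × (∀ (D : PD m n) → T (isNongeneric β π D)
           → leadB (toPoly (weight β D))
               ≈P toPoly ((Bᴱ ^E (m * n ∸ lengthHat π)) ⊗ substE shiftX (weightS β D)))
-- Matching turns `m` and `n` into successors, so that `m ∸ 1` and `n ∸ 1` in `valid` are genuine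
-- last indices.
theorem4p5 (s≤s z≤n) (s≤s _) π inj β =
  G-leading π inj β , generic-no-contribution π inj β , nongeneric-leading π inj β
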